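{- Let $A$ be a finite nonempty subset of $\mathbb{R}\setminus\{0\}$. Then \[ |AA|\gtrsim E_3^+(A)^{4/3}|A|^{ -10/3}. \]
   Context: $AA=\{ab:a,b\in A\}$. $E_3^+(A)=\sum_x r_{A-A}(x)^3$ where $r_{A-A}(x)=\#\{(a,b)\in A\times A: a-b=x\}$. Notation: $X\lesssim Y$ means $X\le C\,Y(\log(2+|A|))^{c}$ for absolute constants $C,c>0$; $X\gtrsim Y$ means $Y\lesssim X$. -}

module Defs where

open import Data.Nat.Base as ℕ using (ℕ; zero; suc; NonZero; z≤n; s≤s)
import Data.Nat.Properties as ℕP
open import Data.Nat.Solver renaming (module +-*-Solver to ℕ-Solver)
open import Data.Integer.Base as ℤ using (ℤ)
import Data.Integer.Properties as ℤP
open import Data.Rational.Base hiding (NonZero)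
open import Data.Rational.Properties
open import Data.Rational.Solver renaming (module +-*-Solver to ℚ-Solver)
import Data.Rational.Unnormalised.Base as ℚᵘ
import Data.Rational.Unnormalised.Properties as ℚᵘP
open import Data.List.Base using (List; length; map)
open import Data.Nat.ListAction using (sum)
import Data.List.Membership.Setoid as Membership
open import Data.List.Relation.Binary.Pointwise using (Pointwise)
import Data.List.Relation.Unary.Unique.Setoid as UniqueSetoid
open import Data.Product.Base using (∃; ∃₂; _×_; _,_)
open import Data.Product.Relation.Binary.Pointwise.NonDependent using (×-setoid)
open import Data.Sum.Base using (inj₁; inj₂)
open import Function.Base using (_∘_; it)
open import Function.Bundles using (_⇔_)
open import Level using (0ℓ)
open import Relation.Binary.Bundles using (Setoid)
open import Relation.Binary.PropositionalEquality
open import Relation.Nullary using (¬_; yes; no; contradiction)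
open import Relation.Unary using (Pred; Decidable)

infixl 7 _//_

_//_ : (a b : ℕ) .{{_ : NonZero b}} → ℚ
a // b = ℤ.+ a / b

frac-≤ : ∀ a b c d .{{_ : NonZero b}} .{{_ : NonZero d}} →
         a ℕ.* d ℕ.≤ c ℕ.* b → a // b ≤ c // d
frac-≤ a b@(suc b-1) c d@(suc d-1) ad≤cb = toℚᵘ-cancel-≤ (begin
  toℚᵘ (a // b)     ≃⟨ toℚᵘ-fromℚᵘ (ℚᵘ.mkℚᵘ (ℤ.+ a) b-1) ⟩
  ℚᵘ.mkℚᵘ (ℤ.+ a) b-1  ≤⟨ ℚᵘ.*≤* (subst₂ ℤ._≤_ (ℤP.pos-* a d) (ℤP.pos-* c b)
                                  (ℤ.+≤+ ad≤cb)) ⟩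
  ℚᵘ.mkℚᵘ (ℤ.+ c) d-1  ≃⟨ ℚᵘP.≃-sym (toℚᵘ-fromℚᵘ (ℚᵘ.mkℚᵘ (ℤ.+ c) d-1)) ⟩
  toℚᵘ (c // d)     ∎)
  where open ℚᵘP.≤-Reasoning

frac-+ : ∀ a b c d .{{_ : NonZero b}} .{{_ : NonZero d}} .{{_ : NonZero (b ℕ.* d)}} →
         a // b + c // d ≡ (a ℕ.* d ℕ.+ c ℕ.* b) // (b ℕ.* d)
frac-+ a b@(suc b-1) c d@(suc d-1) = toℚᵘ-injective (begin-equality
  toℚᵘ (a // b + c // d)
    ≃⟨ toℚᵘ-homo-+ (a // b) (c // d) ⟩
  toℚᵘ (a // b) ℚᵘ.+ toℚᵘ (c // d)
    ≃⟨ ℚᵘP.+-cong (toℚᵘ-fromℚᵘ (ℚᵘ.mkℚᵘ (ℤ.+ a) b-1)) (toℚᵘ-fromℚᵘ (ℚᵘ.mkℚᵘ (ℤ.+ c) d-1)) ⟩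
  ℚᵘ.mkℚᵘ (ℤ.+ a) b-1 ℚᵘ.+ ℚᵘ.mkℚᵘ (ℤ.+ c) d-1
    ≃⟨ ℚᵘP.≃-reflexive (cong (λ z → ℚᵘ.mkℚᵘ z _)
         (trans (cong₂ ℤ._+_ (sym (ℤP.pos-* a d)) (sym (ℤP.pos-* c b)))
                (sym (ℤP.pos-+ (a ℕ.* d) (c ℕ.* b))))) ⟩
  ℚᵘ.mkℚᵘ (ℤ.+ (a ℕ.* d ℕ.+ c ℕ.* b)) _
    ≃⟨ ℚᵘP.≃-sym (toℚᵘ-fromℚᵘ (ℚᵘ.mkℚᵘ (ℤ.+ (a ℕ.* d ℕ.+ c ℕ.* b)) _)) ⟩
  toℚᵘ ((a ℕ.* d ℕ.+ c ℕ.* b) // (b ℕ.* d)) ∎)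
  where open ℚᵘP.≤-Reasoning

frac-+ˢ : ∀ a c d .{{_ : NonZero d}} → a // d + c // d ≡ (a ℕ.+ c) // d
frac-+ˢ a c d = ≤-antisym
  (≤-trans (≤-reflexive (frac-+ a d c d))
    (frac-≤ (a ℕ.* d ℕ.+ c ℕ.* d) (d ℕ.* d) (a ℕ.+ c) d (ℕP.≤-reflexive eq)))
  (≤-trans (frac-≤ (a ℕ.+ c) d (a ℕ.* d ℕ.+ c ℕ.* d) (d ℕ.* d) (ℕP.≤-reflexive (sym eq)))
    (≤-reflexive (sym (frac-+ a d c d))))
  where
  instance _ = ℕP.m*n≢0 d d
  eq : (a ℕ.* d ℕ.+ c ℕ.* d) ℕ.* d ≡ (a ℕ.+ c) ℕ.* (d ℕ.* d)
  eq = solve 3 (λ a c d → (a :* d :+ c :* d) :* d := (a :+ c) :* (d :* d)) refl a c d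
    where open ℕ-Solver

nonNeg-frac : ∀ a b .{{_ : NonZero b}} → 0ℚ ≤ a // b
nonNeg-frac a b = frac-≤ 0 1 a b z≤n

archimedean : ∀ {ε} → 0ℚ < ε → ∃ λ N → ∀ {n} → N ℕ.≤ n → 1 // suc n ≤ ε
archimedean {ε@(mkℚ (ℤ.+ suc p) d _)} _ = d , λ {n} d≤n →
  subst (1 // suc n ≤_) (↥p/↧p≡p ε)
    (frac-≤ 1 (suc n) (suc p) (suc d)
      (ℕP.*-mono-≤ {1} {suc p} (s≤s z≤n) (s≤s d≤n)))
archimedean {mkℚ (ℤ.+ zero) _ _} (*<* (ℤ.+<+ ()))
archimedean {mkℚ (ℤ.-[1+ _ ]) _ _} (*<* ())

½-pos : ∀ {ε} → 0ℚ < ε → 0ℚ < ½ * ε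
½-pos {ε} 0<ε = positive⁻¹ (½ * ε) {{pos*pos⇒pos ½ ε {{positive 0<ε}}}}

½+½ : ∀ ε → ½ * ε + ½ * ε ≡ ε
½+½ ε = trans (sym (*-distribʳ-+ ε ½ ½)) (*-identityˡ ε)

∣p-q∣-sym : ∀ p q → ∣ p - q ∣ ≡ ∣ q - p ∣
∣p-q∣-sym p q = trans (cong ∣_∣ eq) (∣-p∣≡∣p∣ (q - p))
  where
  open ℚ-Solver
  eq : p - q ≡ - (q - p)
  eq = solve 2 (λ p q → p :- q := :- (q :- p)) refl p q

dist-triangle : ∀ p q r → ∣ p - r ∣ ≤ ∣ p - q ∣ + ∣ q - r ∣
dist-triangle p q r = subst (_≤ ∣ p - q ∣ + ∣ q - r ∣) (cong ∣_∣ eq)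
                            (∣p+q∣≤∣p∣+∣q∣ (p - q) (q - r))
  where
  open ℚ-Solver
  eq : (p - q) + (q - r) ≡ p - r
  eq = solve 3 (λ p q r → (p :- q) :+ (q :- r) := p :- r) refl p q r

dist-≤ : ∀ {p q r} → p ≤ q + r → q ≤ p + r → ∣ p - q ∣ ≤ r
dist-≤ {p} {q} {r} p≤q+r q≤p+r with ∣p∣≡p∨∣p∣≡-p (p - q)
... | inj₁ eq = subst₂ _≤_ (sym eq)
                  (solve 2 (λ q r → (q :+ r) :- q := r) refl q r)
                  (+-monoˡ-≤ (- q) p≤q+r)
  where open ℚ-Solver
... | inj₂ eq = subst₂ _≤_
                  (trans (solve 2 (λ p q → q :- p := :- (p :- q)) refl p q) (sym eq))
                  (solve 2 (λ p r → (p :+ r) :- p := r) refl p r)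
                  (+-monoˡ-≤ (- p) q≤p+r)
  where open ℚ-Solver

IsCauchy : (ℕ → ℚ) → Set
IsCauchy x = ∀ {ε} → 0ℚ < ε →
  ∃ λ N → ∀ {m n} → N ℕ.≤ m → N ℕ.≤ n → ∣ x m - x n ∣ ≤ ε

record ℝ : Set where
  constructor mkℝ
  field
    seq    : ℕ → ℚ
    cauchy : IsCauchy seq

open ℝ public

infix  4 _≈ℝ_ _<ℝ_ _≤ℝ_
infixl 6 _+ℝ_ _-ℝ_
infixl 7 _*ℝ_
infixr 8 _^ℝ_

_≈ℝ_ : ℝ → ℝ → Set
x ≈ℝ y = ∀ {ε} → 0ℚ < ε → ∃ λ N → ∀ {n} → N ℕ.≤ n → ∣ seq x n - seq y n ∣ ≤ ε

_<ℝ_ : ℝ → ℝ → Set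
x <ℝ y = ∃ λ ε → 0ℚ < ε × ∃ λ N → ∀ {n} → N ℕ.≤ n → seq x n + ε ≤ seq y n

_≤ℝ_ : ℝ → ℝ → Set
x ≤ℝ y = ¬ (y <ℝ x)

≈ℝ-setoid : Setoid 0ℓ 0ℓ
≈ℝ-setoid = record
  { Carrier       = ℝ
  ; _≈_           = _≈ℝ_
  ; isEquivalence = record
    { refl  = λ {x} 0<ε → 0 , λ {n} _ →
        ≤-trans (≤-reflexive (cong ∣_∣ (+-inverseʳ (seq x n)))) (<⇒≤ 0<ε)
    ; sym   = λ {x} {y} x≈y 0<ε → let (N , h) = x≈y 0<ε in
        N , λ {n} N≤n → ≤-trans (≤-reflexive (∣p-q∣-sym (seq y n) (seq x n))) (h N≤n)
    ; trans = λ {x} {y} {z} x≈y y≈z {ε} 0<ε →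
        let (M , h) = x≈y (½-pos 0<ε) ; (N , k) = y≈z (½-pos 0<ε) in
        M ℕ.⊔ N , λ {n} M⊔N≤n → ≤-trans
          (dist-triangle (seq x n) (seq y n) (seq z n))
          (subst (∣ seq x n - seq y n ∣ + ∣ seq y n - seq z n ∣ ≤_) (½+½ ε)
            (+-mono-≤ (h (ℕP.m⊔n≤o⇒m≤o M N M⊔N≤n)) (k (ℕP.m⊔n≤o⇒n≤o M N M⊔N≤n))))
    }
  }

fromℚ : ℚ → ℝ
fromℚ p = mkℝ (λ _ → p) λ 0<ε → 0 , λ _ _ →
  ≤-trans (≤-reflexive (cong ∣_∣ (+-inverseʳ p))) (<⇒≤ 0<ε)

0ℝ 1ℝ : ℝ
0ℝ = fromℚ 0ℚ
1ℝ = fromℚ 1ℚ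

fromℕ : ℕ → ℝ
fromℕ n = fromℚ (n // 1)

_+ℝ_ : ℝ → ℝ → ℝ
x +ℝ y = mkℝ (λ n → seq x n + seq y n) λ {ε} 0<ε →
  let (M , h) = cauchy x (½-pos 0<ε) ; (N , k) = cauchy y (½-pos 0<ε) in
  M ℕ.⊔ N , λ {m} {n} ≤m ≤n → let open ≤-Reasoning in begin
    ∣ (seq x m + seq y m) - (seq x n + seq y n) ∣
      ≡⟨ cong ∣_∣ (rearrange (seq x m) (seq y m) (seq x n) (seq y n)) ⟩
    ∣ (seq x m - seq x n) + (seq y m - seq y n) ∣
      ≤⟨ ∣p+q∣≤∣p∣+∣q∣ (seq x m - seq x n) (seq y m - seq y n) ⟩
    ∣ seq x m - seq x n ∣ + ∣ seq y m - seq y n ∣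
      ≤⟨ +-mono-≤ (h (ℕP.m⊔n≤o⇒m≤o M N ≤m) (ℕP.m⊔n≤o⇒m≤o M N ≤n))
                  (k (ℕP.m⊔n≤o⇒n≤o M N ≤m) (ℕP.m⊔n≤o⇒n≤o M N ≤n)) ⟩
    ½ * ε + ½ * ε ≡⟨ ½+½ ε ⟩
    ε ∎
  where
  rearrange : ∀ a b c d → (a + b) - (c + d) ≡ (a - c) + (b - d)
  rearrange = solve 4 (λ a b c d → (a :+ b) :- (c :+ d) := (a :- c) :+ (b :- d)) refl
    where open ℚ-Solver

-ℝ_ : ℝ → ℝ
-ℝ x = mkℝ (λ n → - seq x n) λ 0<ε → let (N , h) = cauchy x 0<ε in
  N , λ {m} {n} ≤m ≤n → ≤-trans
    (≤-reflexive (trans (cong ∣_∣ (sym (neg-distrib-+ (seq x m) (- seq x n))))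
                        (∣-p∣≡∣p∣ (seq x m - seq x n))))
    (h ≤m ≤n)

_-ℝ_ : ℝ → ℝ → ℝ
x -ℝ y = x +ℝ (-ℝ y)

eventually-bounded : ∀ x → ∃ λ B → Positive B × ∃ λ N → ∀ {n} → N ℕ.≤ n → ∣ seq x n ∣ ≤ B
eventually-bounded x with cauchy x (positive⁻¹ 1ℚ)
... | N , h = ∣ seq x N ∣ + 1ℚ
            , nonNeg+pos⇒pos ∣ seq x N ∣ {{∣-∣-nonNeg (seq x N)}} 1ℚ
            , N , λ {n} N≤n → begin
  ∣ seq x n ∣
    ≡⟨ cong ∣_∣ (solve 2 (λ a b → a := b :+ (a :- b)) refl (seq x n) (seq x N)) ⟩
  ∣ seq x N + (seq x n - seq x N) ∣
    ≤⟨ ∣p+q∣≤∣p∣+∣q∣ (seq x N) (seq x n - seq x N) ⟩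
  ∣ seq x N ∣ + ∣ seq x n - seq x N ∣
    ≤⟨ +-monoʳ-≤ ∣ seq x N ∣ (h N≤n ℕP.≤-refl) ⟩
  ∣ seq x N ∣ + 1ℚ ∎
  where
  open ≤-Reasoning
  open ℚ-Solver using (solve; _:+_; _:-_; _:=_)

small : ∀ {ε} B .{{_ : Positive B}} → 0ℚ < ε → ∃ λ δ → 0ℚ < δ × B * δ ≡ ε
small {ε} B 0<ε = (1/ B) * ε
  , positive⁻¹ ((1/ B) * ε)
      {{pos*pos⇒pos (1/ B) {{1/pos⇒pos B}} ε {{positive 0<ε}}}}
  , trans (sym (*-assoc B (1/ B) ε))
      (trans (cong (_* ε) (*-inverseʳ B)) (*-identityˡ ε))
  where instance _ = pos⇒nonZero B

∣*∣-bound : ∀ p q {B δ} → 0ℚ ≤ B → ∣ p ∣ ≤ B → ∣ q ∣ ≤ δ → ∣ p * q ∣ ≤ B * δ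
∣*∣-bound p q {B} {δ} 0≤B p≤B q≤δ = begin
  ∣ p * q ∣      ≡⟨ ∣p*q∣≡∣p∣*∣q∣ p q ⟩
  ∣ p ∣ * ∣ q ∣  ≤⟨ *-monoʳ-≤-nonNeg ∣ q ∣ {{∣-∣-nonNeg q}} p≤B ⟩
  B * ∣ q ∣      ≤⟨ *-monoˡ-≤-nonNeg B {{nonNegative 0≤B}} q≤δ ⟩
  B * δ          ∎
  where open ≤-Reasoning

*-close : ∀ a b c d {B D β δ} → 0ℚ ≤ B → 0ℚ ≤ D →
          ∣ a ∣ ≤ B → ∣ b - d ∣ ≤ β → ∣ d ∣ ≤ D → ∣ a - c ∣ ≤ δ →
          ∣ a * b - c * d ∣ ≤ B * β + D * δ
*-close a b c d {B} {D} {β} {δ} 0≤B 0≤D a≤B b-d≤β d≤D a-c≤δ = begin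
  ∣ a * b - c * d ∣                    ≡⟨ cong ∣_∣ (rearrange a b c d) ⟩
  ∣ a * (b - d) + d * (a - c) ∣        ≤⟨ ∣p+q∣≤∣p∣+∣q∣ (a * (b - d)) (d * (a - c)) ⟩
  ∣ a * (b - d) ∣ + ∣ d * (a - c) ∣    ≤⟨ +-mono-≤ (∣*∣-bound a (b - d) 0≤B a≤B b-d≤β)
                                                   (∣*∣-bound d (a - c) 0≤D d≤D a-c≤δ) ⟩
  B * β + D * δ                        ∎
  where
  open ≤-Reasoning
  rearrange : ∀ a b c d → a * b - c * d ≡ a * (b - d) + d * (a - c)
  rearrange = solve 4 (λ a b c d → a :* b :- c :* d := a :* (b :- d) :+ d :* (a :- c)) refl
    where open ℚ-Solver

*-isCauchy : ∀ x y → IsCauchy (λ n → seq x n * seq y n)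
*-isCauchy x y {ε} 0<ε =
  let (B , B>0 , K , hB) = eventually-bounded x
      (D , D>0 , L , hD) = eventually-bounded y
      (β , 0<β , Bβ)     = small B {{B>0}} (½-pos 0<ε)
      (δ , 0<δ , Dδ)     = small D {{D>0}} (½-pos 0<ε)
      (M , h)            = cauchy y 0<β
      (N , k)            = cauchy x 0<δ
  in (K ℕ.⊔ L) ℕ.⊔ (M ℕ.⊔ N) , λ {m} {n} ≤m ≤n →
    let KL≤m = ℕP.m⊔n≤o⇒m≤o (K ℕ.⊔ L) (M ℕ.⊔ N) ≤m
        KL≤n = ℕP.m⊔n≤o⇒m≤o (K ℕ.⊔ L) (M ℕ.⊔ N) ≤n
        MN≤m = ℕP.m⊔n≤o⇒n≤o (K ℕ.⊔ L) (M ℕ.⊔ N) ≤m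
        MN≤n = ℕP.m⊔n≤o⇒n≤o (K ℕ.⊔ L) (M ℕ.⊔ N) ≤n
    in subst (∣ seq x m * seq y m - seq x n * seq y n ∣ ≤_)
         (trans (cong₂ _+_ Bβ Dδ) (½+½ ε))
         (*-close (seq x m) (seq y m) (seq x n) (seq y n)
           (<⇒≤ (positive⁻¹ B {{B>0}})) (<⇒≤ (positive⁻¹ D {{D>0}}))
           (hB (ℕP.m⊔n≤o⇒m≤o K L KL≤m))
           (h (ℕP.m⊔n≤o⇒m≤o M N MN≤m) (ℕP.m⊔n≤o⇒m≤o M N MN≤n))
           (hD (ℕP.m⊔n≤o⇒n≤o K L KL≤n))
           (k (ℕP.m⊔n≤o⇒n≤o M N MN≤m) (ℕP.m⊔n≤o⇒n≤o M N MN≤n)))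

_*ℝ_ : ℝ → ℝ → ℝ
x *ℝ y = mkℝ (λ n → seq x n * seq y n) (*-isCauchy x y)

_^ℝ_ : ℝ → ℕ → ℝ
x ^ℝ zero  = 1ℝ
x ^ℝ suc n = x *ℝ x ^ℝ n

fromModulus : (x : ℕ → ℚ) → (∀ m n → x m ≤ x n + 1 // suc m + 1 // suc n) → IsCauchy x
fromModulus x h {ε} 0<ε with archimedean (½-pos 0<ε)
... | N , small = N , λ {m} {n} ≤m ≤n → dist-≤
  (begin
    x m                               ≤⟨ h m n ⟩
    x n + 1 // suc m + 1 // suc n   ≤⟨ bound (x n) ≤m ≤n ⟩
    x n + ε                           ∎)
  (begin
    x n                               ≤⟨ h n m ⟩
    x m + 1 // suc n + 1 // suc m   ≤⟨ bound (x m) ≤n ≤m ⟩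
    x m + ε                           ∎)
  where
  open ≤-Reasoning
  bound : ∀ p {m n} → N ℕ.≤ m → N ℕ.≤ n → p + 1 // suc m + 1 // suc n ≤ p + ε
  bound p {m} {n} ≤m ≤n = begin
    p + 1 // suc m + 1 // suc n
      ≡⟨ +-assoc p (1 // suc m) (1 // suc n) ⟩
    p + (1 // suc m + 1 // suc n)
      ≤⟨ +-monoʳ-≤ p (+-mono-≤ (small ≤m) (small ≤n)) ⟩
    p + (½ * ε + ½ * ε)  ≡⟨ cong (p +_) (½+½ ε) ⟩
    p + ε                ∎

weaken₁ : ∀ p q m n → p ≤ q + 1 // suc m → p ≤ q + 1 // suc m + 1 // suc n
weaken₁ p q m n h = ≤-trans h
  (subst (_≤ q + 1 // suc m + 1 // suc n) (+-identityʳ (q + 1 // suc m))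
    (+-monoʳ-≤ (q + 1 // suc m) (nonNeg-frac 1 (suc n))))

weaken₂ : ∀ p q m n → p ≤ q + 1 // suc n → p ≤ q + 1 // suc m + 1 // suc n
weaken₂ p q m n h = ≤-trans h
  (+-monoˡ-≤ (1 // suc n)
    (subst (_≤ q + 1 // suc m) (+-identityʳ q)
      (+-monoʳ-≤ q (nonNeg-frac 1 (suc m)))))

-- The largest j ≤ b with P j (and 0 if there is none).
greatest : {P : Pred ℕ 0ℓ} → Decidable P → ℕ → ℕ
greatest P? zero    = zero
greatest P? (suc b) with P? (suc b)
... | yes _ = suc b
... | no  _ = greatest P? b

below? : ∀ q a b k → Decidable (λ j → j ℕ.^ q ℕ.* b ℕ.≤ a ℕ.* k ℕ.^ q)
below? q a b k j = j ℕ.^ q ℕ.* b ℕP.≤? a ℕ.* k ℕ.^ q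

-- ⌊ k · (a / b) ^ (1 / q) ⌋.  The search bound is large enough because
-- j ≤ j ^ q · b ≤ a · k ^ q whenever b, q ≥ 1.
rootFloor : (q a b k : ℕ) → ℕ
rootFloor q a b k = greatest (below? q a b k) (a ℕ.* k ℕ.^ q)

^-distribʳ-* : ∀ q m n → (m ℕ.* n) ℕ.^ q ≡ m ℕ.^ q ℕ.* n ℕ.^ q
^-distribʳ-* zero    m n = refl
^-distribʳ-* (suc q) m n = trans (cong (m ℕ.* n ℕ.*_) (^-distribʳ-* q m n))
  (solve 4 (λ m n a b → m :* n :* (a :* b) := m :* a :* (n :* b)) refl m n (m ℕ.^ q) (n ℕ.^ q))
  where open ℕ-Solver

greatest-holds : {P : Pred ℕ 0ℓ} (P? : Decidable P) → P 0 → ∀ b → P (greatest P? b)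
greatest-holds P? p0 zero    = p0
greatest-holds P? p0 (suc b) with P? (suc b)
... | yes p = p
... | no  _ = greatest-holds P? p0 b

greatest-maximal : {P : Pred ℕ 0ℓ} (P? : Decidable P) → ∀ b {j} → j ℕ.≤ b → P j →
                   j ℕ.≤ greatest P? b
greatest-maximal P? zero    j≤b pj = j≤b
greatest-maximal P? (suc b) j≤b pj with P? (suc b)
... | yes _ = j≤b
... | no ¬p with ℕP.m≤n⇒m<n∨m≡n j≤b
...   | inj₁ (s≤s j≤b′) = greatest-maximal P? b j≤b′ pj
...   | inj₂ refl       = contradiction pj ¬p

m≤m^n : ∀ m n .{{_ : NonZero n}} → m ℕ.≤ m ℕ.^ n
m≤m^n zero    n       = z≤n
m≤m^n (suc m) (suc n) = ℕP.m≤m*n (suc m) (suc m ℕ.^ n) {{ℕP.m^n≢0 (suc m) n}}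

module _ (q a b : ℕ) .{{_ : NonZero q}} .{{_ : NonZero b}} where

  rootFloor-lower : ∀ k → rootFloor q a b k ℕ.^ q ℕ.* b ℕ.≤ a ℕ.* k ℕ.^ q
  rootFloor-lower k = greatest-holds (below? q a b k) (zero-ok q) (a ℕ.* k ℕ.^ q)
    where
    zero-ok : ∀ q .{{_ : NonZero q}} → 0 ℕ.^ q ℕ.* b ℕ.≤ a ℕ.* k ℕ.^ q
    zero-ok (suc _) = z≤n

  rootFloor-upper : ∀ k → a ℕ.* k ℕ.^ q ℕ.< suc (rootFloor q a b k) ℕ.^ q ℕ.* b
  rootFloor-upper k = ℕP.≰⇒> λ h → ℕP.1+n≰n (greatest-maximal (below? q a b k) (a ℕ.* k ℕ.^ q)
    (ℕP.≤-trans (m≤m^n (suc (rootFloor q a b k)) q)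
      (ℕP.≤-trans (ℕP.m≤m*n (suc (rootFloor q a b k) ℕ.^ q) b) h)) h)

  rootFloor-ratio : ∀ k l .{{_ : NonZero k}} →
    rootFloor q a b k ℕ.* l ℕ.< suc (rootFloor q a b l) ℕ.* k
  rootFloor-ratio k l = ℕP.≰⇒> λ h → ℕP.<-irrefl refl (begin-strict
    a ℕ.* (k ℕ.* l) ℕ.^ q                  ≡⟨ cong (a ℕ.*_) (^-distribʳ-* q k l) ⟩
    a ℕ.* (k ℕ.^ q ℕ.* l ℕ.^ q)            ≡⟨ swap₁ a (k ℕ.^ q) (l ℕ.^ q) ⟩
    a ℕ.* l ℕ.^ q ℕ.* k ℕ.^ q              <⟨ ℕP.*-monoˡ-< (k ℕ.^ q) {{ℕP.m^n≢0 k q}} (rootFloor-upper l) ⟩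
    suc v ℕ.^ q ℕ.* b ℕ.* k ℕ.^ q          ≡⟨ swap₂ (suc v ℕ.^ q) b (k ℕ.^ q) ⟩
    suc v ℕ.^ q ℕ.* k ℕ.^ q ℕ.* b          ≡⟨ cong (ℕ._* b) (^-distribʳ-* q (suc v) k) ⟨
    (suc v ℕ.* k) ℕ.^ q ℕ.* b              ≤⟨ ℕP.*-monoˡ-≤ b (ℕP.^-monoˡ-≤ q h) ⟩
    (u ℕ.* l) ℕ.^ q ℕ.* b                  ≡⟨ cong (ℕ._* b) (^-distribʳ-* q u l) ⟩
    u ℕ.^ q ℕ.* l ℕ.^ q ℕ.* b              ≡⟨ swap₂ (u ℕ.^ q) (l ℕ.^ q) b ⟩
    u ℕ.^ q ℕ.* b ℕ.* l ℕ.^ q              ≤⟨ ℕP.*-monoˡ-≤ (l ℕ.^ q) (rootFloor-lower k) ⟩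
    a ℕ.* k ℕ.^ q ℕ.* l ℕ.^ q              ≡⟨ ℕP.*-assoc a (k ℕ.^ q) (l ℕ.^ q) ⟩
    a ℕ.* (k ℕ.^ q ℕ.* l ℕ.^ q)            ≡⟨ cong (a ℕ.*_) (^-distribʳ-* q k l) ⟨
    a ℕ.* (k ℕ.* l) ℕ.^ q                  ∎)
    where
    open ℕP.≤-Reasoning
    u = rootFloor q a b k
    v = rootFloor q a b l
    open ℕ-Solver
    swap₁ : ∀ x y z → x ℕ.* (y ℕ.* z) ≡ x ℕ.* z ℕ.* y
    swap₁ = solve 3 (λ x y z → x :* (y :* z) := x :* z :* y) refl
    swap₂ : ∀ x y z → x ℕ.* y ℕ.* z ≡ x ℕ.* z ℕ.* y
    swap₂ = solve 3 (λ x y z → x :* y :* z := x :* z :* y) refl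

  -- (a / b) ^ (1 / q)
  root : ℝ
  root = mkℝ approx (fromModulus approx λ m n → weaken₂ (approx m) (approx n) m n (close m n))
    where
    approx : ℕ → ℚ
    approx i = rootFloor q a b (suc i) // suc i

    close : ∀ m n → approx m ≤ approx n + 1 // suc n
    close m n = subst (approx m ≤_)
      (trans (cong (λ z → z // suc n) (ℕP.+-comm 1 v)) (sym (frac-+ˢ v 1 (suc n))))
      (frac-≤ (rootFloor q a b (suc m)) (suc m) (suc v) (suc n) (ℕP.<⇒≤ (rootFloor-ratio (suc m) (suc n))))
      where v = rootFloor q a b (suc n)

_^[_/_] : (n p q : ℕ) .{{_ : NonZero q}} → ℝ
n ^[ p / q ] = root q (n ℕ.^ p) 1

_^-[_/_] : (n p q : ℕ) .{{_ : NonZero n}} .{{_ : NonZero q}} → ℝ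
n ^-[ p / q ] = root q 1 (n ℕ.^ p) {{it}} {{ℕP.m^n≢0 n p}}

∑ : ℕ → (ℕ → ℚ) → ℚ
∑ zero    f = 0ℚ
∑ (suc n) f = ∑ n f + f n

-- logSum n i is the left Riemann sum of ∫₁ⁿ dx / x for the mesh 1 / N with N = 1 + i:
-- the j-th rectangle has area (1 / N) / (1 + j / N) = 1 / (N + j).
logSum : (n i : ℕ) → ℚ
logSum n i = ∑ ((n ℕ.∸ 1) ℕ.* suc i) λ j → 1 // suc (i ℕ.+ j)

∑-cong : ∀ n {f g} → (∀ j → f j ≡ g j) → ∑ n f ≡ ∑ n g
∑-cong zero    eq = refl
∑-cong (suc n) eq = cong₂ _+_ (∑-cong n eq) (eq n)

∑-mono : ∀ n {f g} → (∀ j → j ℕ.< n → f j ≤ g j) → ∑ n f ≤ ∑ n g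
∑-mono zero    le = ≤-refl
∑-mono (suc n) le = +-mono-≤ (∑-mono n λ j j<n → le j (ℕP.m<n⇒m<1+n j<n)) (le n ℕP.≤-refl)

∑-const : ∀ n d .{{_ : NonZero d}} → ∑ n (λ _ → 1 // d) ≡ n // d
∑-const zero    d = sym (0/n≡0 d)
∑-const (suc n) d = trans (cong (_+ 1 // d) (∑-const n d))
  (trans (frac-+ˢ n 1 d) (cong (λ z → z // d) (ℕP.+-comm n 1)))

∑-+ : ∀ m n f → ∑ (n ℕ.+ m) f ≡ ∑ m f + ∑ n (λ j → f (j ℕ.+ m))
∑-+ m zero    f = sym (+-identityʳ (∑ m f))
∑-+ m (suc n) f = trans (cong (_+ f (n ℕ.+ m)) (∑-+ m n f))
                        (+-assoc (∑ m f) (∑ n (λ j → f (j ℕ.+ m))) (f (n ℕ.+ m)))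

∑-blocks : ∀ m n f → ∑ (n ℕ.* m) f ≡ ∑ n (λ j → ∑ m (λ i → f (i ℕ.+ j ℕ.* m)))
∑-blocks m zero    f = refl
∑-blocks m (suc n) f = trans (∑-+ (n ℕ.* m) m f)
  (cong (_+ ∑ m (λ i → f (i ℕ.+ n ℕ.* m))) (∑-blocks m n f))

∑-telescope : ∀ n (f : ℕ → ℚ) → ∑ n f + f n ≡ f 0 + ∑ n (f ∘ suc)
∑-telescope zero    f = +-comm 0ℚ (f 0)
∑-telescope (suc n) f = trans (cong (_+ f (suc n)) (∑-telescope n f))
                              (+-assoc (f 0) (∑ n (f ∘ suc)) (f (suc n)))

-- The meshes 1 / (1 + m) and 1 / (1 + n) are compared with their common
-- refinement.
module LogRefine (t m n : ℕ) where
  M = suc m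
  N = suc n

  f : ℕ → ℚ
  f j = 1 // suc (n ℕ.* M ℕ.+ m ℕ.+ j)

  coarse coarse⁺ refined : ℚ
  coarse  = ∑ (t ℕ.* N) λ j → 1 // suc (n ℕ.+ j)
  coarse⁺ = ∑ (t ℕ.* N) λ j → 1 // suc (n ℕ.+ suc j)
  refined = ∑ ((t ℕ.* N) ℕ.* M) f

  den : ∀ i j → ℕ
  den i j = suc (n ℕ.* M ℕ.+ m ℕ.+ (i ℕ.+ j ℕ.* M))

  den-eq : ∀ i j → den i j ≡ i ℕ.+ suc (n ℕ.+ j) ℕ.* M
  den-eq i j = solve 4 (λ m n i j →
      con 1 :+ (n :* (con 1 :+ m) :+ m :+ (i :+ j :* (con 1 :+ m)))
      := i :+ (con 1 :+ (n :+ j)) :* (con 1 :+ m)) refl m n i j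
    where open ℕ-Solver

  upper : refined ≤ coarse
  upper = subst (_≤ coarse) (sym (∑-blocks M (t ℕ.* N) f)) (∑-mono (t ℕ.* N) λ j _ → begin
    ∑ M (λ i → 1 // den i j)
      ≤⟨ ∑-mono M (λ i _ → frac-≤ 1 (den i j) 1 (suc (n ℕ.+ j) ℕ.* M)
           (ℕP.*-monoʳ-≤ 1 (subst (suc (n ℕ.+ j) ℕ.* M ℕ.≤_) (sym (den-eq i j)) (ℕP.m≤n+m (suc (n ℕ.+ j) ℕ.* M) i)))) ⟩
    ∑ M (λ _ → 1 // (suc (n ℕ.+ j) ℕ.* M))
      ≡⟨ ∑-const M (suc (n ℕ.+ j) ℕ.* M) ⟩
    M // (suc (n ℕ.+ j) ℕ.* M)
      ≤⟨ frac-≤ M (suc (n ℕ.+ j) ℕ.* M) 1 (suc (n ℕ.+ j))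
           (ℕP.≤-reflexive (trans (ℕP.*-comm M _) (sym (ℕP.*-identityˡ _)))) ⟩
    1 // suc (n ℕ.+ j) ∎)
    where open ≤-Reasoning

  lower : coarse⁺ ≤ refined
  lower = subst (coarse⁺ ≤_) (sym (∑-blocks M (t ℕ.* N) f)) (∑-mono (t ℕ.* N) λ j _ → begin
    1 // suc (n ℕ.+ suc j)
      ≤⟨ frac-≤ 1 (suc (n ℕ.+ suc j)) M (suc (n ℕ.+ suc j) ℕ.* M)
           (ℕP.≤-reflexive (trans (ℕP.*-identityˡ _) (ℕP.*-comm (suc (n ℕ.+ suc j)) M))) ⟩
    M // (suc (n ℕ.+ suc j) ℕ.* M)
      ≡⟨ ∑-const M (suc (n ℕ.+ suc j) ℕ.* M) ⟨
    ∑ M (λ _ → 1 // (suc (n ℕ.+ suc j) ℕ.* M))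
      ≤⟨ ∑-mono M (λ i i<M → frac-≤ 1 (suc (n ℕ.+ suc j) ℕ.* M) 1 (den i j)
           (ℕP.*-monoʳ-≤ 1 (subst₂ ℕ._≤_ (sym (den-eq i j))
             (cong (λ z → suc z ℕ.* M) (sym (ℕP.+-suc n j)))
             (ℕP.+-monoˡ-≤ (suc (n ℕ.+ j) ℕ.* M) (ℕP.<⇒≤ i<M))))) ⟩
    ∑ M (λ i → 1 // den i j) ∎)
    where open ≤-Reasoning

  gap : coarse ≤ refined + 1 // N
  gap = begin
    ∑ (t ℕ.* N) g                    ≡⟨ +-identityʳ (∑ (t ℕ.* N) g) ⟨
    ∑ (t ℕ.* N) g + 0ℚ               ≤⟨ +-monoʳ-≤ (∑ (t ℕ.* N) g) (nonNeg-frac 1 (suc (n ℕ.+ t ℕ.* N))) ⟩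
    ∑ (t ℕ.* N) g + g (t ℕ.* N)      ≡⟨ ∑-telescope (t ℕ.* N) g ⟩
    g 0 + ∑ (t ℕ.* N) (g ∘ suc)      ≡⟨ +-comm (g 0) (∑ (t ℕ.* N) (g ∘ suc)) ⟩
    ∑ (t ℕ.* N) (g ∘ suc) + g 0      ≤⟨ +-mono-≤ lower (≤-reflexive (cong (λ z → 1 // suc z) (ℕP.+-identityʳ n))) ⟩
    refined + 1 // N                ∎
    where
    open ≤-Reasoning
    g : ℕ → ℚ
    g j = 1 // suc (n ℕ.+ j)

  refined-sym : refined ≡ ∑ ((t ℕ.* M) ℕ.* N) λ j → 1 // suc (m ℕ.* N ℕ.+ n ℕ.+ j)
  refined-sym = trans
    (∑-cong ((t ℕ.* N) ℕ.* M) λ j → cong (λ z → 1 // suc (z ℕ.+ j))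
      (solve 2 (λ m n → n :* (con 1 :+ m) :+ m := m :* (con 1 :+ n) :+ n) refl m n))
    (cong (λ z → ∑ z (λ j → 1 // suc (m ℕ.* N ℕ.+ n ℕ.+ j)))
      (solve 3 (λ t a b → t :* a :* b := t :* b :* a) refl t N M))
    where open ℕ-Solver

log : (n : ℕ) .{{_ : NonZero n}} → ℝ
log n = mkℝ (logSum n) (fromModulus (logSum n) λ i j → weaken₁ (logSum n i) (logSum n j) i j (close i j))
  where
  close : ∀ i j → logSum n i ≤ logSum n j + 1 // suc i
  close i j = ≤-trans (gap t j i)
    (+-monoˡ-≤ (1 // suc i) (subst (_≤ logSum n j) (sym (refined-sym t j i)) (upper t i j)))
    where
    open LogRefine
    t = n ℕ.∸ 1

-- Finite sets and their cardinalities.  Equality of reals is not decidable,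
-- so cardinalities and counting functions are given as relations; classically
-- each of them is the graph of the usual function.

module Finite (S : Setoid 0ℓ 0ℓ) where
  open Setoid S using (Carrier)
  open Membership S using (_∈_)
  open UniqueSetoid S using (Unique)

  Enumerates : List Carrier → Pred Carrier 0ℓ → Set
  Enumerates xs P = Unique xs × (∀ x → x ∈ xs ⇔ P x)

  HasCard : Pred Carrier 0ℓ → ℕ → Set
  HasCard P n = ∃ λ xs → Enumerates xs P × length xs ≡ n

open Finite ≈ℝ-setoid public
open Finite (×-setoid ≈ℝ-setoid ≈ℝ-setoid) public
  using () renaming (HasCard to HasCard²)

ProductSet : Pred ℝ 0ℓ → Pred ℝ 0ℓ
ProductSet A x = ∃₂ λ a b → A a × A b × x ≈ℝ a *ℝ b

DifferenceSet : Pred ℝ 0ℓ → Pred ℝ 0ℓ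
DifferenceSet A x = ∃₂ λ a b → A a × A b × x ≈ℝ a -ℝ b

-- r_{A-A}(x) = k
RepCount : Pred ℝ 0ℓ → ℝ → ℕ → Set
RepCount A x k = HasCard² (λ (a , b) → A a × A b × a -ℝ b ≈ℝ x) k

-- E₃⁺(A) = e.  The sum of r_{A-A}(x)³ over all real x runs over A - A, the
-- set of those x for which r_{A-A}(x) is nonzero.
Energy₃⁺ : Pred ℝ 0ℓ → ℕ → Set
Energy₃⁺ A e = ∃₂ λ xs ks →
  Enumerates xs (DifferenceSet A) × Pointwise (RepCount A) xs ks × sum (map (ℕ._^ 3) ks) ≡ e

{-# OPTIONS --safe #-}

-- Proof idea (after Solymosi's bound max(|A + A|, |AA|) ≳ |A|^{14/11}).  By dyadic pigeonholing
-- E₃ ≲ q t³ for the set D of the q differences with at least t representations.  Let f(c) be the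
-- number of a ∈ A with a - c ∈ D, so that F = Σ f ≥ q t.  Two applications of Cauchy–Schwarz
-- give F⁴ ≤ |AA| Σ_s w(s)², where w(s) sums f(c) f(e) over the pairs with e / c = s.  Now
-- f(c) f(e) counts the pairs (P, R) in A² × D² with P - R = (c, e), so w(s) is at most the sum,
-- over the lines of slope s, of the number of points of A² times the number of points of D² on
-- the line.  By Hölder's inequality this is controlled by the number of collinear triples in a
-- grid X², which is ≲ |X|⁴ by the Szemerédi–Trotter theorem.
--
-- For grids that theorem is elementary: cut X into r blocks of consecutive elements.  A monotone
-- line meets fewer than 2r of the r² cells, so a line with many more points than that
-- contains a pair of points in a common cell, and the pairs in common cells are few.
module Submission where

open import Defs
open import Data.Nat.Base
open import Data.Nat.DivMod
open import Data.Nat.ListAction using (sum)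
open import Data.Nat.Properties
open import Data.Nat.Solver using (module +-*-Solver)
import Data.Integer.Base as ℤ
import Data.Integer.Properties as ℤ
open import Data.Rational.Base as ℚ using (ℚ; 0ℚ; 1ℚ; ½)
import Data.Rational.Properties as ℚ
open import Data.Rational.Solver renaming (module +-*-Solver to ℚ-Solver)
import Data.Rational.Unnormalised.Base as ℚᵘ
import Data.Rational.Unnormalised.Properties as ℚᵘ
open import Data.Fin.Base using (Fin; zero; suc; toℕ; fromℕ<)
import Data.Fin.Properties as Fin
open import Data.List.Base using (List; []; _∷_; _++_; downFrom; map; length; lookup; filter; allFin; cartesianProduct; concatMap; deduplicate)
open import Data.List.Properties using (length-filter; length-tabulate; length-downFrom; map-tabulate)
open import Data.List.Membership.Propositional using (_∈_)
open import Data.List.Membership.Propositional.Properties using (∈-allFin; ∈-cartesianProduct⁺; ∈-lookup)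
import Data.List.Membership.Setoid.Properties as Membership
open import Data.List.Relation.Binary.Pointwise using (Pointwise; []; _∷_)
open import Data.List.Relation.Unary.All as All using (All; []; _∷_)
import Data.List.Relation.Unary.All.Properties as All
open import Data.List.Relation.Unary.AllPairs as AllPairs using (AllPairs; []; _∷_)
import Data.List.Relation.Unary.AllPairs.Properties as AllPairs
open import Data.List.Relation.Unary.Any as Any using (Any; here; there)
import Data.List.Relation.Unary.Any.Properties as Any
open import Data.List.Relation.Unary.Unique.Propositional.Properties using (allFin⁺)
open import Data.Product using (∃; ∃-syntax; _×_; _,_; proj₁; proj₂; uncurry)
import Data.Product.Properties as Product
open import Data.Product.Relation.Binary.Pointwise.NonDependent using (×-setoid)
open import Data.Sum.Base using (_⊎_; inj₁; inj₂; [_,_]′)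
open import Function.Base using (_∘_; id)
open import Function.Bundles using (Equivalence)
open import Level using (0ℓ)
open import Relation.Binary.Bundles using (Setoid)
open import Relation.Binary.PropositionalEquality
open import Relation.Nullary using (¬_; Dec; yes; no; contradiction; ¬?; map′)
open import Relation.Nullary.Decidable using (decidable-stable)
open import Relation.Unary using (Pred; Decidable)

open import Algebra.Solver.CommutativeMonoid *-1-commutativeMonoid using ()
  renaming (solve to solve-*; _⊜_ to infix 4 _⊜_; _⊕_ to infixl 7 _·_; id to id*)
open +-*-Solver using (solve; _:=_; _:+_; _:*_; con)
open ℚ-Solver using (_:-_; :-_)
  renaming (solve to solveℚ; _:=_ to _:=ℚ_; _:+_ to _:+ℚ_; _:*_ to _:*ℚ_; con to conℚ)

-- Finite sums of natural numbers

-- The exponents arise as follows. Put n = |A|, m = |AA|, and let b ≤ B be the sizes of A and D in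
-- increasing order. The bounds on collinear triples in both grids give (Σ w²)³ ≲ b^10 B^8 ≤ n^10
-- q^8. Combined with q t ≤ F and F⁴ ≤ m Σ w² this yields (q t)^12 ≲ m³ n^10 q^8; cancelling q^8
-- leaves (q t³)⁴ ≲ m³ n^10, the fourth power of the energy.
--
-- The obstacle is a line with a single grid point: two points determine a line, one does not, so
-- incidence bounds control only the richness less one. The larger grid can pay for all lines of the
-- family, at most B⁴ of them; the smaller one cannot, and its solitary points need an estimate of
-- their own.
--
-- Reals are Cauchy sequences, so their signs are not decidable. The inequality between natural
-- numbers to which everything reduces is decidable, however, hence stable under double negation,
-- and only finitely many signs have to be supplied inside the refutation.

sumOver : {I : Set} → List I → (I → ℕ) → ℕ
sumOver []       f = 0
sumOver (x ∷ xs) f = f x + sumOver xs f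

infixr 4 sumOver
syntax sumOver xs (λ x → e) = ∑[ x ∈ xs ] e

module _ {I : Set} where

  sum-cong : ∀ (xs : List I) {f g : I → ℕ} → (∀ x → f x ≡ g x) → sumOver xs f ≡ sumOver xs g
  sum-cong []       eq = refl
  sum-cong (x ∷ xs) eq = cong₂ _+_ (eq x) (sum-cong xs eq)

  sum-mono : ∀ (xs : List I) {f g : I → ℕ} → (∀ x → f x ≤ g x) → sumOver xs f ≤ sumOver xs g
  sum-mono []       le = z≤n
  sum-mono (x ∷ xs) le = +-mono-≤ (le x) (sum-mono xs le)

  sum-mono-∈ : ∀ (xs : List I) {f g : I → ℕ} → (∀ {x} → x ∈ xs → f x ≤ g x) → sumOver xs f ≤ sumOver xs g
  sum-mono-∈ []       le = z≤n
  sum-mono-∈ (x ∷ xs) le = +-mono-≤ (le (here refl)) (sum-mono-∈ xs (le ∘ there))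

  sum-zero : ∀ (xs : List I) {f : I → ℕ} → (∀ x → f x ≡ 0) → sumOver xs f ≡ 0
  sum-zero []       eq = refl
  sum-zero (x ∷ xs) eq = cong₂ _+_ (eq x) (sum-zero xs eq)

  sum-+ : ∀ (xs : List I) (f g : I → ℕ) → (∑[ x ∈ xs ] f x + g x) ≡ sumOver xs f + sumOver xs g
  sum-+ []       f g = refl
  sum-+ (x ∷ xs) f g = trans (cong (f x + g x +_) (sum-+ xs f g))
    (solve 4 (λ a b c d → a :+ b :+ (c :+ d) := a :+ c :+ (b :+ d)) refl (f x) (g x) (sumOver xs f) (sumOver xs g))

  sum-*ˡ : ∀ (xs : List I) c (f : I → ℕ) → c * sumOver xs f ≡ (∑[ x ∈ xs ] c * f x)
  sum-*ˡ []       c f = *-zeroʳ c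
  sum-*ˡ (x ∷ xs) c f = trans (*-distribˡ-+ c (f x) _) (cong (c * f x +_) (sum-*ˡ xs c f))

  sum-*ʳ : ∀ (xs : List I) (f : I → ℕ) c → sumOver xs f * c ≡ (∑[ x ∈ xs ] f x * c)
  sum-*ʳ []       f c = refl
  sum-*ʳ (x ∷ xs) f c = trans (*-distribʳ-+ c (f x) _) (cong (f x * c +_) (sum-*ʳ xs f c))

  sum-const : ∀ (xs : List I) c → (∑[ _ ∈ xs ] c) ≡ length xs * c
  sum-const []       c = refl
  sum-const (x ∷ xs) c = cong (c +_) (sum-const xs c)

  sum-≤-const : ∀ (xs : List I) {f} c → (∀ x → f x ≤ c) → sumOver xs f ≤ length xs * c
  sum-≤-const xs c le = ≤-trans (sum-mono xs le) (≤-reflexive (sum-const xs c))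

  term≤sum : ∀ {xs : List I} (f : I → ℕ) {x} → x ∈ xs → f x ≤ sumOver xs f
  term≤sum f (here refl) = m≤m+n _ _
  term≤sum {y ∷ _} f (there x∈) = ≤-trans (term≤sum f x∈) (m≤n+m _ (f y))

  sum-++ : ∀ (xs ys : List I) f → sumOver (xs ++ ys) f ≡ sumOver xs f + sumOver ys f
  sum-++ []       ys f = refl
  sum-++ (x ∷ xs) ys f = trans (cong (f x +_) (sum-++ xs ys f)) (sym (+-assoc (f x) _ _))

  -- Vanishing products leave room for one nonzero term. They are assumed in place of disjoint
  -- predicates so that the terms may themselves be sums, as in `one-line`.
  sum-≤1 : ∀ {xs : List I} {f : I → ℕ} → (∀ x → f x ≤ 1) →
           AllPairs (λ x y → f x * f y ≡ 0) xs → sumOver xs f ≤ 1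
  sum-≤1 le [] = z≤n
  sum-≤1 {x ∷ xs} {f} le (px ∷ pxs) with f x | le x | px
  ... | 0           | _ | _  = sum-≤1 le pxs
  ... | 1           | _ | eq = ≤-reflexive (cong suc (vanish eq))
    where
    vanish : ∀ {ys} → All (λ y → f y + 0 ≡ 0) ys → sumOver ys f ≡ 0
    vanish []       = refl
    vanish (p ∷ ps) = cong₂ _+_ (trans (sym (+-identityʳ _)) p) (vanish ps)
  ... | suc (suc _) | s≤s () | _

sum-map : ∀ {I J : Set} (h : I → J) xs f → sumOver (map h xs) f ≡ sumOver xs (f ∘ h)
sum-map h []       f = refl
sum-map h (x ∷ xs) f = cong (f (h x) +_) (sum-map h xs f)

module _ {I J : Set} where

  sum-swap : ∀ (xs : List I) (ys : List J) (f : I → J → ℕ) →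
             (∑[ x ∈ xs ] ∑[ y ∈ ys ] f x y) ≡ (∑[ y ∈ ys ] ∑[ x ∈ xs ] f x y)
  sum-swap []       ys f = sym (sum-zero ys λ _ → refl)
  sum-swap (x ∷ xs) ys f = trans (cong (sumOver ys (f x) +_) (sum-swap xs ys f))
    (sym (sum-+ ys (f x) λ y → ∑[ x ∈ xs ] f x y))

  sum-× : ∀ (xs : List I) (ys : List J) (f : I × J → ℕ) →
          sumOver (cartesianProduct xs ys) f ≡ (∑[ x ∈ xs ] ∑[ y ∈ ys ] f (x , y))
  sum-× []       ys f = refl
  sum-× (x ∷ xs) ys f = trans (sum-++ (map (x ,_) ys) _ f)
    (cong₂ _+_ (sum-map (x ,_) ys f) (sum-× xs ys f))

  sum*sum : ∀ (xs : List I) (ys : List J) f g →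
            sumOver xs f * sumOver ys g ≡ (∑[ x ∈ xs ] ∑[ y ∈ ys ] f x * g y)
  sum*sum xs ys f g = trans (sum-*ʳ xs f _) (sum-cong xs λ x → sum-*ˡ ys (f x) g)

  sum-concatMap : ∀ (h : I → List J) xs f →
                  sumOver (concatMap h xs) f ≡ (∑[ x ∈ xs ] sumOver (h x) f)
  sum-concatMap h []       f = refl
  sum-concatMap h (x ∷ xs) f = trans (sum-++ (h x) _ f) (cong (sumOver (h x) f +_) (sum-concatMap h xs f))

length-as-sum : {I : Set} (xs : List I) → length xs ≡ (∑[ _ ∈ xs ] 1)
length-as-sum xs = sym (trans (sum-const xs 1) (*-identityʳ _))

-- Indicators of decidable propositions

⟦_⟧ : ∀ {p} {P : Set p} → Dec P → ℕ
⟦ yes _ ⟧ = 1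
⟦ no  _ ⟧ = 0

module _ {p} {P : Set p} where

  ⟦⟧≤1 : (d : Dec P) → ⟦ d ⟧ ≤ 1
  ⟦⟧≤1 (yes _) = ≤-refl
  ⟦⟧≤1 (no  _) = z≤n

  ⟦⟧-true : (d : Dec P) → P → ⟦ d ⟧ ≡ 1
  ⟦⟧-true (yes _) _ = refl
  ⟦⟧-true (no ¬p) p = contradiction p ¬p

  ⟦⟧-false : (d : Dec P) → ¬ P → ⟦ d ⟧ ≡ 0
  ⟦⟧-false (yes p) ¬p = contradiction p ¬p
  ⟦⟧-false (no _)  _  = refl

  ⟦⟧*≤ : (d : Dec P) {x y : ℕ} → (P → x ≤ y) → ⟦ d ⟧ * x ≤ y
  ⟦⟧*≤ (yes p) {x} le = ≤-trans (≤-reflexive (+-identityʳ x)) (le p)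
  ⟦⟧*≤ (no  _) le = z≤n

  ⟦⟧≤ : (d : Dec P) {y : ℕ} → (P → 1 ≤ y) → ⟦ d ⟧ ≤ y
  ⟦⟧≤ (yes p) le = le p
  ⟦⟧≤ (no  _) le = z≤n

  ⟦⟧*≤ʳ : (d : Dec P) (x : ℕ) → ⟦ d ⟧ * x ≤ x
  ⟦⟧*≤ʳ d x = ⟦⟧*≤ d λ _ → ≤-refl

  ⟦⟧+⟦¬⟧ : (d : Dec P) → ⟦ d ⟧ + ⟦ ¬? d ⟧ ≡ 1
  ⟦⟧+⟦¬⟧ (yes _) = refl
  ⟦⟧+⟦¬⟧ (no  _) = refl

module _ {p q} {P : Set p} {Q : Set q} where

  ⟦⟧-mono : (d : Dec P) (e : Dec Q) → (P → Q) → ⟦ d ⟧ ≤ ⟦ e ⟧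
  ⟦⟧-mono d e f = ⟦⟧≤ d λ p → ≤-reflexive (sym (⟦⟧-true e (f p)))

  ⟦⟧*⟦⟧≡0 : (d : Dec P) (e : Dec Q) → ¬ (P × Q) → ⟦ d ⟧ * ⟦ e ⟧ ≡ 0
  ⟦⟧*⟦⟧≡0 (yes p) (yes q) ¬pq = contradiction (p , q) ¬pq
  ⟦⟧*⟦⟧≡0 (yes p) (no  _) _   = refl
  ⟦⟧*⟦⟧≡0 (no  _) _       _   = refl

count≤1 : ∀ {I : Set} {p} {P : Pred I p} (P? : Decidable P) {xs} →
          AllPairs (λ x y → ¬ (P x × P y)) xs → (∑[ x ∈ xs ] ⟦ P? x ⟧) ≤ 1
count≤1 P? ps = sum-≤1 (⟦⟧≤1 ∘ P?) (AllPairs.map (λ {x} {y} → ⟦⟧*⟦⟧≡0 (P? x) (P? y)) ps)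

fin-count≤1 : ∀ {n p} {P : Pred (Fin n) p} (P? : Decidable P) →
              (∀ {i j} → P i → P j → i ≡ j) → (∑[ i ∈ allFin n ] ⟦ P? i ⟧) ≤ 1
fin-count≤1 {n} P? unique = count≤1 P? (AllPairs.map (λ i≢j (p , q) → i≢j (unique p q)) (allFin⁺ n))

fin-count≥1 : ∀ {n p} {P : Pred (Fin n) p} (P? : Decidable P) {i} → P i →
              1 ≤ (∑[ i ∈ allFin n ] ⟦ P? i ⟧)
fin-count≥1 P? {i} p = ≤-trans (≤-reflexive (sym (⟦⟧-true (P? i) p))) (term≤sum (⟦_⟧ ∘ P?) (∈-allFin i))

length-allFin : ∀ n → length (allFin n) ≡ n
length-allFin n = length-tabulate {n = n} id

-- Representatives of the classes of a decidable equivalence relation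

module Reps {I : Set} {_~_ : I → I → Set} (_~?_ : ∀ x y → Dec (x ~ y))
            (~-refl : ∀ x → x ~ x) (~-sym : ∀ {x y} → x ~ y → y ~ x)
            (~-trans : ∀ {x y z} → x ~ y → y ~ z → x ~ z) where

  reps : List I → List I
  reps = deduplicate _~?_

  reps-distinct : ∀ xs → AllPairs (λ x y → ¬ x ~ y) (reps xs)
  reps-distinct []       = []
  reps-distinct (x ∷ xs) = All.all-filter (¬? ∘ (x ~?_)) (reps xs)
                         ∷ AllPairs.filter⁺ (¬? ∘ (x ~?_)) (reps-distinct xs)

  length-reps : ∀ xs → length (reps xs) ≤ length xs
  length-reps []       = z≤n
  length-reps (x ∷ xs) = s≤s (≤-trans (length-filter (¬? ∘ (x ~?_)) (reps xs)) (length-reps xs))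

  rep-of : ∀ {x xs} → x ∈ xs → Any (x ~_) (reps xs)
  rep-of {x} (here refl) = here (~-refl x)
  rep-of {x} {y ∷ ys} (there x∈ys) with y ~? x
  ... | yes y~x = here (~-sym y~x)
  ... | no  y≁x = there (keep (rep-of x∈ys))
    where
    -- Filtering by y removes only the class of y, to which x does not belong, so the representative
    -- of x survives.
    keep : ∀ {zs} → Any (x ~_) zs → Any (x ~_) (filter (¬? ∘ (y ~?_)) zs)
    keep {z ∷ zs} (here x~z) with y ~? z
    ... | yes y~z = contradiction (~-trans y~z (~-sym x~z)) y≁x
    ... | no  _   = here x~z
    keep {z ∷ zs} (there p) with y ~? z
    ... | yes _ = keep p
    ... | no  _ = there (keep p)

  reps≤1 : ∀ x xs → (∑[ r ∈ reps xs ] ⟦ x ~? r ⟧) ≤ 1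
  reps≤1 x xs = count≤1 (x ~?_)
    (AllPairs.map (λ r≁s (x~r , x~s) → r≁s (~-trans (~-sym x~r) x~s)) (reps-distinct xs))

  class-sum : ∀ {x xs} (f : I → ℕ) → x ∈ xs → (∀ {r} → x ~ r → 1 ≤ f r) → 1 ≤ sumOver (reps xs) f
  class-sum {x} f x∈xs pos = go (rep-of x∈xs)
    where
    go : ∀ {rs} → Any (x ~_) rs → 1 ≤ sumOver rs f
    go {r ∷ rs} (here x~r) = ≤-trans (pos x~r) (m≤m+n _ _)
    go {r ∷ rs} (there p)  = ≤-trans (go p) (m≤n+m _ (f r))

  -- Each x has some representative r, and `f x ≡ f r`. This turns a sum over points into a sum over
  -- lines, each line weighted by its number of points.
  sum-by-class : ∀ xs (f : I → ℕ) → (∀ {x y} → x ~ y → f x ≡ f y) →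
                 sumOver xs f ≤ (∑[ r ∈ reps xs ] (∑[ x ∈ xs ] ⟦ x ~? r ⟧) * f r)
  sum-by-class xs f resp = begin
    sumOver xs f
      ≤⟨ sum-mono-∈ xs (λ {x} x∈ → ≤-trans (≤-reflexive (sym (*-identityˡ (f x)))) (≤-trans
           (*-monoˡ-≤ (f x) (class-sum (λ r → ⟦ x ~? r ⟧) x∈ λ {r} x~r → ≤-reflexive (sym (⟦⟧-true (x ~? r) x~r))))
           (≤-trans (≤-reflexive (sum-*ʳ (reps xs) (λ r → ⟦ x ~? r ⟧) (f x)))
             (sum-mono (reps xs) λ r → ⟦⟧*≤ (x ~? r) λ x~r → ≤-reflexive
               (trans (resp x~r) (sym (trans (cong (_* f r) (⟦⟧-true (x ~? r) x~r)) (*-identityˡ (f r))))))))) ⟩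
    (∑[ x ∈ xs ] ∑[ r ∈ reps xs ] ⟦ x ~? r ⟧ * f r)
      ≡⟨ sum-swap xs (reps xs) (λ x r → ⟦ x ~? r ⟧ * f r) ⟩
    (∑[ r ∈ reps xs ] ∑[ x ∈ xs ] ⟦ x ~? r ⟧ * f r)
      ≡⟨ sum-cong (reps xs) (λ r → sum-*ʳ xs (λ x → ⟦ x ~? r ⟧) (f r)) ⟨
    (∑[ r ∈ reps xs ] (∑[ x ∈ xs ] ⟦ x ~? r ⟧) * f r) ∎
    where open ≤-Reasoning

-- Inequalities

sq-cancel-≤ : ∀ {m n} → m * m ≤ n * n → m ≤ n
sq-cancel-≤ {m} {n} le with m ≤? n
... | yes m≤n = m≤n
... | no  m≰n = contradiction le (<⇒≱ (*-mono-< (≰⇒> m≰n) (≰⇒> m≰n)))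

-- Cancellation without division: the last hypothesis settles p = 0, where the first one carries no
-- information.
cancel-factor : ∀ {x y} p → p * x ≤ p * y → (p ≡ 0 → x ≡ 0) → x ≤ y
cancel-factor zero    le z = ≤-trans (≤-reflexive (z refl)) z≤n
cancel-factor (suc p) le z = *-cancelˡ-≤ (suc p) le

4uv≤[u+v]² : ∀ u v → 4 * (u * v) ≤ (u + v) * (u + v)
4uv≤[u+v]² u v = [ ordered , (λ v≤u → subst₂ _≤_ (cong (4 *_) (*-comm v u)) (cong (λ z → z * z) (+-comm v u)) (ordered v≤u)) ]′ (≤-total u v)
  where
  ordered : ∀ {u v} → u ≤ v → 4 * (u * v) ≤ (u + v) * (u + v)
  ordered {u} u≤v with m≤n⇒∃[o]m+o≡n u≤v
  ... | d , refl = ≤-trans (m≤m+n (4 * (u * (u + d))) (d * d)) (≤-reflexive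
    (solve 2 (λ u d → con 4 :* (u :* (u :+ d)) :+ d :* d := (u :+ (u :+ d)) :* (u :+ (u :+ d))) refl u d))

private
  -- The cross term in the induction for Cauchy-Schwarz. Squaring gives 4a²x²y² ≤ 4(by²)(cx²) ≤ (by²
  -- + cx²)², so that neither square roots nor differences appear.
  am-gm : ∀ a b c x y → a * a ≤ b * c → 2 * (a * (x * y)) ≤ b * (y * y) + c * (x * x)
  am-gm a b c x y h = sq-cancel-≤ (begin
    2 * (a * (x * y)) * (2 * (a * (x * y)))
      ≡⟨ solve 3 (λ a x y → con 2 :* (a :* (x :* y)) :* (con 2 :* (a :* (x :* y)))
           := con 4 :* (a :* a) :* (x :* x :* (y :* y))) refl a x y ⟩
    4 * (a * a) * (x * x * (y * y))
      ≤⟨ *-monoˡ-≤ (x * x * (y * y)) (*-monoʳ-≤ 4 h) ⟩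
    4 * (b * c) * (x * x * (y * y))
      ≡⟨ solve 4 (λ b c X Y → con 4 :* (b :* c) :* (X :* Y) := con 4 :* ((b :* Y) :* (c :* X))) refl b c (x * x) (y * y) ⟩
    4 * ((b * (y * y)) * (c * (x * x)))
      ≤⟨ 4uv≤[u+v]² (b * (y * y)) (c * (x * x)) ⟩
    (b * (y * y) + c * (x * x)) * (b * (y * y) + c * (x * x)) ∎)
    where
    open ≤-Reasoning

module _ {I : Set} (xs : List I) where

  -- The weight p lets one induction serve several times: constant weights give `sum²≤`, while the
  -- weights f and g give the interpolations behind `sum²≤sum*cubes` and `hölder`.
  cauchy-schwarz : ∀ (p u v : I → ℕ) →
    sumOver xs (λ x → p x * (u x * v x)) * sumOver xs (λ x → p x * (u x * v x))
    ≤ sumOver xs (λ x → p x * (u x * u x)) * sumOver xs (λ x → p x * (v x * v x))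
  cauchy-schwarz p u v = go xs
    where
    go : ∀ xs → sumOver xs (λ x → p x * (u x * v x)) * sumOver xs (λ x → p x * (u x * v x))
              ≤ sumOver xs (λ x → p x * (u x * u x)) * sumOver xs (λ x → p x * (v x * v x))
    go []       = z≤n
    go (x ∷ xs) = begin
      (p x * (u x * v x) + a) * (p x * (u x * v x) + a)
        ≡⟨ solve 4 (λ p u v a → (p :* (u :* v) :+ a) :* (p :* (u :* v) :+ a)
             := p :* p :* (u :* u :* (v :* v)) :+ (p :* (con 2 :* (a :* (u :* v))) :+ a :* a)) refl (p x) (u x) (v x) a ⟩
      p x * p x * (u x * u x * (v x * v x)) + (p x * (2 * (a * (u x * v x))) + a * a)
        ≤⟨ +-monoʳ-≤ (p x * p x * (u x * u x * (v x * v x)))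
             (+-mono-≤ (*-monoʳ-≤ (p x) (am-gm a b c (u x) (v x) (go xs))) (go xs)) ⟩
      p x * p x * (u x * u x * (v x * v x)) + (p x * (b * (v x * v x) + c * (u x * u x)) + b * c)
        ≡⟨ solve 5 (λ p U V b c → p :* p :* (U :* V) :+ (p :* (b :* V :+ c :* U) :+ b :* c)
             := (p :* U :+ b) :* (p :* V :+ c)) refl (p x) (u x * u x) (v x * v x) b c ⟩
      (p x * (u x * u x) + b) * (p x * (v x * v x) + c) ∎
      where
      open ≤-Reasoning
      a = sumOver xs (λ x → p x * (u x * v x))
      b = sumOver xs (λ x → p x * (u x * u x))
      c = sumOver xs (λ x → p x * (v x * v x))

  sum²≤ : ∀ (f : I → ℕ) → sumOver xs f * sumOver xs f ≤ length xs * (∑[ x ∈ xs ] f x * f x)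
  sum²≤ f = subst₂ _≤_ (cong (λ z → z * z) (sum-cong xs λ x → trans (*-identityˡ _) (*-identityˡ _)))
    (cong₂ _*_ (sym (length-as-sum xs)) (sum-cong xs λ x → *-identityˡ _))
    (cauchy-schwarz (λ _ → 1) (λ _ → 1) f)

  sum²≤sum*cubes : ∀ (f : I → ℕ) → sumOver xs (λ x → f x * f x) * sumOver xs (λ x → f x * f x)
                   ≤ sumOver xs f * (∑[ x ∈ xs ] f x * (f x * f x))
  sum²≤sum*cubes f = subst₂ _≤_ (cong (λ z → z * z) (sum-cong xs λ x → cong (f x *_) (*-identityˡ _)))
    (cong (_* (∑[ x ∈ xs ] f x * (f x * f x))) (sum-cong xs λ x → *-identityʳ (f x)))
    (cauchy-schwarz f (λ _ → 1) f)

  sum³≤ : ∀ (f : I → ℕ) → let n = length xs ; S = sumOver xs f in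
          S * (S * S) ≤ n * n * (∑[ x ∈ xs ] f x * (f x * f x))
  sum³≤ f = cancel-factor S (begin
    S * (S * (S * S))        ≡⟨ solve 1 (λ s → s :* (s :* (s :* s)) := (s :* s) :* (s :* s)) refl S ⟩
    (S * S) * (S * S)        ≤⟨ *-mono-≤ (sum²≤ f) (sum²≤ f) ⟩
    n * S₂ * (n * S₂)        ≡⟨ solve 2 (λ n t → n :* t :* (n :* t) := n :* n :* (t :* t)) refl n S₂ ⟩
    n * n * (S₂ * S₂)        ≤⟨ *-monoʳ-≤ (n * n) (sum²≤sum*cubes f) ⟩
    n * n * (S * S₃)         ≡⟨ solve 3 (λ n s t → n :* n :* (s :* t) := s :* (n :* n :* t)) refl n S S₃ ⟩
    S * (n * n * S₃)         ∎) (λ eq → cong (λ s → s * (s * s)) eq)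
    where
    open ≤-Reasoning
    n = length xs
    S = sumOver xs f
    S₂ = ∑[ x ∈ xs ] f x * f x
    S₃ = ∑[ x ∈ xs ] f x * (f x * f x)

  -- Hölder with exponents 3 and 3/2. With T = Σ f²g, Cauchy-Schwarz gives P² ≤ T Y and T² ≤ X P;
  -- eliminating T leaves P⁴ ≤ X P Y².
  hölder : ∀ (f g : I → ℕ) → let P = sumOver xs (λ x → f x * (g x * g x)) ; Y = ∑[ x ∈ xs ] g x * (g x * g x) in
           P * (P * P) ≤ (∑[ x ∈ xs ] f x * (f x * f x)) * (Y * Y)
  hölder f g = cancel-factor P (begin
    P * (P * (P * P))      ≡⟨ solve 1 (λ s → s :* (s :* (s :* s)) := (s :* s) :* (s :* s)) refl P ⟩
    (P * P) * (P * P)      ≤⟨ *-mono-≤ P²≤TY P²≤TY ⟩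
    T * Y * (T * Y)        ≡⟨ solve 2 (λ t y → t :* y :* (t :* y) := t :* t :* (y :* y)) refl T Y ⟩
    T * T * (Y * Y)        ≤⟨ *-monoˡ-≤ (Y * Y) (cauchy-schwarz f f g) ⟩
    X * P * (Y * Y)        ≡⟨ solve 3 (λ x p y → x :* p :* y := p :* (x :* y)) refl X P (Y * Y) ⟩
    P * (X * (Y * Y))      ∎) (λ eq → cong (λ s → s * (s * s)) eq)
    where
    open ≤-Reasoning
    P = sumOver xs (λ x → f x * (g x * g x))
    T = sumOver xs (λ x → f x * (f x * g x))
    X = sumOver xs (λ x → f x * (f x * f x))
    Y = sumOver xs (λ x → g x * (g x * g x))
    P²≤TY : P * P ≤ T * Y
    P²≤TY = subst₂ _≤_
      (cong (λ z → z * z) (sum-cong xs λ x → solve 2 (λ f g → g :* (f :* g) := f :* (g :* g)) refl (f x) (g x)))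
      (cong (_* Y) (sum-cong xs λ x → solve 2 (λ f g → g :* (f :* f) := f :* (f :* g)) refl (f x) (g x)))
      (cauchy-schwarz g f g)

-- Cauchy-Schwarz over the H values of h. It is applied with h the diagonal of a cell, in
-- `richness²≤`, and with h the product of a pair, in `F⁴≤`.
fibre-cauchy-schwarz : ∀ {I : Set} (xs : List I) {H} (h : I → Fin H) (f : I → ℕ) →
  sumOver xs f * sumOver xs f ≤ H * (∑[ x ∈ xs ] ∑[ y ∈ xs ] f x * f y * ⟦ h x Fin.≟ h y ⟧)
fibre-cauchy-schwarz xs {H} h f = begin
  sumOver xs f * sumOver xs f
    ≤⟨ *-mono-≤ split split ⟩
  sumOver (allFin H) c * sumOver (allFin H) c
    ≤⟨ sum²≤ (allFin H) c ⟩
  length (allFin H) * (∑[ v ∈ allFin H ] c v * c v)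
    ≡⟨ cong₂ _*_ (length-allFin H) (trans (sum-cong (allFin H) λ v → sum*sum xs xs _ _)
         (trans (sum-swap (allFin H) xs _) (sum-cong xs λ x → sum-swap (allFin H) xs _))) ⟩
  H * (∑[ x ∈ xs ] ∑[ y ∈ xs ] ∑[ v ∈ allFin H ] f x * ⟦ h x Fin.≟ v ⟧ * (f y * ⟦ h y Fin.≟ v ⟧))
    ≤⟨ *-monoʳ-≤ H (sum-mono xs λ x → sum-mono xs λ y → pair x y) ⟩
  H * (∑[ x ∈ xs ] ∑[ y ∈ xs ] f x * f y * ⟦ h x Fin.≟ h y ⟧) ∎
  where
  open ≤-Reasoning
  c : Fin H → ℕ
  c v = ∑[ x ∈ xs ] f x * ⟦ h x Fin.≟ v ⟧
  split : sumOver xs f ≤ sumOver (allFin H) c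
  split = ≤-trans
    (sum-mono xs λ x → ≤-trans (≤-reflexive (sym (*-identityʳ (f x))))
      (≤-trans (*-monoʳ-≤ (f x) (fin-count≥1 (h x Fin.≟_) refl))
        (≤-reflexive (sum-*ˡ (allFin H) (f x) λ v → ⟦ h x Fin.≟ v ⟧))))
    (≤-reflexive (sum-swap xs (allFin H) _))
  pair : ∀ x y → (∑[ v ∈ allFin H ] f x * ⟦ h x Fin.≟ v ⟧ * (f y * ⟦ h y Fin.≟ v ⟧)) ≤ f x * f y * ⟦ h x Fin.≟ h y ⟧
  pair x y = begin
    (∑[ v ∈ allFin H ] f x * ⟦ h x Fin.≟ v ⟧ * (f y * ⟦ h y Fin.≟ v ⟧))
      ≡⟨ sum-cong (allFin H) (λ v → solve 4 (λ a b c d → a :* b :* (c :* d) := a :* c :* (b :* d)) refl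
           (f x) ⟦ h x Fin.≟ v ⟧ (f y) ⟦ h y Fin.≟ v ⟧) ⟩
    (∑[ v ∈ allFin H ] f x * f y * (⟦ h x Fin.≟ v ⟧ * ⟦ h y Fin.≟ v ⟧))
      ≤⟨ sum-mono (allFin H) (λ v → *-monoʳ-≤ (f x * f y) (⟦⟧*≤ (h x Fin.≟ v) λ hx≡v →
           ≤-trans (⟦⟧-mono (h y Fin.≟ v) (h x Fin.≟ h y) λ hy≡v → trans hx≡v (sym hy≡v))
             (≤-reflexive (sym (trans (cong (⟦ h x Fin.≟ h y ⟧ *_) (⟦⟧-true (h x Fin.≟ v) hx≡v)) (*-identityʳ _)))))) ⟩
    (∑[ v ∈ allFin H ] f x * f y * (⟦ h x Fin.≟ h y ⟧ * ⟦ h x Fin.≟ v ⟧))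
      ≡⟨ trans (sum-cong (allFin H) λ v → sym (*-assoc (f x * f y) ⟦ h x Fin.≟ h y ⟧ ⟦ h x Fin.≟ v ⟧))
           (sym (sum-*ˡ (allFin H) (f x * f y * ⟦ h x Fin.≟ h y ⟧) λ v → ⟦ h x Fin.≟ v ⟧)) ⟩
    f x * f y * ⟦ h x Fin.≟ h y ⟧ * (∑[ v ∈ allFin H ] ⟦ h x Fin.≟ v ⟧)
      ≤⟨ *-monoʳ-≤ (f x * f y * ⟦ h x Fin.≟ h y ⟧) (fin-count≤1 (h x Fin.≟_) λ p q → trans (sym p) q) ⟩
    f x * f y * ⟦ h x Fin.≟ h y ⟧ * 1
      ≡⟨ *-identityʳ _ ⟩
    f x * f y * ⟦ h x Fin.≟ h y ⟧ ∎

-- Dyadic pigeonholing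

cube : ℕ → ℕ
cube x = x * (x * x)

cube-mono : ∀ {x y} → x ≤ y → cube x ≤ cube y
cube-mono le = *-mono-≤ le (*-mono-≤ le le)

-- For k ≥ 1 the top scale 2^j ≤ k < 2^(j+1) suffices, as k³ ≤ 8 (2^j)³.
dyadic-layers : ∀ K k → k < 2 ^ K → cube k ≤ (∑[ j ∈ downFrom K ] 8 * cube (2 ^ j) * ⟦ 2 ^ j ≤? k ⟧)
dyadic-layers zero    zero    _ = z≤n
dyadic-layers zero    (suc k) (s≤s ())
dyadic-layers (suc K) k k< with 2 ^ K ≤? k
... | no  2^K≰k = ≤-trans (dyadic-layers K k (≰⇒> 2^K≰k)) (m≤n+m _ (8 * cube (2 ^ K) * 0))
... | yes 2^K≤k = ≤-trans (cube-mono (<⇒≤ k<)) (≤-trans (≤-reflexive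
  (solve 1 (λ x → con 2 :* x :* (con 2 :* x :* (con 2 :* x)) := con 8 :* (x :* (x :* x)) :* con 1) refl (2 ^ K)))
  (m≤m+n _ _))

some-term≥average : ∀ {I : Set} x (xs : List I) (f : I → ℕ) →
                    ∃ λ y → sumOver (x ∷ xs) f ≤ length (x ∷ xs) * f y
some-term≥average x []        f = x , ≤-refl
some-term≥average x (x′ ∷ xs) f with some-term≥average x′ xs f
... | y , le with ≤-total (f x) (f y)
...   | inj₁ fx≤fy = y , +-mono-≤ fx≤fy le
...   | inj₂ fy≤fx = x , +-monoʳ-≤ (f x) (≤-trans le (*-monoʳ-≤ (length (x′ ∷ xs)) fy≤fx))

dyadic-pigeonhole : ∀ {I : Set} (xs : List I) (k : I → ℕ) K → (∀ x → k x < 2 ^ K) →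
  ∃ λ t → 1 ≤ t × (∑[ x ∈ xs ] cube (k x)) ≤ K * (8 * cube t * (∑[ x ∈ xs ] ⟦ t ≤? k x ⟧))
dyadic-pigeonhole xs k K k< = pick K (≤-trans (sum-mono xs λ x → dyadic-layers K (k x) (k< x)) (≤-reflexive (trans
  (sum-swap xs (downFrom K) _)
  (sum-cong (downFrom K) λ j → sym (sum-*ˡ xs (8 * cube (2 ^ j)) λ x → ⟦ 2 ^ j ≤? k x ⟧)))))
  where
  layer : ℕ → ℕ
  layer j = 8 * cube (2 ^ j) * (∑[ x ∈ xs ] ⟦ 2 ^ j ≤? k x ⟧)
  pick : ∀ K → (∑[ x ∈ xs ] cube (k x)) ≤ sumOver (downFrom K) layer →
         ∃ λ t → 1 ≤ t × (∑[ x ∈ xs ] cube (k x)) ≤ K * (8 * cube t * (∑[ x ∈ xs ] ⟦ t ≤? k x ⟧))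
  -- Without scales the bound `le` says that the sum is 0, and any positive threshold serves.
  pick zero    le = 1 , ≤-refl , le
  pick (suc K) le with some-term≥average K (downFrom K) layer
  ... | j , le′ = 2 ^ j , m^n>0 2 j , ≤-trans le (≤-trans le′ (≤-reflexive (cong (_* layer j) (length-downFrom (suc K)))))

-- Rich lines in a grid

points : ∀ n → List (Fin n × Fin n)
points n = cartesianProduct (allFin n) (allFin n)

sum-≤-fin : ∀ n {f : Fin n → ℕ} c → (∀ i → f i ≤ c) → sumOver (allFin n) f ≤ n * c
sum-≤-fin n c le = ≤-trans (sum-≤-const (allFin n) c le) (≤-reflexive (cong (_* c) (length-allFin n)))

+-squeeze : ∀ {a a′ b b′} → a ≤ a′ → b ≤ b′ → a + b ≡ a′ + b′ → a ≡ a′ × b ≡ b′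
+-squeeze {a} {a′} {b} {b′} a≤ b≤ eq = a≡a′ , +-cancelˡ-≡ a b b′ (trans eq (cong (_+ b′) (sym a≡a′)))
  where
  a≡a′ : a ≡ a′
  a≡a′ = ≤-antisym a≤ (+-cancelʳ-≤ b a′ a (≤-trans (+-monoʳ-≤ a′ b≤) (≤-reflexive (sym eq))))

opaque
  -- The factor 8 comes from `dyadic-pigeonhole`, the factor 32 from `count-rich`.
  κ : ℕ
  κ = 256

  κ≡ : κ ≡ 8 * 32
  κ≡ = refl

-- Geometry enters through two properties: a line is monotone for the order of the coordinates, and
-- at most one line of `Λ` passes through two given points in different columns. The coordinates
-- themselves enter by rank alone.
module RichLines
  {n : ℕ} (rank : Fin n → ℕ) (rank<n : ∀ i → rank i < n) (rank-injective : ∀ {i j} → rank i ≡ rank j → i ≡ j)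
  {L : Set} (Λ : List L) (On : L → Fin n × Fin n → Set) (on? : ∀ ℓ p → Dec (On ℓ p))
  (monotone : ∀ ℓ →
    (∀ {i j i′ j′} → On ℓ (i , j) → On ℓ (i′ , j′) → rank i ≤ rank i′ → rank j ≤ rank j′) ⊎
    (∀ {i j i′ j′} → On ℓ (i , j) → On ℓ (i′ , j′) → rank i ≤ rank i′ → rank j′ ≤ rank j))
  (two-points : ∀ {i j i′ j′} → i ≢ i′ → (∑[ ℓ ∈ Λ ] ⟦ on? ℓ (i , j) ⟧ * ⟦ on? ℓ (i′ , j′) ⟧) ≤ 1)
  where

  richness : L → ℕ
  richness ℓ = ∑[ p ∈ points n ] ⟦ on? ℓ p ⟧

  richness≤n² : ∀ ℓ → richness ℓ ≤ n * n
  richness≤n² ℓ = begin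
    richness ℓ                                             ≡⟨ sum-× (allFin n) (allFin n) _ ⟩
    (∑[ i ∈ allFin n ] ∑[ j ∈ allFin n ] ⟦ on? ℓ (i , j) ⟧)
      ≤⟨ sum-≤-fin n n (λ i → ≤-trans (sum-≤-fin n 1 λ j → ⟦⟧≤1 (on? ℓ (i , j))) (≤-reflexive (*-identityʳ n))) ⟩
    n * n                                                  ∎
    where open ≤-Reasoning

  -- Equal columns have equal ranks, so monotonicity applied in both directions equates the ranks of
  -- the ordinates: no line is vertical.
  functional : ∀ ℓ {i j i′ j′} → On ℓ (i , j) → On ℓ (i′ , j′) → i ≡ i′ → j ≡ j′
  functional ℓ {i} p p′ refl with monotone ℓ
  ... | inj₁ inc = rank-injective (≤-antisym (inc p p′ ≤-refl) (inc p′ p ≤-refl))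
  ... | inj₂ dec = rank-injective (≤-antisym (dec p′ p ≤-refl) (dec p p′ ≤-refl))

  -- There are suc r blocks, each of length suc d.
  module Blocks (r d : ℕ) (n≤ : n ≤ suc r * suc d) where

    block : Fin n → ℕ
    block i = rank i / suc d

    block≤r : ∀ i → block i ≤ r
    block≤r i = s≤s⁻¹ (m<n*o⇒m/o<n {o = suc d} (<-≤-trans (rank<n i) n≤))

    block-mono : ∀ {i i′} → rank i ≤ rank i′ → block i ≤ block i′
    block-mono = /-monoˡ-≤ (suc d)

    -- A rank in a given block is determined by its remainder modulo `suc d`, and ranks are
    -- injective.
    block-size : ∀ i → (∑[ j ∈ allFin n ] ⟦ block i ≟ block j ⟧) ≤ suc d
    block-size i = begin
      (∑[ j ∈ allFin n ] ⟦ block i ≟ block j ⟧)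
        ≤⟨ sum-mono (allFin n) (λ j → ⟦⟧≤ (block i ≟ block j) λ eq →
             fin-count≥1 (λ v → rank j ≟ toℕ v + block i * suc d) {fromℕ< (m%n<n (rank j) (suc d))} (begin-equality
               rank j                                ≡⟨ m≡m%n+[m/n]*n (rank j) (suc d) ⟩
               rank j % suc d + block j * suc d
                 ≡⟨ cong₂ (λ a b → a + b * suc d) (sym (Fin.toℕ-fromℕ< (m%n<n (rank j) (suc d)))) (sym eq) ⟩
               toℕ (fromℕ< (m%n<n (rank j) (suc d))) + block i * suc d ∎)) ⟩
      (∑[ j ∈ allFin n ] ∑[ v ∈ allFin (suc d) ] ⟦ rank j ≟ toℕ v + block i * suc d ⟧)
        ≡⟨ sum-swap (allFin n) (allFin (suc d)) _ ⟩
      (∑[ v ∈ allFin (suc d) ] ∑[ j ∈ allFin n ] ⟦ rank j ≟ toℕ v + block i * suc d ⟧)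
        ≤⟨ sum-≤-fin (suc d) 1 (λ v → fin-count≤1 (λ j → rank j ≟ toℕ v + block i * suc d)
             λ p q → rank-injective (trans p (sym q))) ⟩
      suc d * 1
        ≡⟨ *-identityʳ (suc d) ⟩
      suc d ∎
      where open ≤-Reasoning

    near near≢ : Fin n → Fin n → ℕ
    near  i i′ = ⟦ block i ≟ block i′ ⟧
    near≢ i i′ = ⟦ ¬? (i Fin.≟ i′) ⟧ * near i i′

    -- Leaving out i itself saves one, and the saving matters: for d = 0 the blocks are singletons
    -- and `close-total` has to give 0.
    near≢-size : ∀ i → sumOver (allFin n) (near≢ i) ≤ d
    near≢-size i = s≤s⁻¹ (begin
      1 + sumOver (allFin n) (near≢ i)
        ≤⟨ +-monoˡ-≤ _ (≤-trans (≤-reflexive (sym (⟦⟧*near i refl)))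
             (term≤sum (λ i′ → ⟦ i Fin.≟ i′ ⟧ * near i i′) (∈-allFin i))) ⟩
      (∑[ i′ ∈ allFin n ] ⟦ i Fin.≟ i′ ⟧ * near i i′) + sumOver (allFin n) (near≢ i)
        ≡⟨ sum-+ (allFin n) _ _ ⟨
      (∑[ i′ ∈ allFin n ] ⟦ i Fin.≟ i′ ⟧ * near i i′ + near≢ i i′)
        ≡⟨ sum-cong (allFin n) (λ i′ → trans (sym (*-distribʳ-+ (near i i′) ⟦ i Fin.≟ i′ ⟧ _))
             (trans (cong (_* near i i′) (⟦⟧+⟦¬⟧ (i Fin.≟ i′))) (*-identityˡ _))) ⟩
      (∑[ i′ ∈ allFin n ] near i i′)
        ≤⟨ block-size i ⟩
      suc d ∎)
      where
      open ≤-Reasoning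
      ⟦⟧*near : ∀ i′ → i ≡ i′ → ⟦ i Fin.≟ i′ ⟧ * near i i′ ≡ 1
      ⟦⟧*near i′ refl = cong₂ _*_ (⟦⟧-true (i Fin.≟ i) refl) (⟦⟧-true (block i ≟ block i) refl)

    close : L → ℕ
    close ℓ = ∑[ p ∈ points n ] ∑[ p′ ∈ points n ] ⟦ on? ℓ p ⟧ * ⟦ on? ℓ p′ ⟧ *
                (near≢ (proj₁ p) (proj₁ p′) * near (proj₂ p) (proj₂ p′))

    cells : ℕ
    cells = suc (r + r)

    -- Along a monotone line block i + η j determines the cell, so that the line meets
    -- at most 2r + 1 cells.
    richness²≤ : ∀ ℓ (η : Fin n → ℕ) → (∀ j → η j ≤ r) → (∀ {j j′} → η j ≡ η j′ → block j ≡ block j′) →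
      (∀ {i j i′ j′} → On ℓ (i , j) → On ℓ (i′ , j′) → rank i ≤ rank i′ → η j ≤ η j′) →
      richness ℓ * richness ℓ ≤ cells * (richness ℓ + close ℓ)
    richness²≤ ℓ η η≤r η-injective mono = begin
      richness ℓ * richness ℓ
        ≤⟨ fibre-cauchy-schwarz (points n) diagonal on ⟩
      cells * (∑[ p ∈ points n ] ∑[ p′ ∈ points n ] on p * on p′ * ⟦ diagonal p Fin.≟ diagonal p′ ⟧)
        ≤⟨ *-monoʳ-≤ cells (sum-mono (points n) λ p → sum-mono (points n) λ p′ → same-diagonal p p′) ⟩
      cells * (∑[ p ∈ points n ] ∑[ p′ ∈ points n ] on p * (on p′ * ⟦ proj₁ p Fin.≟ proj₁ p′ ⟧)
                  + on p * on p′ * (near≢ (proj₁ p) (proj₁ p′) * near (proj₂ p) (proj₂ p′)))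
        ≡⟨ cong (cells *_) (trans (sum-cong (points n) λ p → sum-+ (points n) _ _) (sum-+ (points n) _ _)) ⟩
      cells * ((∑[ p ∈ points n ] ∑[ p′ ∈ points n ] on p * (on p′ * ⟦ proj₁ p Fin.≟ proj₁ p′ ⟧)) + close ℓ)
        ≤⟨ *-monoʳ-≤ cells (+-monoˡ-≤ (close ℓ) (sum-mono (points n) λ p →
             ≤-trans (≤-reflexive (sym (sum-*ˡ (points n) (on p) _))) (same-column p))) ⟩
      cells * (richness ℓ + close ℓ) ∎
      where
      open ≤-Reasoning
      on : Fin n × Fin n → ℕ
      on p = ⟦ on? ℓ p ⟧
      diagonal : Fin n × Fin n → Fin cells
      diagonal (i , j) = fromℕ< (s≤s (+-mono-≤ (block≤r i) (η≤r j)))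
      same-cell : ∀ {i j i′ j′} → On ℓ (i , j) → On ℓ (i′ , j′) → block i + η j ≡ block i′ + η j′ →
                  block i ≡ block i′ × block j ≡ block j′
      same-cell {i} {j} {i′} {j′} p p′ eq with ≤-total (rank i) (rank i′)
      ... | inj₁ le = let (e , e′) = +-squeeze (block-mono le) (mono p p′ le) eq in e , η-injective e′
      ... | inj₂ ge = let (e , e′) = +-squeeze (block-mono ge) (mono p′ p ge) (sym eq) in sym e , sym (η-injective e′)
      -- Two points of the line on one diagonal share a cell. If they also share a column they
      -- coincide and are counted by the richness; otherwise they form a close pair.
      same-diagonal : ∀ p p′ → on p * on p′ * ⟦ diagonal p Fin.≟ diagonal p′ ⟧ ≤
        on p * (on p′ * ⟦ proj₁ p Fin.≟ proj₁ p′ ⟧) + on p * on p′ * (near≢ (proj₁ p) (proj₁ p′) * near (proj₂ p) (proj₂ p′))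
      same-diagonal p@(i , j) p′@(i′ , j′) with on? ℓ p | on? ℓ p′
      ... | no  _  | _      = z≤n
      ... | yes _  | no  _  = z≤n
      ... | yes pp | yes pp′ with diagonal p Fin.≟ diagonal p′
      ...   | no  _  = z≤n
      ...   | yes eq with i Fin.≟ i′
      ...     | yes _ = s≤s z≤n
      ...     | no  _ with same-cell pp pp′ (Fin.fromℕ<-injective _ _ _ _ eq)
      ...       | e , e′ = ≤-reflexive (sym (trans (+-identityʳ _)
                    (cong₂ (λ a b → (a + 0) * b) (⟦⟧-true (block i ≟ block i′) e) (⟦⟧-true (block j ≟ block j′) e′))))
      same-column : ∀ p → on p * (∑[ p′ ∈ points n ] on p′ * ⟦ proj₁ p Fin.≟ proj₁ p′ ⟧) ≤ on p
      same-column p@(i , j) = ⟦⟧*≤ (on? ℓ p) λ pp → begin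
        (∑[ p′ ∈ points n ] on p′ * ⟦ i Fin.≟ proj₁ p′ ⟧)
          ≤⟨ sum-mono (points n) (λ p′ → ⟦⟧*≤ (on? ℓ p′) λ pp′ → ⟦⟧≤ (i Fin.≟ proj₁ p′) λ i≡ →
               ≤-reflexive (sym (cong₂ _*_ (⟦⟧-true (i Fin.≟ proj₁ p′) i≡)
                 (⟦⟧-true (j Fin.≟ proj₂ p′) (functional ℓ pp pp′ i≡))))) ⟩
        (∑[ p′ ∈ points n ] ⟦ i Fin.≟ proj₁ p′ ⟧ * ⟦ j Fin.≟ proj₂ p′ ⟧)
          ≡⟨ trans (sum-× (allFin n) (allFin n) _) (sym (sum*sum (allFin n) (allFin n) _ _)) ⟩
        (∑[ i′ ∈ allFin n ] ⟦ i Fin.≟ i′ ⟧) * (∑[ j′ ∈ allFin n ] ⟦ j Fin.≟ j′ ⟧)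
          ≤⟨ *-mono-≤ (fin-count≤1 (i Fin.≟_) λ p q → trans (sym p) q) (fin-count≤1 (j Fin.≟_) λ p q → trans (sym p) q) ⟩
        1
          ≡⟨ ⟦⟧-true (on? ℓ p) pp ⟨
        on p ∎

    -- Since `2 * cells ≤ α`, the term `cells * α` takes up at most half of α², and the close pairs
    -- account for the rest.
    rich⇒close : ∀ ℓ → 2 * cells ≤ richness ℓ → richness ℓ ≤ close ℓ
    rich⇒close ℓ rich = *-cancelˡ-≤ cells (+-cancelˡ-≤ (cells * α) (cells * α) (cells * close ℓ) (begin
      cells * α + cells * α        ≡⟨ solve 2 (λ h a → h :* a :+ h :* a := con 2 :* h :* a) refl cells α ⟩
      2 * cells * α                ≤⟨ *-monoˡ-≤ α rich ⟩
      α * α                        ≤⟨ α²≤ (monotone ℓ) ⟩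
      cells * (α + close ℓ)        ≡⟨ *-distribˡ-+ cells α (close ℓ) ⟩
      cells * α + cells * close ℓ  ∎))
      where
      open ≤-Reasoning
      α = richness ℓ
      α²≤ : _ ⊎ _ → α * α ≤ cells * (α + close ℓ)
      α²≤ (inj₁ inc) = richness²≤ ℓ block block≤r id λ p p′ le → block-mono (inc p p′ le)
      -- Reflecting the second block index makes a decreasing line increasing.
      α²≤ (inj₂ dec) = richness²≤ ℓ (λ j → r ∸ block j) (λ j → m∸n≤m r (block j))
        (λ {j} {j′} → ∸-cancelˡ-≡ (block≤r j) (block≤r j′))
        (λ p p′ le → ∸-monoʳ-≤ r (block-mono (dec p p′ le)))

    -- The points of a close pair lie in different columns, so the pair is on at most one line of
    -- `Λ`; the right side bounds the number of such pairs in the whole grid.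
    close-total : sumOver Λ close ≤ n * d * (n * suc d)
    close-total = begin
      sumOver Λ close
        ≡⟨ trans (sum-swap Λ (points n) _) (sum-cong (points n) λ p → sum-swap Λ (points n) _) ⟩
      (∑[ p ∈ points n ] ∑[ p′ ∈ points n ] ∑[ ℓ ∈ Λ ] ⟦ on? ℓ p ⟧ * ⟦ on? ℓ p′ ⟧ *
        (near≢ (proj₁ p) (proj₁ p′) * near (proj₂ p) (proj₂ p′)))
        ≤⟨ sum-mono (points n) (λ p → sum-mono (points n) λ p′ →
             ≤-trans (≤-reflexive (sym (sum-*ʳ Λ _ _))) (one-line p p′)) ⟩
      (∑[ p ∈ points n ] ∑[ p′ ∈ points n ] near≢ (proj₁ p) (proj₁ p′) * near (proj₂ p) (proj₂ p′))
        ≡⟨ trans (sum-cong (points n) λ p → trans (sum-× (allFin n) (allFin n) _) (sym (sum*sum (allFin n) (allFin n) _ _)))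
             (trans (sum-× (allFin n) (allFin n) _) (sym (sum*sum (allFin n) (allFin n) _ _))) ⟩
      (∑[ i ∈ allFin n ] sumOver (allFin n) (near≢ i)) * (∑[ j ∈ allFin n ] sumOver (allFin n) (near j))
        ≤⟨ *-mono-≤ (sum-≤-fin n d near≢-size) (sum-≤-fin n (suc d) block-size) ⟩
      n * d * (n * suc d) ∎
      where
      open ≤-Reasoning
      one-line : ∀ p p′ → (∑[ ℓ ∈ Λ ] ⟦ on? ℓ p ⟧ * ⟦ on? ℓ p′ ⟧) * (near≢ (proj₁ p) (proj₁ p′) * near (proj₂ p) (proj₂ p′))
                        ≤ near≢ (proj₁ p) (proj₁ p′) * near (proj₂ p) (proj₂ p′)
      one-line (i , j) (i′ , j′) with i Fin.≟ i′
      ... | yes _   = ≤-reflexive (*-zeroʳ (∑[ ℓ ∈ Λ ] ⟦ on? ℓ (i , j) ⟧ * ⟦ on? ℓ (i′ , j′) ⟧))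
      ... | no i≢i′ = ≤-trans (*-monoˡ-≤ _ (two-points i≢i′)) (≤-reflexive (*-identityˡ _))

  -- Every counted line has at least t close pairs, so N t ≤ n² d (d + 1). As t ≤ 4 (r + 1),
  -- multiplying by t² costs 16 (r + 1)²; then (r + 1) d ≤ n and d (d + 1) ≤ 2 d² lead to 32 = 16 ·
  -- 2.
  count-rich : ∀ t → 1 ≤ t → cube t * (∑[ ℓ ∈ Λ ] ⟦ t ≤? richness ℓ ∸ 1 ⟧) ≤ 32 * (n * n * (n * n))
  count-rich (suc u) _ = begin
    cube t * N                               ≤⟨ *-monoˡ-≤ N (*-monoʳ-≤ t (*-mono-≤ t≤4r t≤4r)) ⟩
    t * (4 * suc r * (4 * suc r)) * N        ≡⟨ solve 3 (λ t r N → t :* (con 4 :* r :* (con 4 :* r)) :* N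
                                                  := con 16 :* (r :* r :* (N :* t))) refl t (suc r) N ⟩
    16 * (suc r * suc r * (N * t))           ≤⟨ *-monoʳ-≤ 16 (*-monoʳ-≤ (suc r * suc r) Nt≤) ⟩
    16 * (suc r * suc r * (n * d * (n * suc d)))
      ≡⟨ solve 4 (λ r n d e → con 16 :* (r :* r :* (n :* d :* (n :* e))) := con 16 :* (n :* n :* (r :* r :* (d :* e)))) refl (suc r) n d (suc d) ⟩
    16 * (n * n * (suc r * suc r * (d * suc d)))
      ≤⟨ *-monoʳ-≤ 16 (*-monoʳ-≤ (n * n) (*-monoʳ-≤ (suc r * suc r) (d[1+d]≤2d² d))) ⟩
    16 * (n * n * (suc r * suc r * (2 * (d * d))))
      ≡⟨ solve 3 (λ r n d → con 16 :* (n :* n :* (r :* r :* (con 2 :* (d :* d)))) := con 32 :* (n :* n :* (d :* r :* (d :* r)))) refl (suc r) n d ⟩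
    32 * (n * n * (d * suc r * (d * suc r)))
      ≤⟨ *-monoʳ-≤ 32 (*-monoʳ-≤ (n * n) (*-mono-≤ dr≤n dr≤n)) ⟩
    32 * (n * n * (n * n))                   ∎
    where
    open ≤-Reasoning
    t = suc u
    -- With t = u + 1 this gives 2 (2r + 1) ≤ t + 1, and `t ≤ richness ℓ ∸ 1` provides at least t +
    -- 1 points.
    r = u / 4
    d = n / suc r
    N = ∑[ ℓ ∈ Λ ] ⟦ t ≤? richness ℓ ∸ 1 ⟧
    dr≤n : d * suc r ≤ n
    dr≤n = m/n*n≤m n (suc r)
    below : ∀ m k → suc m ≤ suc (m / suc k) * suc k
    below m k = begin
      suc m                                       ≡⟨ cong suc (m≡m%n+[m/n]*n m (suc k)) ⟩
      suc (m % suc k) + m / suc k * suc k         ≤⟨ +-monoˡ-≤ (m / suc k * suc k) (m%n<n m (suc k)) ⟩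
      suc k + m / suc k * suc k                   ∎
    t≤4r : t ≤ 4 * suc r
    t≤4r = ≤-trans (below u 3) (≤-reflexive (*-comm (suc r) 4))
    n≤ : n ≤ suc r * suc d
    n≤ = ≤-trans (n≤1+n n) (≤-trans (below n r) (≤-reflexive (*-comm (suc d) (suc r))))
    open Blocks r d n≤
    d[1+d]≤2d² : ∀ d → d * suc d ≤ 2 * (d * d)
    d[1+d]≤2d² zero    = z≤n
    d[1+d]≤2d² (suc e) = ≤-trans (*-monoʳ-≤ (suc e) (s≤s (s≤s (m≤n+m e e)))) (≤-reflexive
      (solve 1 (λ e → (con 1 :+ e) :* (con 2 :+ (e :+ e)) := con 2 :* ((con 1 :+ e) :* (con 1 :+ e))) refl e))
    2cells≤ : ∀ {α} → t ≤ α ∸ 1 → 2 * cells ≤ α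
    2cells≤ {suc α} t≤α = begin
      2 * suc (r + r)     ≡⟨ solve 1 (λ r → con 2 :* (con 1 :+ (r :+ r)) := con 2 :+ r :* con 4) refl r ⟩
      2 + r * 4           ≤⟨ +-monoʳ-≤ 2 (m/n*n≤m u 4) ⟩
      suc t               ≤⟨ s≤s t≤α ⟩
      suc α               ∎
    Nt≤ : N * t ≤ n * d * (n * suc d)
    Nt≤ = ≤-trans (≤-reflexive (sum-*ʳ Λ _ t)) (≤-trans
      (sum-mono Λ λ ℓ → ⟦⟧*≤ (t ≤? richness ℓ ∸ 1) λ t≤ →
        ≤-trans t≤ (≤-trans (m∸n≤m (richness ℓ) 1) (rich⇒close ℓ (2cells≤ t≤))))
      close-total)

  -- The richness is lowered by 1 to discard lines with a single point, whose number the two-point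
  -- property does not limit. The factor M counts the dyadic scales.
  szemerédi-trotter : ∀ M → n * n < 2 ^ M →
    (∑[ ℓ ∈ Λ ] cube (richness ℓ ∸ 1)) ≤ κ * (M * (n * n * (n * n)))
  szemerédi-trotter M n²<2^M
    with dyadic-pigeonhole Λ (λ ℓ → richness ℓ ∸ 1) M
           (λ ℓ → ≤-<-trans (≤-trans (m∸n≤m (richness ℓ) 1) (richness≤n² ℓ)) n²<2^M)
  ... | t , 1≤t , le = begin
    (∑[ ℓ ∈ Λ ] cube (richness ℓ ∸ 1))  ≤⟨ le ⟩
    M * (8 * cube t * N)                ≡⟨ cong (M *_) (*-assoc 8 (cube t) N) ⟩
    M * (8 * (cube t * N))              ≤⟨ *-monoʳ-≤ M (*-monoʳ-≤ 8 (count-rich t 1≤t)) ⟩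
    M * (8 * (32 * (n * n * (n * n))))  ≡⟨ solve 4 (λ a b m x → m :* (a :* (b :* x)) := a :* b :* (m :* x)) refl 8 32 M (n * n * (n * n)) ⟩
    8 * 32 * (M * (n * n * (n * n)))    ≡⟨ cong (_* (M * (n * n * (n * n)))) κ≡ ⟨
    κ * (M * (n * n * (n * n)))         ∎
    where
    open ≤-Reasoning
    N = ∑[ ℓ ∈ Λ ] ⟦ t ≤? richness ℓ ∸ 1 ⟧

-- Two grids cut by a common family of lines

length-points : ∀ n → length (points n) ≡ n * n
length-points n = begin-equality
  length (points n)                                  ≡⟨ length-as-sum (points n) ⟩
  (∑[ _ ∈ points n ] 1)                              ≡⟨ sum-× (allFin n) (allFin n) _ ⟩
  (∑[ _ ∈ allFin n ] ∑[ _ ∈ allFin n ] 1)            ≡⟨ sum-const (allFin n) _ ⟩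
  length (allFin n) * (∑[ _ ∈ allFin n ] 1)          ≡⟨ cong (length (allFin n) *_) (length-as-sum (allFin n)) ⟨
  length (allFin n) * length (allFin n)              ≡⟨ cong₂ _*_ (length-allFin n) (length-allFin n) ⟩
  n * n                                              ∎
  where open ≤-Reasoning

∈-points : ∀ {n} (p : Fin n × Fin n) → p ∈ points n
∈-points (i , j) = ∈-cartesianProduct⁺ (∈-allFin i) (∈-allFin j)

cube-* : ∀ c x → cube (c * x) ≡ cube c * cube x
cube-* = solve 2 (λ c x → c :* x :* (c :* x :* (c :* x)) := c :* (c :* c) :* (x :* (x :* x))) refl

-- Undoes the lowering of the richness, as x ≤ 2 (x - 1) for x ≥ 2; the summand 1 takes care of x =
-- 1 and is paid once per line.
cube≤8[1+cube-pred] : ∀ x → cube x ≤ 8 * (1 + cube (x ∸ 1))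
cube≤8[1+cube-pred] 0             = z≤n
cube≤8[1+cube-pred] 1             = s≤s z≤n
cube≤8[1+cube-pred] (suc (suc x)) = begin
  cube (2 + x)                 ≤⟨ cube-mono (s≤s (s≤s (m≤n+m x x))) ⟩
  cube (2 + (x + x))           ≡⟨ cong cube (solve 1 (λ x → con 2 :+ (x :+ x) := con 2 :* (con 1 :+ x)) refl x) ⟩
  cube (2 * suc x)             ≡⟨ cube-* 2 (suc x) ⟩
  8 * cube (suc x)             ≤⟨ *-monoʳ-≤ 8 (n≤1+n (cube (suc x))) ⟩
  8 * (1 + cube (suc x))       ∎
  where open ≤-Reasoning

[m+n]²≤2[m²+n²] : ∀ m n → (m + n) * (m + n) ≤ 2 * (m * m + n * n)
[m+n]²≤2[m²+n²] m n = begin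
  (m + n) * (m + n)
    ≤⟨ +-cancelʳ-≤ (2 * (m * n)) _ _ (≤-trans (≤-reflexive
         (solve 2 (λ m n → (m :+ n) :* (m :+ n) :+ con 2 :* (m :* n) := m :* m :+ n :* n :+ con 4 :* (m :* n)) refl m n))
         (≤-trans (+-monoʳ-≤ (m * m + n * n) (4mn≤ m n)) (≤-reflexive
         (solve 2 (λ m n → m :* m :+ n :* n :+ (m :* m :+ n :* n :+ con 2 :* (m :* n))
            := con 2 :* (m :* m :+ n :* n) :+ con 2 :* (m :* n)) refl m n)))) ⟩
  2 * (m * m + n * n) ∎
  where
  open ≤-Reasoning
  4mn≤ : ∀ m n → 4 * (m * n) ≤ m * m + n * n + 2 * (m * n)
  4mn≤ m n = ≤-trans (4uv≤[u+v]² m n) (≤-reflexive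
    (solve 2 (λ m n → (m :+ n) :* (m :+ n) := m :* m :+ n :* n :+ con 2 :* (m :* n)) refl m n))

sum-halves : ∀ {Q Q₁ Q₂} → Q ≤ 2 * (Q₁ + Q₂) → Q ≤ 4 * Q₁ ⊎ Q ≤ 4 * Q₂
sum-halves {Q} {Q₁} {Q₂} le with ≤-total Q₁ Q₂
... | inj₁ Q₁≤Q₂ = inj₂ (≤-trans le (≤-trans (*-monoʳ-≤ 2 (+-monoˡ-≤ Q₂ Q₁≤Q₂))
                     (≤-reflexive (solve 1 (λ q → con 2 :* (q :+ q) := con 4 :* q) refl Q₂))))
... | inj₂ Q₂≤Q₁ = inj₁ (≤-trans le (≤-trans (*-monoʳ-≤ 2 (+-monoʳ-≤ Q₁ Q₂≤Q₁))
                     (≤-reflexive (solve 1 (λ q → con 2 :* (q :+ q) := con 4 :* q) refl Q₁))))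

opaque
  -- `κ′` comes from the bound on `Γ`. The powers of 4 in `c₁` and `c₂` come from `sum-halves`, the
  -- factor `8 * κ` from the doubled lowered richness in `P`.
  κ′ c₁ c₂ : ℕ
  κ′ = 8 * (1 + κ)
  c₁ = 16 * κ′
  c₂ = cube 4 * (8 * κ) * (κ′ * κ′)

  κ′≡ : κ′ ≡ 8 * (1 + κ)
  κ′≡ = refl

  c₁≡ : c₁ ≡ 16 * κ′
  c₁≡ = refl

  c₂≡ : c₂ ≡ cube 4 * (8 * κ) * (κ′ * κ′)
  c₂≡ = refl

combine₁ : ∀ {Q Q₁ W x Γ M y} → Q ≤ 4 * Q₁ → Q₁ * Q₁ ≤ W * (x * Γ) → Γ ≤ κ′ * (M * y) →
           Q * Q ≤ c₁ * (M * (W * (x * y)))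
combine₁ {Q} {Q₁} {W} {x} {Γ} {M} {y} Q≤ Q₁²≤ Γ≤ = begin
  Q * Q                               ≤⟨ *-mono-≤ Q≤ Q≤ ⟩
  4 * Q₁ * (4 * Q₁)                   ≡⟨ solve 1 (λ q → con 4 :* q :* (con 4 :* q) := con 16 :* (q :* q)) refl Q₁ ⟩
  16 * (Q₁ * Q₁)                      ≤⟨ *-monoʳ-≤ 16 (≤-trans Q₁²≤ (*-monoʳ-≤ W (*-monoʳ-≤ x Γ≤))) ⟩
  16 * (W * (x * (κ′ * (M * y))))     ≡⟨ rearrange 16 κ′ W x M y ⟩
  16 * κ′ * (M * (W * (x * y)))       ≡⟨ cong (_* (M * (W * (x * y)))) c₁≡ ⟨
  c₁ * (M * (W * (x * y)))            ∎
  where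
  open ≤-Reasoning
  rearrange : ∀ c d W x M y → c * (W * (x * (d * (M * y)))) ≡ c * d * (M * (W * (x * y)))
  rearrange = solve-* 6 (λ c d W x M y → c · (W · (x · (d · (M · y)))) ⊜ c · d · (M · (W · (x · y)))) refl

combine₂ : ∀ {Q Q₂ P b² x Γ M y} → Q ≤ 4 * Q₂ → Q₂ ≤ b² * P → cube P ≤ 8 * κ * (M * x) * (Γ * Γ) → Γ ≤ κ′ * (M * y) →
           cube Q ≤ c₂ * (cube M * (cube b² * x * (y * y)))
combine₂ {Q} {Q₂} {P} {b²} {x} {Γ} {M} {y} Q≤ Q₂≤ P³≤ Γ≤ = begin
  cube Q
    ≤⟨ cube-mono (≤-trans Q≤ (*-monoʳ-≤ 4 Q₂≤)) ⟩
  cube (4 * (b² * P))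
    ≡⟨ trans (cube-* 4 (b² * P)) (cong (cube 4 *_) (cube-* b² P)) ⟩
  cube 4 * (cube b² * cube P)
    ≤⟨ *-monoʳ-≤ (cube 4) (*-monoʳ-≤ (cube b²) (≤-trans P³≤ (*-monoʳ-≤ (8 * κ * (M * x)) (*-mono-≤ Γ≤ Γ≤)))) ⟩
  cube 4 * (cube b² * (8 * κ * (M * x) * (κ′ * (M * y) * (κ′ * (M * y)))))
    ≡⟨ rearrange (cube 4) (8 * κ) κ′ (cube b²) M x y ⟩
  cube 4 * (8 * κ) * (κ′ * κ′) * (cube M * (cube b² * x * (y * y)))
    ≡⟨ cong (_* (cube M * (cube b² * x * (y * y)))) c₂≡ ⟨
  c₂ * (cube M * (cube b² * x * (y * y))) ∎
  where
  open ≤-Reasoning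
  rearrange : ∀ a c d b⁶ M x y → a * (b⁶ * (c * (M * x) * (d * (M * y) * (d * (M * y)))))
            ≡ a * c * (d * d) * (M * (M * M) * (b⁶ * x * (y * y)))
  rearrange = solve-* 7 (λ a c d b⁶ M x y → a · (b⁶ · (c · (M · x) · (d · (M · y) · (d · (M · y)))))
            ⊜ a · c · (d · d) · (M · (M · M) · (b⁶ · x · (y · y)))) refl

-- Lines are given by a direction and a point: Line s p p′ says that p and p′ lie on
-- a common line of direction s.
record LineStructure : Set₁ where
  infix 4 _∥_
  field
    Coord Dir  : Set
    Line       : Dir → Coord × Coord → Coord × Coord → Set
    line?      : ∀ s p p′ → Dec (Line s p p′)
    line-refl  : ∀ s p → Line s p p
    line-sym   : ∀ s {p p′} → Line s p p′ → Line s p′ p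
    line-trans : ∀ s {p p′ p″} → Line s p p′ → Line s p′ p″ → Line s p p″
    _∥_        : Dir → Dir → Set

module Grids (𝓛 : LineStructure) where
  open LineStructure 𝓛

  at : ∀ {n} → (Fin n → Coord) → Fin n × Fin n → Coord × Coord
  at X (i , j) = X i , X j

  record IsGrid {n} (X : Fin n → Coord) : Set where
    field
      rank           : Fin n → ℕ
      rank<n         : ∀ i → rank i < n
      rank-injective : ∀ {i j} → rank i ≡ rank j → i ≡ j
      monotone       : ∀ s →
        (∀ {i j i′ j′} → Line s (X i , X j) (X i′ , X j′) → rank i ≤ rank i′ → rank j ≤ rank j′) ⊎
        (∀ {i j i′ j′} → Line s (X i , X j) (X i′ , X j′) → rank i ≤ rank i′ → rank j′ ≤ rank j)
      two-points     : ∀ {s s′ i j i′ j′} → i ≢ i′ → Line s (X i , X j) (X i′ , X j′) →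
                       Line s′ (X i , X j) (X i′ , X j′) → s ∥ s′

  -- A line is coded by its direction and one representative among the points of U × U on it, so
  -- every line of the family meets U × U. The points of any grid X on these lines are then counted
  -- by `rich`.
  module Family {b} (U : Fin b → Coord) (S : List Dir) (S-distinct : AllPairs (λ s s′ → ¬ s ∥ s′) S) where

    module R s = Reps {Fin b × Fin b} {λ p p′ → Line s (at U p) (at U p′)} (λ p p′ → line? s (at U p) (at U p′))
                   (λ p → line-refl s (at U p)) (line-sym s) (line-trans s)

    base : Dir → List (Fin b × Fin b)
    base s = R.reps s (points b)

    lines : List (Dir × (Fin b × Fin b))
    lines = concatMap (λ s → map (s ,_) (base s)) S

    sum-lines : ∀ f → sumOver lines f ≡ (∑[ s ∈ S ] ∑[ u ∈ base s ] f (s , u))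
    sum-lines f = trans (sum-concatMap _ S f) (sum-cong S λ s → sum-map (s ,_) (base s) f)

    lines≤ : length lines ≤ length S * (b * b)
    lines≤ = begin
      length lines                    ≡⟨ length-as-sum lines ⟩
      (∑[ _ ∈ lines ] 1)              ≡⟨ sum-lines (λ _ → 1) ⟩
      (∑[ s ∈ S ] ∑[ _ ∈ base s ] 1)
        ≤⟨ sum-≤-const S (b * b) (λ s → subst (_≤ b * b) (length-as-sum (base s))
             (≤-trans (R.length-reps s (points b)) (≤-reflexive (length-points b)))) ⟩
      length S * (b * b)              ∎
      where open ≤-Reasoning

    rich : ∀ {n} → (Fin n → Coord) → Dir → Fin b × Fin b → ℕ
    rich {n} X s u = ∑[ p ∈ points n ] ⟦ line? s (at X p) (at U u) ⟧

    module _ {n} {X : Fin n → Coord} (grid : IsGrid X) where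
      open IsGrid grid

      -- In one direction a point lies on a single line, as the representatives are on different
      -- lines. Two directions that join the same two points of different columns are parallel,
      -- which `S-distinct` excludes.
      one-line : ∀ {p p′} → proj₁ p ≢ proj₁ p′ →
        (∑[ (s , u) ∈ lines ] ⟦ line? s (at X p) (at U u) ⟧ * ⟦ line? s (at X p′) (at U u) ⟧) ≤ 1
      one-line {p} {p′} i≢i′ = ≤-trans (≤-reflexive (sum-lines _)) (sum-≤1
        (λ s → ≤-trans
          (sum-mono (base s) λ u → ≤-trans (*-monoʳ-≤ ⟦ line? s (at X p) (at U u) ⟧ (⟦⟧≤1 (line? s (at X p′) (at U u))))
             (≤-reflexive (*-identityʳ _)))
          (count≤1 (λ u → line? s (at X p) (at U u))
             (AllPairs.map (λ u≁u′ (pu , pu′) → u≁u′ (line-trans s (line-sym s pu) pu′)) (R.reps-distinct s (points b)))))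
        (AllPairs.map (λ {s} {s′} s∦s′ → trans (sum*sum (base s) (base s′) _ _)
          (sum-zero (base s) λ u → sum-zero (base s′) λ u′ → disjoint s s′ u u′ s∦s′)) S-distinct))
        where
        disjoint : ∀ s s′ u u′ → ¬ s ∥ s′ →
          ⟦ line? s (at X p) (at U u) ⟧ * ⟦ line? s (at X p′) (at U u) ⟧ *
          (⟦ line? s′ (at X p) (at U u′) ⟧ * ⟦ line? s′ (at X p′) (at U u′) ⟧) ≡ 0
        disjoint s s′ u u′ s∦s′ with line? s (at X p) (at U u) | line? s (at X p′) (at U u)
                                   | line? s′ (at X p) (at U u′) | line? s′ (at X p′) (at U u′)
        ... | no _   | _      | _      | _      = refl
        ... | yes _  | no _   | _      | _      = refl
        ... | yes _  | yes _  | no _   | _      = refl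
        ... | yes _  | yes _  | yes _  | no _   = refl
        ... | yes pu | yes pu′ | yes qu | yes qu′ = contradiction
          (two-points i≢i′ (line-trans s pu (line-sym s pu′)) (line-trans s′ qu (line-sym s′ qu′))) s∦s′

      rich-lines : ∀ M → n * n < 2 ^ M →
        (∑[ (s , u) ∈ lines ] cube (rich X s u ∸ 1)) ≤ κ * (M * (n * n * (n * n)))
      rich-lines = RichLines.szemerédi-trotter rank rank<n rank-injective lines
        (λ (s , u) p → Line s (at X p) (at U u)) (λ (s , u) p → line? s (at X p) (at U u))
        monotone′ one-line
        where
        monotone′ : ∀ ((s , u) : Dir × (Fin b × Fin b)) →
          (∀ {i j i′ j′} → Line s (X i , X j) (at U u) → Line s (X i′ , X j′) (at U u) → rank i ≤ rank i′ → rank j ≤ rank j′) ⊎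
          (∀ {i j i′ j′} → Line s (X i , X j) (at U u) → Line s (X i′ , X j′) (at U u) → rank i ≤ rank i′ → rank j′ ≤ rank j)
        monotone′ (s , u) with monotone s
        ... | inj₁ inc = inj₁ λ p p′ → inc (line-trans s p (line-sym s p′))
        ... | inj₂ dec = inj₂ λ p p′ → dec (line-trans s p (line-sym s p′))

  -- The grid U is the smaller one.  The points of U × U alone on their line are treated
  -- separately: such lines can be too numerous for Hölder's inequality.
  module Pairs
    {b B} {U : Fin b → Coord} {V : Fin B → Coord} (gridU : IsGrid U) (gridV : IsGrid V) (b≤B : b ≤ B)
    (S : List Dir) (S-distinct : AllPairs (λ s s′ → ¬ s ∥ s′) S) (|S|≤B² : length S ≤ B * B)
    (M : ℕ) (1≤M : 1 ≤ M) (B²<2^M : B * B < 2 ^ M)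
    (g : Dir → Fin b × Fin b → Fin B × Fin B → ℕ)
    (g≤ : ∀ s u v → g s u v ≤ ⟦ line? s (at V v) (at U u) ⟧)
    where
    open Family U S S-distinct
    open ≤-Reasoning

    b⁴ B⁴ : ℕ
    b⁴ = b * b * (b * b)
    B⁴ = B * B * (B * B)

    weight : Dir → ℕ
    weight s = ∑[ u ∈ points b ] ∑[ v ∈ points B ] g s u v

    private
      β γ : Dir → Fin b × Fin b → ℕ
      β = rich U
      γ = rich V

      β-resp : ∀ s {u u′} → Line s (at U u) (at U u′) → β s u ≡ β s u′
      β-resp s {u} {u′} uu′ = sum-cong (points b) λ p → ≤-antisym
        (⟦⟧-mono (line? s (at U p) (at U u)) (line? s (at U p) (at U u′)) λ pu → line-trans s pu uu′)
        (⟦⟧-mono (line? s (at U p) (at U u′)) (line? s (at U p) (at U u)) λ pu → line-trans s pu (line-sym s uu′))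

      γ-resp : ∀ s {u u′} → Line s (at U u) (at U u′) → γ s u ≡ γ s u′
      γ-resp s {u} {u′} uu′ = sum-cong (points B) λ p → ≤-antisym
        (⟦⟧-mono (line? s (at V p) (at U u)) (line? s (at V p) (at U u′)) λ pu → line-trans s pu uu′)
        (⟦⟧-mono (line? s (at V p) (at U u′)) (line? s (at V p) (at U u)) λ pu → line-trans s pu (line-sym s uu′))

      alone : ∀ s u → Dec (β s u ≤ 1)
      alone s u = β s u ≤? 1

      G : Dir → Fin b × Fin b → ℕ
      G s u = ∑[ v ∈ points B ] g s u v

      G≤γ : ∀ s u → G s u ≤ γ s u
      G≤γ s u = sum-mono (points B) (g≤ s u)

      w₁ w₂ : Dir → ℕ
      w₁ s = ∑[ u ∈ points b ] ⟦ alone s u ⟧ * G s u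
      w₂ s = ∑[ u ∈ points b ] ⟦ ¬? (alone s u) ⟧ * G s u

      weight≡ : ∀ s → weight s ≡ w₁ s + w₂ s
      weight≡ s = trans (sum-cong (points b) λ u → trans (sym (*-identityˡ (G s u)))
        (trans (cong (_* G s u) (sym (⟦⟧+⟦¬⟧ (alone s u)))) (*-distribʳ-+ (G s u) ⟦ alone s u ⟧ _)))
        (sum-+ (points b) _ _)

      Q Q₁ Q₂ Γ : ℕ
      Q  = ∑[ s ∈ S ] weight s * weight s
      Q₁ = ∑[ s ∈ S ] w₁ s * w₁ s
      Q₂ = ∑[ s ∈ S ] w₂ s * w₂ s
      Γ  = ∑[ (s , u) ∈ lines ] cube (γ s u)

      Q≤ : Q ≤ 2 * (Q₁ + Q₂)
      Q≤ = begin
        Q                                                ≡⟨ sum-cong S (λ s → cong (λ z → z * z) (weight≡ s)) ⟩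
        (∑[ s ∈ S ] (w₁ s + w₂ s) * (w₁ s + w₂ s))       ≤⟨ sum-mono S (λ s → [m+n]²≤2[m²+n²] (w₁ s) (w₂ s)) ⟩
        (∑[ s ∈ S ] 2 * (w₁ s * w₁ s + w₂ s * w₂ s))     ≡⟨ sum-*ˡ S 2 _ ⟨
        2 * (∑[ s ∈ S ] w₁ s * w₁ s + w₂ s * w₂ s)       ≡⟨ cong (2 *_) (sum-+ S _ _) ⟩
        2 * (Q₁ + Q₂)                                    ∎

      -- For the larger grid the full cubes are affordable: the 1 per line adds up to at most |S| b²
      -- ≤ B⁴. The same count may exceed b⁴, hence the separate treatment of the smaller grid.
      Γ≤ : Γ ≤ κ′ * (M * B⁴)
      Γ≤ = begin
        Γ
          ≤⟨ sum-mono lines (λ (s , u) → cube≤8[1+cube-pred] (γ s u)) ⟩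
        (∑[ (s , u) ∈ lines ] 8 * (1 + cube (γ s u ∸ 1)))
          ≡⟨ trans (sym (sum-*ˡ lines 8 _)) (cong (8 *_) (sum-+ lines _ _)) ⟩
        8 * ((∑[ _ ∈ lines ] 1) + (∑[ (s , u) ∈ lines ] cube (γ s u ∸ 1)))
          ≤⟨ *-monoʳ-≤ 8 (+-mono-≤
               (≤-trans (≤-reflexive (sym (length-as-sum lines))) (≤-trans lines≤ (*-mono-≤ |S|≤B² (*-mono-≤ b≤B b≤B))))
               (rich-lines gridV M B²<2^M)) ⟩
        8 * (B⁴ + κ * (M * B⁴))
          ≤⟨ *-monoʳ-≤ 8 (+-monoˡ-≤ (κ * (M * B⁴)) (≤-trans (≤-reflexive (sym (*-identityˡ B⁴))) (*-monoˡ-≤ B⁴ 1≤M))) ⟩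
        8 * (M * B⁴ + κ * (M * B⁴))
          ≡⟨ trans (solve 3 (λ a k x → a :* (x :+ k :* x) := a :* (con 1 :+ k) :* x) refl 8 κ (M * B⁴)) (cong (_* (M * B⁴)) (sym κ′≡)) ⟩
        κ′ * (M * B⁴) ∎

      -- A point of U × U alone on its line has the line to itself, so a sum over such points is a
      -- sum over lines without repetition. The factor b⁴ is the square of the number of points,
      -- from `sum³≤`.
      cube-w₁≤ : ∀ s → cube (w₁ s) ≤ b⁴ * (∑[ u ∈ base s ] cube (γ s u))
      cube-w₁≤ s = begin
        cube (w₁ s)
          ≤⟨ sum³≤ (points b) _ ⟩
        length (points b) * length (points b) * (∑[ u ∈ points b ] cube (⟦ alone s u ⟧ * G s u))
          ≤⟨ *-mono-≤ (≤-reflexive (cong (λ z → z * z) (length-points b))) (sum-mono (points b) λ u → restrict u) ⟩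
        b⁴ * (∑[ u ∈ points b ] ⟦ alone s u ⟧ * cube (γ s u))
          ≤⟨ *-monoʳ-≤ b⁴ (R.sum-by-class s (points b) _ λ uu′ →
               cong₂ (λ x y → ⟦ x ≤? 1 ⟧ * cube y) (β-resp s uu′) (γ-resp s uu′)) ⟩
        b⁴ * (∑[ u ∈ base s ] β s u * (⟦ alone s u ⟧ * cube (γ s u)))
          ≤⟨ *-monoʳ-≤ b⁴ (sum-mono (base s) λ u → single u) ⟩
        b⁴ * (∑[ u ∈ base s ] cube (γ s u)) ∎
        where
        restrict : ∀ u → cube (⟦ alone s u ⟧ * G s u) ≤ ⟦ alone s u ⟧ * cube (γ s u)
        restrict u with alone s u
        ... | no  _ = z≤n
        ... | yes _ = ≤-trans (cube-mono (≤-trans (≤-reflexive (*-identityˡ _)) (G≤γ s u))) (≤-reflexive (sym (*-identityˡ _)))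
        single : ∀ u → β s u * (⟦ alone s u ⟧ * cube (γ s u)) ≤ cube (γ s u)
        single u with alone s u
        ... | no  _   = ≤-trans (≤-reflexive (*-zeroʳ (β s u))) z≤n
        ... | yes β≤1 = ≤-trans (*-mono-≤ β≤1 (≤-reflexive (*-identityˡ _))) (≤-reflexive (*-identityˡ _))

      -- The second moment is interpolated between the first and the third.
      Q₁²≤ : Q₁ * Q₁ ≤ sumOver S weight * (b⁴ * Γ)
      Q₁²≤ = begin
        Q₁ * Q₁
          ≤⟨ sum²≤sum*cubes S w₁ ⟩
        sumOver S w₁ * (∑[ s ∈ S ] cube (w₁ s))
          ≤⟨ *-mono-≤ (sum-mono S λ s → ≤-trans (m≤m+n (w₁ s) (w₂ s)) (≤-reflexive (sym (weight≡ s))))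
               (≤-trans (sum-mono S cube-w₁≤) (≤-reflexive
                 (trans (sym (sum-*ˡ S b⁴ _)) (cong (b⁴ *_) (sym (sum-lines λ (s , u) → cube (γ s u))))))) ⟩
        sumOver S weight * (b⁴ * Γ) ∎

      P : ℕ
      P = ∑[ (s , u) ∈ lines ] 2 * (β s u ∸ 1) * (γ s u * γ s u)

      -- On these lines β ≥ 2, hence β ≤ 2 (β - 1), which brings in the lowered richness that
      -- `rich-lines` controls.
      w₂²≤ : ∀ s → w₂ s * w₂ s ≤ b * b * (∑[ u ∈ base s ] 2 * (β s u ∸ 1) * (γ s u * γ s u))
      w₂²≤ s = begin
        w₂ s * w₂ s
          ≤⟨ sum²≤ (points b) _ ⟩
        length (points b) * (∑[ u ∈ points b ] ⟦ ¬? (alone s u) ⟧ * G s u * (⟦ ¬? (alone s u) ⟧ * G s u))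
          ≤⟨ *-mono-≤ (≤-reflexive (length-points b)) (sum-mono (points b) λ u → restrict u) ⟩
        b * b * (∑[ u ∈ points b ] ⟦ ¬? (alone s u) ⟧ * (γ s u * γ s u))
          ≤⟨ *-monoʳ-≤ (b * b) (R.sum-by-class s (points b) _ λ uu′ →
               cong₂ (λ x y → ⟦ ¬? (x ≤? 1) ⟧ * (y * y)) (β-resp s uu′) (γ-resp s uu′)) ⟩
        b * b * (∑[ u ∈ base s ] β s u * (⟦ ¬? (alone s u) ⟧ * (γ s u * γ s u)))
          ≤⟨ *-monoʳ-≤ (b * b) (sum-mono (base s) λ u → multiple u) ⟩
        b * b * (∑[ u ∈ base s ] 2 * (β s u ∸ 1) * (γ s u * γ s u)) ∎
        where
        restrict : ∀ u → ⟦ ¬? (alone s u) ⟧ * G s u * (⟦ ¬? (alone s u) ⟧ * G s u) ≤ ⟦ ¬? (alone s u) ⟧ * (γ s u * γ s u)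
        restrict u with alone s u
        ... | yes _ = z≤n
        ... | no  _ = ≤-trans (*-mono-≤ G≤ G≤) (≤-reflexive (sym (*-identityˡ _)))
          where
          G≤ : 1 * G s u ≤ γ s u
          G≤ = ≤-trans (≤-reflexive (*-identityˡ _)) (G≤γ s u)
        2≤⇒ : ∀ {x} → 1 < x → x ≤ 2 * (x ∸ 1)
        2≤⇒ {suc x} (s≤s 1≤x) = ≤-trans (+-monoˡ-≤ x 1≤x) (≤-reflexive (cong (x +_) (sym (+-identityʳ x))))
        multiple : ∀ u → β s u * (⟦ ¬? (alone s u) ⟧ * (γ s u * γ s u)) ≤ 2 * (β s u ∸ 1) * (γ s u * γ s u)
        multiple u with alone s u
        ... | yes _   = ≤-trans (≤-reflexive (*-zeroʳ (β s u))) z≤n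
        ... | no  β≰1 = *-mono-≤ (2≤⇒ (≰⇒> β≰1)) (≤-reflexive (*-identityˡ _))

      Q₂≤ : Q₂ ≤ b * b * P
      Q₂≤ = ≤-trans (sum-mono S w₂²≤) (≤-reflexive
        (trans (sym (sum-*ˡ S (b * b) _)) (cong (b * b *_)
          (sym (sum-lines λ (s , u) → 2 * (β s u ∸ 1) * (γ s u * γ s u))))))

      cube-P≤ : cube P ≤ (8 * κ) * (M * b⁴) * (Γ * Γ)
      cube-P≤ = ≤-trans (hölder lines (λ (s , u) → 2 * (β s u ∸ 1)) (λ (s , u) → γ s u)) (*-monoˡ-≤ (Γ * Γ) (begin
        (∑[ (s , u) ∈ lines ] cube (2 * (β s u ∸ 1)))   ≡⟨ sum-cong lines (λ (s , u) → cube-* 2 (β s u ∸ 1)) ⟩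
        (∑[ (s , u) ∈ lines ] 8 * cube (β s u ∸ 1))     ≡⟨ sum-*ˡ lines 8 _ ⟨
        8 * (∑[ (s , u) ∈ lines ] cube (β s u ∸ 1))
          ≤⟨ *-monoʳ-≤ 8 (rich-lines gridU M (≤-<-trans (*-mono-≤ b≤B b≤B) B²<2^M)) ⟩
        8 * (κ * (M * b⁴))                            ≡⟨ *-assoc 8 κ (M * b⁴) ⟨
        (8 * κ) * (M * b⁴)                                 ∎))

    energy-bound :
      Q * Q ≤ c₁ * (M * (sumOver S weight * (b⁴ * B⁴))) ⊎
      cube Q ≤ c₂ * (cube M * (cube (b * b) * b⁴ * (B⁴ * B⁴)))
    energy-bound = [ (λ Q≤4Q₁ → inj₁ (combine₁ {Q} {Q₁} {sumOver S weight} {b⁴} {Γ} {M} {B⁴} Q≤4Q₁ Q₁²≤ Γ≤))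
                   , (λ Q≤4Q₂ → inj₂ (combine₂ {Q} {Q₂} {P} {b * b} {b⁴} {Γ} {M} {B⁴} Q≤4Q₂ Q₂≤ cube-P≤ Γ≤)) ]′ (sum-halves {Q} {Q₁} {Q₂} Q≤)

-- Signs of real numbers

Zero Pos Neg : ℝ → Set
Zero x = x ≈ℝ 0ℝ
Pos x  = ∃ λ ε → 0ℚ ℚ.< ε × ∃ λ N → ∀ {n} → N ≤ n → ε ℚ.≤ seq x n
Neg x  = Pos (-ℝ x)

Tri : ℝ → Set
Tri x = Pos x ⊎ Zero x ⊎ Neg x

-- Ring identities hold term by term on the sequences, where the rational solver proves them;
-- `Pos-resp` and `Zero-resp` carry signs across them.
_≐_ : ℝ → ℝ → Set
x ≐ y = ∀ n → seq x n ≡ seq y n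

Pos-resp : ∀ {x y} → x ≐ y → Pos x → Pos y
Pos-resp eq (ε , 0<ε , N , h) = ε , 0<ε , N , λ {n} N≤n → subst (ε ℚ.≤_) (eq n) (h N≤n)

Zero-resp : ∀ {x y} → x ≐ y → Zero x → Zero y
Zero-resp eq x≈0 0<ε = let (N , h) = x≈0 0<ε in
  N , λ {n} N≤n → subst (λ z → ℚ.∣ z ℚ.- 0ℚ ∣ ℚ.≤ _) (eq n) (h N≤n)

private
  ∣-0∣ : ∀ p → ℚ.∣ p ℚ.- 0ℚ ∣ ≡ ℚ.∣ p ∣
  ∣-0∣ p = cong ℚ.∣_∣ (solveℚ 1 (λ p → p :- conℚ 0ℚ :=ℚ p) refl p)

  p≤∣p∣ : ∀ p → p ℚ.≤ ℚ.∣ p ∣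
  p≤∣p∣ p with ℚ.∣p∣≡p∨∣p∣≡-p p
  ... | inj₁ eq = ℚ.≤-reflexive (sym eq)
  ... | inj₂ eq = ℚ.≤-trans (subst (ℚ._≤ 0ℚ) (solveℚ 1 (λ p → :- (:- p) :=ℚ p) refl p)
      (ℚ.neg-antimono-≤ (subst (0ℚ ℚ.≤_) eq (ℚ.0≤∣p∣ p)))) (ℚ.0≤∣p∣ p)

≈⇒Zero : ∀ {x y} → x ≈ℝ y → Zero (x -ℝ y)
≈⇒Zero {x} {y} x≈y 0<ε = let (N , h) = x≈y 0<ε in
  N , λ {n} N≤n → ℚ.≤-trans (ℚ.≤-reflexive (∣-0∣ (seq x n ℚ.- seq y n))) (h N≤n)

Zero⇒≈ : ∀ {x y} → Zero (x -ℝ y) → x ≈ℝ y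
Zero⇒≈ {x} {y} x-y≈0 0<ε = let (N , h) = x-y≈0 0<ε in
  N , λ {n} N≤n → ℚ.≤-trans (ℚ.≤-reflexive (sym (∣-0∣ (seq x n ℚ.- seq y n)))) (h N≤n)

Zero-+ : ∀ {x y} → Zero x → Zero y → Zero (x +ℝ y)
Zero-+ {x} {y} x≈0 y≈0 {ε} 0<ε =
  let (M , h) = x≈0 (½-pos 0<ε) ; (N , k) = y≈0 (½-pos 0<ε) in
  M ⊔ N , λ {n} le → let open ℚ.≤-Reasoning in begin
    ℚ.∣ seq x n ℚ.+ seq y n ℚ.- 0ℚ ∣                   ≡⟨ cong ℚ.∣_∣ (solveℚ 2 (λ x y → x :+ℚ y :- conℚ 0ℚ :=ℚ (x :- conℚ 0ℚ) :+ℚ (y :- conℚ 0ℚ)) refl (seq x n) (seq y n)) ⟩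
    ℚ.∣ (seq x n ℚ.- 0ℚ) ℚ.+ (seq y n ℚ.- 0ℚ) ∣        ≤⟨ ℚ.∣p+q∣≤∣p∣+∣q∣ (seq x n ℚ.- 0ℚ) (seq y n ℚ.- 0ℚ) ⟩
    ℚ.∣ seq x n ℚ.- 0ℚ ∣ ℚ.+ ℚ.∣ seq y n ℚ.- 0ℚ ∣      ≤⟨ ℚ.+-mono-≤ (h (m⊔n≤o⇒m≤o M N le)) (k (m⊔n≤o⇒n≤o M N le)) ⟩
    ½ ℚ.* ε ℚ.+ ½ ℚ.* ε                                ≡⟨ ½+½ ε ⟩
    ε                                                  ∎

Zero-*ˡ : ∀ x {y} → Zero y → Zero (x *ℝ y)
Zero-*ˡ x {y} y≈0 {ε} 0<ε =
  let (B , B>0 , K , hB) = eventually-bounded x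
      (δ , 0<δ , Bδ)     = small B {{B>0}} 0<ε
      (N , h)            = y≈0 0<δ in
  K ⊔ N , λ {n} le → let open ℚ.≤-Reasoning in begin
    ℚ.∣ seq x n ℚ.* seq y n ℚ.- 0ℚ ∣  ≡⟨ ∣-0∣ (seq x n ℚ.* seq y n) ⟩
    ℚ.∣ seq x n ℚ.* seq y n ∣         ≤⟨ ∣*∣-bound (seq x n) (seq y n) (ℚ.<⇒≤ (ℚ.positive⁻¹ B {{B>0}})) (hB (m⊔n≤o⇒m≤o K N le))
                                           (subst (ℚ._≤ δ) (∣-0∣ (seq y n)) (h (m⊔n≤o⇒n≤o K N le))) ⟩
    B ℚ.* δ                           ≡⟨ Bδ ⟩
    ε                                 ∎

Pos-+Zero : ∀ {x y} → Pos x → Zero y → Pos (x +ℝ y)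
Pos-+Zero {x} {y} (ε , 0<ε , M , h) y≈0 = let (N , k) = y≈0 (½-pos 0<ε) in
  ½ ℚ.* ε , ½-pos 0<ε , M ⊔ N , λ {n} le → let open ℚ.≤-Reasoning in begin
    ½ ℚ.* ε                               ≡⟨ solveℚ 1 (λ h → h :=ℚ (h :+ℚ h) :- h) refl (½ ℚ.* ε) ⟩
    ½ ℚ.* ε ℚ.+ ½ ℚ.* ε ℚ.- ½ ℚ.* ε       ≡⟨ cong (ℚ._- ½ ℚ.* ε) (½+½ ε) ⟩
    ε ℚ.- ½ ℚ.* ε                         ≤⟨ ℚ.+-mono-≤ (h (m⊔n≤o⇒m≤o M N le))
                                               (lower (subst (ℚ._≤ ½ ℚ.* ε) (∣-0∣ (seq y n)) (k (m⊔n≤o⇒n≤o M N le)))) ⟩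
    seq x n ℚ.+ seq y n                   ∎
  where
  lower : ∀ {p δ} → ℚ.∣ p ∣ ℚ.≤ δ → ℚ.- δ ℚ.≤ p
  lower {p} {δ} le = subst (ℚ.- δ ℚ.≤_) (solveℚ 1 (λ p → :- (:- p) :=ℚ p) refl p)
    (ℚ.neg-antimono-≤ (ℚ.≤-trans (-p≤∣p∣ p) le))
    where
    -p≤∣p∣ : ∀ p → ℚ.- p ℚ.≤ ℚ.∣ p ∣
    -p≤∣p∣ p = ℚ.≤-trans (p≤∣p∣ (ℚ.- p)) (ℚ.≤-reflexive (ℚ.∣-p∣≡∣p∣ p))

Pos-+ : ∀ {x y} → Pos x → Pos y → Pos (x +ℝ y)
Pos-+ (ε , 0<ε , M , h) (δ , 0<δ , N , k) = ε ℚ.+ δ , ℚ.+-mono-< 0<ε 0<δ , M ⊔ N , λ le →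
  ℚ.+-mono-≤ (h (m⊔n≤o⇒m≤o M N le)) (k (m⊔n≤o⇒n≤o M N le))

Pos-* : ∀ {x y} → Pos x → Pos y → Pos (x *ℝ y)
Pos-* {x} {y} (ε , 0<ε , M , h) (δ , 0<δ , N , k) =
  ε ℚ.* δ , ℚ.positive⁻¹ (ε ℚ.* δ) {{ℚ.pos*pos⇒pos ε {{ℚ.positive 0<ε}} δ {{ℚ.positive 0<δ}}}} , M ⊔ N , λ {n} le →
  let x≥ε = h (m⊔n≤o⇒m≤o M N le) ; y≥δ = k (m⊔n≤o⇒n≤o M N le) in
  ℚ.≤-trans (ℚ.*-monoˡ-≤-nonNeg ε {{ℚ.nonNegative (ℚ.<⇒≤ 0<ε)}} y≥δ)
    (ℚ.*-monoʳ-≤-nonNeg (seq y n) {{ℚ.nonNegative (ℚ.≤-trans (ℚ.<⇒≤ 0<δ) y≥δ)}} x≥ε)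

Pos⇒¬Zero : ∀ {x} → Pos x → ¬ Zero x
Pos⇒¬Zero {x} (ε , 0<ε , M , h) x≈0 with x≈0 (½-pos 0<ε)
... | N , k = ℚ.<-irrefl refl (ℚ.<-≤-trans (½ε<ε 0<ε) (ℚ.≤-trans (h (m≤m⊔n M N))
  (ℚ.≤-trans (p≤∣p∣ (seq x (M ⊔ N))) (subst (ℚ._≤ ½ ℚ.* ε) (∣-0∣ (seq x (M ⊔ N))) (k (m≤n⊔m M N))))))
  where
  ½ε<ε : ∀ {ε} → 0ℚ ℚ.< ε → ½ ℚ.* ε ℚ.< ε
  ½ε<ε {ε} 0<ε = subst₂ ℚ._<_ (ℚ.+-identityʳ (½ ℚ.* ε)) (½+½ ε) (ℚ.+-monoʳ-< (½ ℚ.* ε) (½-pos 0<ε))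

Pos⇒¬Neg : ∀ {x} → Pos x → ¬ Neg x
Pos⇒¬Neg {x} x>0 x<0 = Pos⇒¬Zero {x -ℝ x} (Pos-+ {x} { -ℝ x} x>0 x<0) λ 0<ε → 0 , λ {n} _ →
  ℚ.≤-trans (ℚ.≤-reflexive (trans (∣-0∣ (seq x n ℚ.- seq x n)) (cong ℚ.∣_∣ (ℚ.+-inverseʳ (seq x n))))) (ℚ.<⇒≤ 0<ε)

private
  -- A Cauchy sequence that exceeds ε after its oscillation has dropped below ε / 2 is positive.
  not-eventually-positive : ∀ (f : ℕ → ℚ) {ε N} → 0ℚ ℚ.< ε →
    (∀ {m n} → N ≤ m → N ≤ n → f n ℚ.≤ f m ℚ.+ ½ ℚ.* ε) →
    ¬ (∃ λ δ → 0ℚ ℚ.< δ × ∃ λ N → ∀ {n} → N ≤ n → δ ℚ.≤ f n) → ∀ {n} → N ≤ n → f n ℚ.≤ ε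
  not-eventually-positive f {ε} {N} 0<ε near f≯0 {n} N≤n = ℚ.≮⇒≥ λ ε<fn →
    f≯0 (½ ℚ.* ε , ½-pos 0<ε , N , λ {m} N≤m → let open ℚ.≤-Reasoning in begin
      ½ ℚ.* ε                            ≡⟨ solveℚ 1 (λ h → h :=ℚ (h :+ℚ h) :- h) refl (½ ℚ.* ε) ⟩
      ½ ℚ.* ε ℚ.+ ½ ℚ.* ε ℚ.- ½ ℚ.* ε    ≡⟨ cong (ℚ._- ½ ℚ.* ε) (½+½ ε) ⟩
      ε ℚ.- ½ ℚ.* ε                      ≤⟨ ℚ.+-monoˡ-≤ (ℚ.- (½ ℚ.* ε)) (ℚ.≤-trans (ℚ.<⇒≤ ε<fn) (near N≤m N≤n)) ⟩
      f m ℚ.+ ½ ℚ.* ε ℚ.- ½ ℚ.* ε        ≡⟨ solveℚ 2 (λ p d → p :+ℚ d :- d :=ℚ p) refl (f m) (½ ℚ.* ε) ⟩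
      f m                                ∎)

¬Pos∧¬Neg⇒Zero : ∀ {x} → ¬ Pos x → ¬ Neg x → Zero x
¬Pos∧¬Neg⇒Zero {x} x≯0 x≮0 {ε} 0<ε with cauchy x (½-pos 0<ε) | cauchy (-ℝ x) (½-pos 0<ε)
... | M , h | N , k = M ⊔ N , λ {n} le → ℚ.≤-trans (ℚ.≤-reflexive (∣-0∣ (seq x n)))
  ([ (λ eq → subst (ℚ._≤ ε) (sym eq)
       (not-eventually-positive (seq x) 0<ε (λ ≤m ≤n → near (h ≤n ≤m)) x≯0 (m⊔n≤o⇒m≤o M N le)))
   , (λ eq → subst (ℚ._≤ ε) (sym eq)
       (not-eventually-positive (λ n → ℚ.- seq x n) 0<ε (λ ≤m ≤n → near (k ≤n ≤m)) x≮0 (m⊔n≤o⇒n≤o M N le)))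
   ]′ (ℚ.∣p∣≡p∨∣p∣≡-p (seq x n)))
  where
  near : ∀ {p q δ} → ℚ.∣ p ℚ.- q ∣ ℚ.≤ δ → p ℚ.≤ q ℚ.+ δ
  near {p} {q} {δ} le = subst (ℚ._≤ q ℚ.+ δ) (solveℚ 2 (λ p q → q :+ℚ (p :- q) :=ℚ p) refl p q)
    (ℚ.+-monoʳ-≤ q (ℚ.≤-trans (p≤∣p∣ (p ℚ.- q)) le))

-- Refuting both positivity and negativity yields zero, so the three cases cannot all fail, even
-- though none of them can be selected.
trichotomy : ∀ x → ¬ ¬ Tri x
trichotomy x ¬tri = ¬tri (inj₂ (inj₁ (¬Pos∧¬Neg⇒Zero {x} (¬tri ∘ inj₁) (¬tri ∘ inj₂ ∘ inj₂))))

Pos-*-Neg : ∀ {x y} → Pos x → Neg y → Neg (x *ℝ y)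
Pos-*-Neg {x} {y} x>0 y<0 = Pos-resp {x *ℝ (-ℝ y)} { -ℝ (x *ℝ y)} (λ n → sym (ℚ.neg-distribʳ-* (seq x n) (seq y n))) (Pos-* {x} { -ℝ y} x>0 y<0)

Neg-*-Pos : ∀ {x y} → Neg x → Pos y → Neg (x *ℝ y)
Neg-*-Pos {x} {y} x<0 y>0 = Pos-resp {(-ℝ x) *ℝ y} { -ℝ (x *ℝ y)} (λ n → sym (ℚ.neg-distribˡ-* (seq x n) (seq y n))) (Pos-* { -ℝ x} {y} x<0 y>0)

Neg-*-Neg : ∀ {x y} → Neg x → Neg y → Pos (x *ℝ y)
Neg-*-Neg {x} {y} x<0 y<0 = Pos-resp {(-ℝ x) *ℝ (-ℝ y)} {x *ℝ y}
  (λ n → solveℚ 2 (λ x y → :- x :*ℚ :- y :=ℚ x :*ℚ y) refl (seq x n) (seq y n)) (Pos-* { -ℝ x} { -ℝ y} x<0 y<0)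

Zero-neg : ∀ {x} → Zero x → Zero (-ℝ x)
Zero-neg {x} x≈0 = Zero-resp {fromℚ (ℚ.- 1ℚ) *ℝ x} { -ℝ x}
  (λ n → solveℚ 1 (λ x → conℚ (ℚ.- 1ℚ) :*ℚ x :=ℚ :- x) refl (seq x n)) (Zero-*ˡ (fromℚ (ℚ.- 1ℚ)) {x} x≈0)

Zero-- : ∀ {x y} → Zero x → Zero y → Zero (x -ℝ y)
Zero-- {x} {y} x≈0 y≈0 = Zero-+ {x} { -ℝ y} x≈0 (Zero-neg {y} y≈0)

-- The signs of x and y are available only under a double negation, whence the form of the
-- conclusion.
no-zero-divisors : ∀ x y → Zero (x *ℝ y) → ¬ Zero y → ¬ ¬ Zero x
no-zero-divisors x y xy≈0 y≉0 x≉0 = trichotomy x λ sx → trichotomy y λ sy → signs sx sy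
  where
  signs : Tri x → Tri y → _
  signs (inj₂ (inj₁ x≈0)) _                 = x≉0 x≈0
  signs _                 (inj₂ (inj₁ y≈0)) = y≉0 y≈0
  signs (inj₁ x>0)        (inj₁ y>0)        = Pos⇒¬Zero {x *ℝ y} (Pos-* {x} {y} x>0 y>0) xy≈0
  signs (inj₁ x>0)        (inj₂ (inj₂ y<0)) = Pos⇒¬Zero { -ℝ (x *ℝ y)} (Pos-*-Neg {x} {y} x>0 y<0) (Zero-neg {x *ℝ y} xy≈0)
  signs (inj₂ (inj₂ x<0)) (inj₁ y>0)        = Pos⇒¬Zero { -ℝ (x *ℝ y)} (Neg-*-Pos {x} {y} x<0 y>0) (Zero-neg {x *ℝ y} xy≈0)
  signs (inj₂ (inj₂ x<0)) (inj₂ (inj₂ y<0)) = Pos⇒¬Zero {x *ℝ y} (Neg-*-Neg {x} {y} x<0 y<0) xy≈0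

pos? : ∀ {x} → Tri x → Dec (Pos x)
pos? (inj₁ x>0)            = yes x>0
pos? {x} (inj₂ (inj₁ x≈0)) = no λ x>0 → Pos⇒¬Zero {x} x>0 x≈0
pos? {x} (inj₂ (inj₂ x<0)) = no λ x>0 → Pos⇒¬Neg {x} x>0 x<0

zero? : ∀ {x} → Tri x → Dec (Zero x)
zero? {x} (inj₁ x>0)        = no (Pos⇒¬Zero {x} x>0)
zero?     (inj₂ (inj₁ x≈0)) = yes x≈0
zero? {x} (inj₂ (inj₂ x<0)) = no λ x≈0 → Pos⇒¬Zero { -ℝ x} x<0 (Zero-neg {x} x≈0)

module ≈ℝ = Setoid ≈ℝ-setoid

-- Double-negated choice over finite index types

DNChoice : Set → Set₁
DNChoice I = ∀ {P : I → Set} → (∀ i → ¬ ¬ P i) → ¬ ¬ (∀ i → P i)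

-- Double-negation shift, by induction on the size of the index type: finitely many undecidable
-- questions may be taken as answered all at once inside a refutation.
fin-choice : ∀ {n} → DNChoice (Fin n)
fin-choice {zero}  p ¬all = ¬all λ ()
fin-choice {suc n} p ¬all = p zero λ p₀ → fin-choice (p ∘ suc) λ ps → ¬all λ { zero → p₀ ; (suc i) → ps i }

×-choice : ∀ {I J} → DNChoice I → DNChoice J → DNChoice (I × J)
×-choice cI cJ p ¬all = cI (λ i → cJ λ j → p (i , j)) λ ps → ¬all (uncurry ps)

⊎-choice : ∀ {I J} → DNChoice I → DNChoice J → DNChoice (I ⊎ J)
⊎-choice cI cJ p ¬all = cI (p ∘ inj₁) λ ps → cJ (p ∘ inj₂) λ qs → ¬all λ { (inj₁ i) → ps i ; (inj₂ j) → qs j }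

-- Ranks

Neg⇒Pos-flip : ∀ {x y} → Neg (x -ℝ y) → Pos (y -ℝ x)
Neg⇒Pos-flip {x} {y} = Pos-resp { -ℝ (x -ℝ y)} {y -ℝ x}
  λ n → solveℚ 2 (λ x y → :- (x :- y) :=ℚ y :- x) refl (seq x n) (seq y n)

Zero-refl : ∀ x → Zero (x -ℝ x)
Zero-refl x = ≈⇒Zero {x} {x} (≈ℝ.refl {x})

Pos-irrefl : ∀ x → ¬ Pos (x -ℝ x)
Pos-irrefl x x>x = Pos⇒¬Zero {x -ℝ x} x>x (Zero-refl x)

module Rank {k} {_≻_ : Fin k → Fin k → Set} (_≻?_ : ∀ i j → Dec (i ≻ j))
            (≻-irrefl : ∀ i → ¬ i ≻ i) (≻-trans : ∀ {i j l} → i ≻ j → j ≻ l → i ≻ l)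
            (compare : ∀ i j → i ≻ j ⊎ i ≡ j ⊎ j ≻ i) where

  rank : Fin k → ℕ
  rank i = ∑[ j ∈ allFin k ] ⟦ i ≻? j ⟧

  private
    -- `rank i` omits i itself, so any f that dominates its indicators and is positive at i sums to
    -- at least one more. A constant f bounds the ranks by k; the indicators of being below a larger
    -- j give strict monotonicity.
    rank+1≤ : ∀ i (f : Fin k → ℕ) → (∀ j → ⟦ i ≻? j ⟧ ≤ f j) → 1 ≤ f i → rank i < sumOver (allFin k) f
    rank+1≤ i f le fi≥1 = begin
      1 + rank i
        ≤⟨ +-monoˡ-≤ (rank i) (fin-count≥1 (i Fin.≟_) refl) ⟩
      (∑[ j ∈ allFin k ] ⟦ i Fin.≟ j ⟧) + rank i
        ≡⟨ sum-+ (allFin k) _ _ ⟨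
      (∑[ j ∈ allFin k ] ⟦ i Fin.≟ j ⟧ + ⟦ i ≻? j ⟧)
        ≤⟨ sum-mono (allFin k) one-or-below ⟩
      sumOver (allFin k) f ∎
      where
      open ≤-Reasoning
      one-or-below : ∀ j → ⟦ i Fin.≟ j ⟧ + ⟦ i ≻? j ⟧ ≤ f j
      one-or-below j with i Fin.≟ j
      ... | no  _    = le j
      ... | yes refl = ≤-trans (≤-reflexive (cong suc (⟦⟧-false (i ≻? i) (≻-irrefl i)))) fi≥1

  rank<k : ∀ i → rank i < k
  rank<k i = ≤-trans (rank+1≤ i (λ _ → 1) (λ j → ⟦⟧≤1 (i ≻? j)) ≤-refl)
    (≤-trans (sum-≤-fin k 1 λ _ → ≤-refl) (≤-reflexive (*-identityʳ k)))

  rank-mono-< : ∀ {i j} → j ≻ i → rank i < rank j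
  rank-mono-< {i} {j} j≻i = rank+1≤ i (λ l → ⟦ j ≻? l ⟧)
    (λ l → ⟦⟧-mono (i ≻? l) (j ≻? l) (≻-trans j≻i)) (≤-reflexive (sym (⟦⟧-true (j ≻? i) j≻i)))

  rank-injective : ∀ {i j} → rank i ≡ rank j → i ≡ j
  rank-injective {i} {j} eq with compare i j
  ... | inj₁ i≻j        = contradiction (sym eq) (<⇒≢ (rank-mono-< i≻j))
  ... | inj₂ (inj₁ i≡j) = i≡j
  ... | inj₂ (inj₂ j≻i) = contradiction eq (<⇒≢ (rank-mono-< j≻i))

  rank-reflects-≤ : ∀ {i j} → rank i ≤ rank j → ¬ i ≻ j
  rank-reflects-≤ le i≻j = <⇒≱ (rank-mono-< i≻j) le

  rank-mono-≤ : ∀ {i j} → ¬ i ≻ j → rank i ≤ rank j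
  rank-mono-≤ {i} {j} i⊁j with compare i j
  ... | inj₁ i≻j        = contradiction i≻j i⊁j
  ... | inj₂ (inj₁ i≡j) = ≤-reflexive (cong rank i≡j)
  ... | inj₂ (inj₂ j≻i) = <⇒≤ (rank-mono-< j≻i)

-- On a line u y - v x = const, the sign of u v decides whether y increases with x.
slope-sign : ∀ {w dx dy u} → Pos w → ¬ Zero u → Zero (u *ℝ u *ℝ dy -ℝ w *ℝ dx) → ¬ Pos dx → ¬ Pos dy
slope-sign {w} {dx} {dy} {u} w>0 u≉0 eq dx≯0 dy>0 = trichotomy u λ su → trichotomy dx (signs (square-pos su))
  where
  square-pos : Tri u → Pos (u *ℝ u)
  square-pos (inj₁ u>0)        = Pos-* {u} {u} u>0 u>0
  square-pos (inj₂ (inj₁ u≈0)) = contradiction (λ {ε} → u≈0 {ε}) u≉0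
  square-pos (inj₂ (inj₂ u<0)) = Neg-*-Neg {u} {u} u<0 u<0
  wdx>0 : Pos (u *ℝ u) → Pos (w *ℝ dx)
  wdx>0 uu>0 = Pos-resp {u *ℝ u *ℝ dy -ℝ (u *ℝ u *ℝ dy -ℝ w *ℝ dx)} {w *ℝ dx}
    (λ n → solveℚ 2 (λ a b → a :- (a :- b) :=ℚ b) refl (seq (u *ℝ u *ℝ dy) n) (seq (w *ℝ dx) n))
    (Pos-+Zero {u *ℝ u *ℝ dy} { -ℝ (u *ℝ u *ℝ dy -ℝ w *ℝ dx)} (Pos-* {u *ℝ u} {dy} uu>0 dy>0)
      (Zero-neg {u *ℝ u *ℝ dy -ℝ w *ℝ dx} eq))
  signs : Pos (u *ℝ u) → ¬ Tri dx
  signs uu>0 (inj₁ dx>0)        = dx≯0 dx>0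
  signs uu>0 (inj₂ (inj₁ dx≈0)) = Pos⇒¬Zero {w *ℝ dx} (wdx>0 uu>0) (Zero-*ˡ w {dx} dx≈0)
  signs uu>0 (inj₂ (inj₂ dx<0)) = Pos⇒¬Neg {w *ℝ dx} (wdx>0 uu>0) (Pos-*-Neg {w} {dx} w>0 dx<0)

-- Multiplicative energy weighted by popular differences

sum-*² : ∀ {I J : Set} (xs : List I) (ys : List J) (f g : I → J → ℕ) →
  (∑[ (i , j) ∈ cartesianProduct xs xs ] ∑[ (k , l) ∈ cartesianProduct ys ys ] f i k * g j l)
  ≡ (∑[ i ∈ xs ] sumOver ys (f i)) * (∑[ j ∈ xs ] sumOver ys (g j))
sum-*² xs ys f g = trans
  (sum-cong (cartesianProduct xs xs) λ (i , j) → trans (sum-× ys ys _) (sym (sum*sum ys ys (f i) (g j))))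
  (trans (sum-× xs xs _) (sym (sum*sum xs xs _ _)))

-- The slopes v / u and v′ / u′ agree; π codes the products of pairs.
EqualSlope : ∀ {n m} → (Fin n × Fin n → Fin m) → Fin n × Fin n → Fin n × Fin n → Set
EqualSlope π (u , v) (u′ , v′) = π (u , v′) ≡ π (u′ , v)

-- Purely combinatorial: indices stand for the elements of A and of D, π codes products, and
-- `χ i c l` stands for a_i - a_c = d_l.
module Popular
  {n q m : ℕ} (π : Fin n × Fin n → Fin m)
  (∥-trans : ∀ {s s′ s″} → EqualSlope π s s′ → EqualSlope π s′ s″ → EqualSlope π s s″)
  (χ : Fin n → Fin n → Fin q → Set) (χ? : ∀ i c l → Dec (χ i c l))
  where

  _∥_ : Fin n × Fin n → Fin n × Fin n → Set
  _∥_ = EqualSlope π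

  _∥?_ : ∀ s s′ → Dec (s ∥ s′)
  (u , v) ∥? (u′ , v′) = π (u , v′) Fin.≟ π (u′ , v)

  module Slopes = Reps _∥?_ (λ _ → refl) sym (λ {s} {s′} {s″} → ∥-trans {s} {s′} {s″})

  slopes : List (Fin n × Fin n)
  slopes = Slopes.reps (points n)

  f : Fin n → ℕ
  f c = ∑[ i ∈ allFin n ] ∑[ l ∈ allFin q ] ⟦ χ? i c l ⟧

  F : ℕ
  F = ∑[ c ∈ allFin n ] f c

  f² : Fin n × Fin n → ℕ
  f² (c , e) = f c * f e

  w : Fin n × Fin n → ℕ
  w s = ∑[ σ ∈ points n ] ⟦ σ ∥? s ⟧ * f² σ

  -- For p = (i , j) in A² and r = (l , l′) in D², this counts the vectors σ of slope s with p - σ =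
  -- r. There is at most one, and only if p and r lie on a line of slope s; see `g≤`.
  g : Fin n × Fin n → Fin n × Fin n → Fin q × Fin q → ℕ
  g s (i , j) (l , l′) = ∑[ σ ∈ points n ] ⟦ σ ∥? s ⟧ * (⟦ χ? i (proj₁ σ) l ⟧ * ⟦ χ? j (proj₂ σ) l′ ⟧)

  sum-g : ∀ s → (∑[ p ∈ points n ] ∑[ r ∈ points q ] g s p r) ≡ w s
  sum-g s = begin
    (∑[ p ∈ points n ] ∑[ r ∈ points q ] g s p r)
      ≡⟨ trans (sum-cong (points n) λ p → sum-swap (points q) (points n) _) (sum-swap (points n) (points n) _) ⟩
    (∑[ σ ∈ points n ] ∑[ p ∈ points n ] ∑[ r ∈ points q ] ⟦ σ ∥? s ⟧ * h σ p r)
      ≡⟨ sum-cong (points n) (λ σ → trans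
           (sum-cong (points n) λ p → sym (sum-*ˡ (points q) ⟦ σ ∥? s ⟧ (h σ p)))
           (sym (sum-*ˡ (points n) ⟦ σ ∥? s ⟧ _))) ⟩
    (∑[ σ ∈ points n ] ⟦ σ ∥? s ⟧ * (∑[ p ∈ points n ] ∑[ r ∈ points q ] h σ p r))
      ≡⟨ sum-cong (points n) (λ (c , e) → cong (⟦ (c , e) ∥? s ⟧ *_)
           (sum-*² (allFin n) (allFin q) (λ i l → ⟦ χ? i c l ⟧) (λ j l → ⟦ χ? j e l ⟧))) ⟩
    w s ∎
    where
    open ≡-Reasoning
    h : Fin n × Fin n → Fin n × Fin n → Fin q × Fin q → ℕ
    h σ p r = ⟦ χ? (proj₁ p) (proj₁ σ) (proj₁ r) ⟧ * ⟦ χ? (proj₂ p) (proj₂ σ) (proj₂ r) ⟧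

  sum-f² : sumOver (points n) f² ≡ F * F
  sum-f² = trans (sum-× (allFin n) (allFin n) f²) (sym (sum*sum (allFin n) (allFin n) f f))

  sum-w≤ : sumOver slopes w ≤ F * F
  sum-w≤ = begin
    sumOver slopes w
      ≡⟨ sum-swap slopes (points n) _ ⟩
    (∑[ σ ∈ points n ] ∑[ s ∈ slopes ] ⟦ σ ∥? s ⟧ * f² σ)
      ≤⟨ sum-mono (points n) (λ σ → ≤-trans (≤-reflexive (sym (sum-*ʳ slopes (λ s → ⟦ σ ∥? s ⟧) (f² σ))))
           (≤-trans (*-monoˡ-≤ (f² σ) (Slopes.reps≤1 σ (points n))) (≤-reflexive (*-identityˡ (f² σ))))) ⟩
    sumOver (points n) f²
      ≡⟨ sum-f² ⟩
    F * F ∎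
    where open ≤-Reasoning

  length-slopes : length slopes ≤ n * n
  length-slopes = ≤-trans (Slopes.length-reps (points n)) (≤-reflexive (length-points n))

  private
    reindex : ∀ (h : Fin n × Fin n → Fin n × Fin n → ℕ) →
      (∑[ p ∈ points n ] ∑[ p′ ∈ points n ] h p p′)
      ≡ (∑[ (c , e′) ∈ points n ] ∑[ (e , c′) ∈ points n ] h (c , c′) (e , e′))
    reindex h = begin
      (∑[ p ∈ points n ] ∑[ p′ ∈ points n ] h p p′)
        ≡⟨ trans (sum-cong (points n) λ p → sum-× N N _) (sum-× N N _) ⟩
      (∑[ c ∈ N ] ∑[ c′ ∈ N ] ∑[ e ∈ N ] ∑[ e′ ∈ N ] h (c , c′) (e , e′))
        ≡⟨ sum-cong N (λ c → trans (sum-cong N λ c′ → sum-swap N N _) (trans (sum-swap N N _) (sum-cong N λ e′ → sum-swap N N _))) ⟩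
      (∑[ c ∈ N ] ∑[ e′ ∈ N ] ∑[ e ∈ N ] ∑[ c′ ∈ N ] h (c , c′) (e , e′))
        ≡⟨ trans (sum-cong (points n) λ (c , e′) → sum-× N N (λ (e , c′) → h (c , c′) (e , e′))) (sum-× N N _) ⟨
      (∑[ (c , e′) ∈ points n ] ∑[ (e , c′) ∈ points n ] h (c , c′) (e , e′)) ∎
      where
      open ≡-Reasoning
      N = allFin n

  -- The quadruples with c c′ = e e′ are regrouped as pairs of equal slopes e′ / c = c′ / e.
  F⁴≤ : F * F * (F * F) ≤ m * (∑[ s ∈ slopes ] w s * w s)
  F⁴≤ = begin
    F * F * (F * F)
      ≡⟨ cong₂ _*_ sum-f² sum-f² ⟨
    sumOver (points n) f² * sumOver (points n) f²
      ≤⟨ fibre-cauchy-schwarz (points n) π f² ⟩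
    m * (∑[ p ∈ points n ] ∑[ p′ ∈ points n ] f² p * f² p′ * ⟦ π p Fin.≟ π p′ ⟧)
      ≡⟨ cong (m *_) (reindex λ p p′ → f² p * f² p′ * ⟦ π p Fin.≟ π p′ ⟧) ⟩
    m * (∑[ (c , e′) ∈ points n ] ∑[ (e , c′) ∈ points n ] f c * f c′ * (f e * f e′) * ⟦ (c , e′) ∥? (e , c′) ⟧)
      ≤⟨ *-monoʳ-≤ m (sum-mono (points n) λ σ → sum-mono (points n) λ σ′ → common-slope σ σ′) ⟩
    m * (∑[ σ ∈ points n ] ∑[ σ′ ∈ points n ] ∑[ s ∈ slopes ] ⟦ σ ∥? s ⟧ * f² σ * (⟦ σ′ ∥? s ⟧ * f² σ′))
      ≡⟨ cong (m *_) (trans (sum-cong slopes λ s → sum*sum (points n) (points n) _ _)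
           (trans (sum-swap slopes (points n) _) (sum-cong (points n) λ σ → sum-swap slopes (points n) _))) ⟨
    m * (∑[ s ∈ slopes ] w s * w s) ∎
    where
    open ≤-Reasoning
    common-slope : ∀ σ σ′ → f (proj₁ σ) * f (proj₂ σ′) * (f (proj₁ σ′) * f (proj₂ σ)) * ⟦ σ ∥? σ′ ⟧
                          ≤ (∑[ s ∈ slopes ] ⟦ σ ∥? s ⟧ * f² σ * (⟦ σ′ ∥? s ⟧ * f² σ′))
    common-slope σ@(c , e′) σ′@(e , c′) = begin
      f c * f c′ * (f e * f e′) * ⟦ σ ∥? σ′ ⟧
        ≤⟨ *-monoʳ-≤ (f c * f c′ * (f e * f e′)) (⟦⟧≤ (σ ∥? σ′) λ σ∥σ′ →
             Slopes.class-sum {σ} {points n} (λ s → ⟦ σ ∥? s ⟧ * ⟦ σ′ ∥? s ⟧) (∈-points σ) λ {s} σ∥s →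
               ≤-reflexive (sym (cong₂ _*_ (⟦⟧-true (σ ∥? s) σ∥s)
                 (⟦⟧-true (σ′ ∥? s) (∥-trans {σ′} {σ} {s} (sym σ∥σ′) σ∥s))))) ⟩
      f c * f c′ * (f e * f e′) * (∑[ s ∈ slopes ] ⟦ σ ∥? s ⟧ * ⟦ σ′ ∥? s ⟧)
        ≡⟨ sum-*ˡ slopes (f c * f c′ * (f e * f e′)) _ ⟩
      (∑[ s ∈ slopes ] f c * f c′ * (f e * f e′) * (⟦ σ ∥? s ⟧ * ⟦ σ′ ∥? s ⟧))
        ≡⟨ sum-cong slopes (λ s → rearrange (f c) (f c′) (f e) (f e′) ⟦ σ ∥? s ⟧ ⟦ σ′ ∥? s ⟧) ⟩
      (∑[ s ∈ slopes ] ⟦ σ ∥? s ⟧ * f² σ * (⟦ σ′ ∥? s ⟧ * f² σ′)) ∎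
      where
      rearrange : ∀ a b c d x y → a * b * (c * d) * (x * y) ≡ x * (a * d) * (y * (c * b))
      rearrange = solve-* 6 (λ a b c d x y → a · b · (c · d) · (x · y) ⊜ x · (a · d) · (y · (c · b))) refl

  module _ {t} (popular : ∀ l → t ≤ (∑[ (i , c) ∈ points n ] ⟦ χ? i c l ⟧)) where

    F≡ : F ≡ (∑[ l ∈ allFin q ] ∑[ (i , c) ∈ points n ] ⟦ χ? i c l ⟧)
    F≡ = begin
      (∑[ c ∈ allFin n ] ∑[ i ∈ allFin n ] ∑[ l ∈ allFin q ] ⟦ χ? i c l ⟧)
        ≡⟨ sum-swap (allFin n) (allFin n) _ ⟩
      (∑[ i ∈ allFin n ] ∑[ c ∈ allFin n ] ∑[ l ∈ allFin q ] ⟦ χ? i c l ⟧)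
        ≡⟨ sum-× (allFin n) (allFin n) (λ (i , c) → ∑[ l ∈ allFin q ] ⟦ χ? i c l ⟧) ⟨
      (∑[ (i , c) ∈ points n ] ∑[ l ∈ allFin q ] ⟦ χ? i c l ⟧)
        ≡⟨ sum-swap (points n) (allFin q) _ ⟩
      (∑[ l ∈ allFin q ] ∑[ (i , c) ∈ points n ] ⟦ χ? i c l ⟧) ∎
      where open ≡-Reasoning

    qt≤F : q * t ≤ F
    qt≤F = begin
      q * t                                                        ≡⟨ cong (_* t) (length-allFin q) ⟨
      length (allFin q) * t                                        ≡⟨ sum-const (allFin q) t ⟨
      (∑[ l ∈ allFin q ] t)                                        ≤⟨ sum-mono (allFin q) popular ⟩
      (∑[ l ∈ allFin q ] ∑[ (i , c) ∈ points n ] ⟦ χ? i c l ⟧)     ≡⟨ F≡ ⟨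
      F                                                            ∎
      where open ≤-Reasoning

-- Elimination of F and Q

fourth : ℕ → ℕ
fourth x = x * x * (x * x)

-- Written in the shape `cube (b * b) * b⁴` in which `Pairs.energy-bound` produces it.
tenth : ℕ → ℕ
tenth x = cube (x * x) * fourth x

opaque
  -- Covers both outcomes: `conclude₁` squares its estimate, which turns `c₁` into `c₁ * c₁`.
  c₃ : ℕ
  c₃ = c₁ * c₁ + c₂

  c₁²≤c₃ : c₁ * c₁ ≤ c₃
  c₁²≤c₃ = m≤m+n (c₁ * c₁) c₂

  c₂≤c₃ : c₂ ≤ c₃
  c₂≤c₃ = m≤n+m c₂ (c₁ * c₁)

module _ {n q m t M F Q : ℕ} (qt≤F : q * t ≤ F) (F⁴≤mQ : fourth F ≤ m * Q) where

  private
    Y : ℕ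
    Y = q * cube t
    open ≤-Reasoning

  -- From F⁸ ≤ m² Q² and W ≤ F² a factor F² cancels, leaving F⁶ ≲ m² n⁴ q⁴ and so q² t⁶ ≲ m² n⁴.
  -- Squared, the right side is m⁴ n⁸, and one factor m ≤ n² gives m³ n^10: solitary points do
  -- better than required.
  conclude₁ : ∀ {W} → W ≤ F * F → m ≤ n * n → 1 ≤ M → Q * Q ≤ c₁ * (M * (W * (fourth n * fourth q))) →
              fourth Y ≤ c₃ * (cube M * (cube m * tenth n))
  conclude₁ {W} W≤ m≤n² 1≤M Q²≤ = begin
    fourth Y
      ≤⟨ *-mono-≤ Y²≤ Y²≤ ⟩
    c₁ * (M * (m * m * fourth n)) * (c₁ * (M * (m * m * fourth n)))
      ≡⟨ expand c₁ M m n ⟩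
    c₁ * c₁ * (M * M * (m * (m * m * m) * (fourth n * fourth n)))
      ≤⟨ *-mono-≤ c₁²≤c₃ (*-mono-≤ M²≤M³ (*-monoˡ-≤ (fourth n * fourth n) (*-monoˡ-≤ (m * m * m) m≤n²))) ⟩
    c₃ * (cube M * (n * n * (m * m * m) * (fourth n * fourth n)))
      ≡⟨ cong (λ z → c₃ * (cube M * z)) (collect n m) ⟩
    c₃ * (cube M * (cube m * tenth n)) ∎
    where
    S = F * F
    expand : ∀ c M m n → c * (M * (m * m * fourth n)) * (c * (M * (m * m * fourth n)))
           ≡ c * c * (M * M * (m * (m * m * m) * (fourth n * fourth n)))
    expand = solve-* 4 (λ c M m n → let n⁴ = n · n · (n · n) in
      c · (M · (m · m · n⁴)) · (c · (M · (m · m · n⁴))) ⊜ c · c · (M · M · (m · (m · m · m) · (n⁴ · n⁴)))) refl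
    collect : ∀ n m → n * n * (m * m * m) * (fourth n * fourth n) ≡ cube m * tenth n
    collect = solve-* 2 (λ n m → let n⁴ = n · n · (n · n) ; n² = n · n in
      n · n · (m · m · m) · (n⁴ · n⁴) ⊜ m · (m · m) · (n² · (n² · n²) · n⁴)) refl
    M²≤M³ : M * M ≤ cube M
    M²≤M³ = ≤-trans (≤-reflexive (sym (*-identityˡ (M * M)))) (*-monoˡ-≤ (M * M) 1≤M)
    S³≤ : cube S ≤ m * m * (c₁ * (M * (fourth n * fourth q)))
    S³≤ = cancel-factor S (begin
      S * cube S
        ≡⟨ solve-* 1 (λ s → s · (s · (s · s)) ⊜ s · s · (s · s)) refl S ⟩
      S * S * (S * S)
        ≤⟨ *-mono-≤ F⁴≤mQ F⁴≤mQ ⟩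
      m * Q * (m * Q)
        ≡⟨ solve-* 2 (λ m q → m · q · (m · q) ⊜ m · m · (q · q)) refl m Q ⟩
      m * m * (Q * Q)
        ≤⟨ *-monoʳ-≤ (m * m) (≤-trans Q²≤ (*-monoʳ-≤ c₁ (*-monoʳ-≤ M (*-monoˡ-≤ (fourth n * fourth q) W≤)))) ⟩
      m * m * (c₁ * (M * (S * (fourth n * fourth q))))
        ≡⟨ pull (m * m) c₁ M S (fourth n * fourth q) ⟩
      S * (m * m * (c₁ * (M * (fourth n * fourth q)))) ∎) (λ S≡0 → cong cube S≡0)
      where
      pull : ∀ a c M S x → a * (c * (M * (S * x))) ≡ S * (a * (c * (M * x)))
      pull = solve-* 5 (λ a c M S x → a · (c · (M · (S · x))) ⊜ S · (a · (c · (M · x)))) refl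
    Y²≤ : Y * Y ≤ c₁ * (M * (m * m * fourth n))
    Y²≤ = cancel-factor (fourth q) (begin
      fourth q * (Y * Y)
        ≡⟨ solve-* 2 (λ q t → q · q · (q · q) · (q · (t · (t · t)) · (q · (t · (t · t))))
             ⊜ (q · t) · (q · t) · ((q · t) · (q · t) · ((q · t) · (q · t)))) refl q t ⟩
      cube (q * t * (q * t))
        ≤⟨ cube-mono (*-mono-≤ qt≤F qt≤F) ⟩
      cube S
        ≤⟨ S³≤ ⟩
      m * m * (c₁ * (M * (fourth n * fourth q)))
        ≡⟨ pull (m * m) c₁ M (fourth n) (fourth q) ⟩
      fourth q * (c₁ * (M * (m * m * fourth n))) ∎) vanish
      where
      pull : ∀ a c M x y → a * (c * (M * (x * y))) ≡ y * (c * (M * (a * x)))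
      pull = solve-* 5 (λ a c M x y → a · (c · (M · (x · y))) ⊜ y · (c · (M · (a · x)))) refl
      vanish : fourth q ≡ 0 → Y * Y ≡ 0
      vanish eq = cong (λ q → q * cube t * (q * cube t)) (fourth≡0 q eq)
        where
        fourth≡0 : ∀ q → fourth q ≡ 0 → q ≡ 0
        fourth≡0 zero _ = refl

  conclude₂ : ∀ {z} → z ≤ tenth n * (fourth q * fourth q) → cube Q ≤ c₂ * (cube M * z) →
              fourth Y ≤ c₃ * (cube M * (cube m * tenth n))
  conclude₂ {z} z≤ Q³≤ = cancel-factor (fourth q * fourth q) (begin
    fourth q * fourth q * fourth Y
      ≡⟨ solve-* 2 (λ q t → let q⁴ = q · q · (q · q) ; y = q · (t · (t · t)) ; f = q · t · (q · t) · (q · t · (q · t)) in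
           q⁴ · q⁴ · (y · y · (y · y)) ⊜ f · (f · f)) refl q t ⟩
    cube (fourth (q * t))
      ≤⟨ cube-mono (≤-trans (*-mono-≤ (*-mono-≤ qt≤F qt≤F) (*-mono-≤ qt≤F qt≤F)) F⁴≤mQ) ⟩
    cube (m * Q)
      ≡⟨ cube-* m Q ⟩
    cube m * cube Q
      ≤⟨ *-monoʳ-≤ (cube m) (≤-trans Q³≤ (*-mono-≤ c₂≤c₃ (*-monoʳ-≤ (cube M) z≤))) ⟩
    cube m * (c₃ * (cube M * (tenth n * (fourth q * fourth q))))
      ≡⟨ pull (cube m) c₃ (cube M) (tenth n) (fourth q * fourth q) ⟩
    fourth q * fourth q * (c₃ * (cube M * (cube m * tenth n))) ∎) (vanish q)
    where
    pull : ∀ a c M x y → a * (c * (M * (x * y))) ≡ y * (c * (M * (a * x)))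
    pull = solve-* 5 (λ a c M x y → a · (c · (M · (x · y))) ⊜ y · (c · (M · (a · x)))) refl
    vanish : ∀ q → fourth q * fourth q ≡ 0 → fourth (q * cube t) ≡ 0
    vanish zero _ = refl

-- Lines in the real plane

form : ℝ → ℝ → ℝ → ℝ → ℝ
form u v x y = u *ℝ y -ℝ v *ℝ x

module _ (u v x y x′ y′ : ℝ) where

  Collinear : Set
  Collinear = Zero (form u v x y -ℝ form u v x′ y′)

  -- Multiplication by u replaces division: u² is positive for nonzero u, so the sign of u v is that
  -- of the slope.
  line-slope : Collinear → Zero (u *ℝ u *ℝ (y -ℝ y′) -ℝ u *ℝ v *ℝ (x -ℝ x′))
  line-slope col = Zero-resp {u *ℝ (form u v x y -ℝ form u v x′ y′)} {u *ℝ u *ℝ (y -ℝ y′) -ℝ u *ℝ v *ℝ (x -ℝ x′)}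
    (λ n → solveℚ 6 (λ u v x y x′ y′ →
        u :*ℚ ((u :*ℚ y :- v :*ℚ x) :- (u :*ℚ y′ :- v :*ℚ x′)) :=ℚ u :*ℚ u :*ℚ (y :- y′) :- u :*ℚ v :*ℚ (x :- x′)) refl
        (seq u n) (seq v n) (seq x n) (seq y n) (seq x′ n) (seq y′ n))
    (Zero-*ˡ u {form u v x y -ℝ form u v x′ y′} col)

  line-slope-neg : Collinear → Zero (u *ℝ u *ℝ (y′ -ℝ y) -ℝ (-ℝ (u *ℝ v)) *ℝ (x -ℝ x′))
  line-slope-neg col = Zero-resp { -ℝ (u *ℝ u *ℝ (y -ℝ y′) -ℝ u *ℝ v *ℝ (x -ℝ x′))} {u *ℝ u *ℝ (y′ -ℝ y) -ℝ (-ℝ (u *ℝ v)) *ℝ (x -ℝ x′)}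
    (λ n → solveℚ 6 (λ u v x y x′ y′ →
        :- (u :*ℚ u :*ℚ (y :- y′) :- u :*ℚ v :*ℚ (x :- x′)) :=ℚ u :*ℚ u :*ℚ (y′ :- y) :- (:- (u :*ℚ v)) :*ℚ (x :- x′)) refl
        (seq u n) (seq v n) (seq x n) (seq y n) (seq x′ n) (seq y′ n))
    (Zero-neg {u *ℝ u *ℝ (y -ℝ y′) -ℝ u *ℝ v *ℝ (x -ℝ x′)} (line-slope col))

-- Eliminating y - y′ from the two equations leaves (u v′ - u′ v) (x - x′) = 0.
two-lines : ∀ u v u′ v′ x y x′ y′ → Collinear u v x y x′ y′ → Collinear u′ v′ x y x′ y′ →
            ¬ Zero (x -ℝ x′) → ¬ ¬ Zero (u *ℝ v′ -ℝ u′ *ℝ v)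
two-lines u v u′ v′ x y x′ y′ col col′ x≉x′ = no-zero-divisors (u *ℝ v′ -ℝ u′ *ℝ v) (x -ℝ x′)
  (Zero-resp {u′ *ℝ L -ℝ u *ℝ L′} {(u *ℝ v′ -ℝ u′ *ℝ v) *ℝ (x -ℝ x′)}
    (λ n → identity (seq u n) (seq v n) (seq u′ n) (seq v′ n) (seq x n) (seq y n) (seq x′ n) (seq y′ n))
    (Zero-- {u′ *ℝ L} {u *ℝ L′} (Zero-*ˡ u′ {L} col) (Zero-*ˡ u {L′} col′)))
  x≉x′
  where
  L L′ : ℝ
  L  = form u v x y -ℝ form u v x′ y′
  L′ = form u′ v′ x y -ℝ form u′ v′ x′ y′
  identity : ∀ u v u′ v′ x y x′ y′ →
    u′ ℚ.* (u ℚ.* y ℚ.- v ℚ.* x ℚ.- (u ℚ.* y′ ℚ.- v ℚ.* x′)) ℚ.- u ℚ.* (u′ ℚ.* y ℚ.- v′ ℚ.* x ℚ.- (u′ ℚ.* y′ ℚ.- v′ ℚ.* x′))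
    ≡ (u ℚ.* v′ ℚ.- u′ ℚ.* v) ℚ.* (x ℚ.- x′)
  identity = solveℚ 8 (λ u v u′ v′ x y x′ y′ →
    u′ :*ℚ (u :*ℚ y :- v :*ℚ x :- (u :*ℚ y′ :- v :*ℚ x′)) :- u :*ℚ (u′ :*ℚ y :- v′ :*ℚ x :- (u′ :*ℚ y′ :- v′ :*ℚ x′))
    :=ℚ (u :*ℚ v′ :- u′ :*ℚ v) :*ℚ (x :- x′)) refl

-- A combination of the two relations gives u′ (u v″ - u″ v) = 0. Cancelling u′ is one of the places
-- where 0 ∉ A is used.
proportional-trans : ∀ u v u′ v′ u″ v″ → Zero (u *ℝ v′ -ℝ u′ *ℝ v) → Zero (u′ *ℝ v″ -ℝ u″ *ℝ v′) →
                     ¬ Zero u′ → ¬ ¬ Zero (u *ℝ v″ -ℝ u″ *ℝ v)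
proportional-trans u v u′ v′ u″ v″ p p′ u′≉0 = no-zero-divisors (u *ℝ v″ -ℝ u″ *ℝ v) u′
  (Zero-resp {u *ℝ (u′ *ℝ v″ -ℝ u″ *ℝ v′) +ℝ u″ *ℝ (u *ℝ v′ -ℝ u′ *ℝ v)} {(u *ℝ v″ -ℝ u″ *ℝ v) *ℝ u′}
    (λ n → solveℚ 6 (λ u v u′ v′ u″ v″ →
        u :*ℚ (u′ :*ℚ v″ :- u″ :*ℚ v′) :+ℚ u″ :*ℚ (u :*ℚ v′ :- u′ :*ℚ v) :=ℚ (u :*ℚ v″ :- u″ :*ℚ v) :*ℚ u′) refl
        (seq u n) (seq v n) (seq u′ n) (seq v′ n) (seq u″ n) (seq v″ n))
    (Zero-+ {u *ℝ (u′ *ℝ v″ -ℝ u″ *ℝ v′)} {u″ *ℝ (u *ℝ v′ -ℝ u′ *ℝ v)}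
      (Zero-*ˡ u {u′ *ℝ v″ -ℝ u″ *ℝ v′} p′) (Zero-*ˡ u″ {u *ℝ v′ -ℝ u′ *ℝ v} p)))
  u′≉0

-- (x, y) - (x′, y′) = (c, e) is a vector of slope v / u.
translate-line : ∀ u v c e x y x′ y′ → Zero (c *ℝ v -ℝ u *ℝ e) → Zero (x -ℝ c -ℝ x′) → Zero (y -ℝ e -ℝ y′) →
                 Collinear u v x y x′ y′
translate-line u v c e x y x′ y′ p hx hy =
  Zero-resp {u *ℝ (y -ℝ e -ℝ y′) -ℝ v *ℝ (x -ℝ c -ℝ x′) -ℝ (c *ℝ v -ℝ u *ℝ e)} {form u v x y -ℝ form u v x′ y′}
    (λ n → identity (seq u n) (seq v n) (seq c n) (seq e n) (seq x n) (seq y n) (seq x′ n) (seq y′ n))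
    (Zero-- {u *ℝ (y -ℝ e -ℝ y′) -ℝ v *ℝ (x -ℝ c -ℝ x′)} {c *ℝ v -ℝ u *ℝ e}
      (Zero-- {u *ℝ (y -ℝ e -ℝ y′)} {v *ℝ (x -ℝ c -ℝ x′)} (Zero-*ˡ u {y -ℝ e -ℝ y′} hy) (Zero-*ˡ v {x -ℝ c -ℝ x′} hx)) p)
  where
  identity : ∀ u v c e x y x′ y′ →
    u ℚ.* (y ℚ.- e ℚ.- y′) ℚ.- v ℚ.* (x ℚ.- c ℚ.- x′) ℚ.- (c ℚ.* v ℚ.- u ℚ.* e)
    ≡ u ℚ.* y ℚ.- v ℚ.* x ℚ.- (u ℚ.* y′ ℚ.- v ℚ.* x′)
  identity = solveℚ 8 (λ u v c e x y x′ y′ →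
    u :*ℚ (y :- e :- y′) :- v :*ℚ (x :- c :- x′) :- (c :*ℚ v :- u :*ℚ e)
    :=ℚ u :*ℚ y :- v :*ℚ x :- (u :*ℚ y′ :- v :*ℚ x′)) refl

Nonzero : ℝ → Set
Nonzero x = Pos x ⊎ Neg x

nonzero-sign : ∀ {x} → ¬ Zero x → Tri x → Nonzero x
nonzero-sign x≉0 (inj₁ x>0)        = inj₁ x>0
nonzero-sign x≉0 (inj₂ (inj₁ x≈0)) = contradiction (λ {ε} → x≈0 {ε}) x≉0
nonzero-sign x≉0 (inj₂ (inj₂ x<0)) = inj₂ x<0

nonzero-* : ∀ {x y} → Nonzero x → Nonzero y → Nonzero (x *ℝ y)
nonzero-* {x} {y} (inj₁ x>0) (inj₁ y>0) = inj₁ (Pos-* {x} {y} x>0 y>0)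
nonzero-* {x} {y} (inj₁ x>0) (inj₂ y<0) = inj₂ (Pos-*-Neg {x} {y} x>0 y<0)
nonzero-* {x} {y} (inj₂ x<0) (inj₁ y>0) = inj₂ (Neg-*-Pos {x} {y} x<0 y>0)
nonzero-* {x} {y} (inj₂ x<0) (inj₂ y<0) = inj₁ (Neg-*-Neg {x} {y} x<0 y<0)

-- The lines determined by A and a set D of differences

module Decided
  {n q m : ℕ} (a : Fin n → ℝ) (d : Fin q → ℝ)
  (a-injective : ∀ {i j} → a i ≈ℝ a j → i ≡ j) (d-injective : ∀ {i j} → d i ≈ℝ d j → i ≡ j)
  (a≉0 : ∀ i → ¬ Zero (a i))
  (π : Fin n × Fin n → Fin m)
  (π⇒≈ : ∀ {i j k l} → π (i , j) ≡ π (k , l) → a i *ℝ a j ≈ℝ a k *ℝ a l)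
  (≈⇒π : ∀ {i j k l} → a i *ℝ a j ≈ℝ a k *ℝ a l → π (i , j) ≡ π (k , l))
  (χ : Fin n → Fin n → Fin q → Set) (χ? : ∀ i c l → Dec (χ i c l)) (χ⇒≈ : ∀ {i c l} → χ i c l → a i -ℝ a c ≈ℝ d l)
  where

  -- Both grids must lie in one plane for their lines to be compared, and coordinates must range
  -- over a finite type so that `coord-choice` applies to all comparisons at once.
  Coord : Set
  Coord = Fin n ⊎ Fin q

  z : Coord → ℝ
  z (inj₁ i) = a i
  z (inj₂ l) = d l

  record Line (s : Fin n × Fin n) (p p′ : Coord × Coord) : Set where
    constructor on-line
    field same-form : form (a (proj₁ s)) (a (proj₂ s)) (z (proj₁ p)) (z (proj₂ p))
                   ≈ℝ form (a (proj₁ s)) (a (proj₂ s)) (z (proj₁ p′)) (z (proj₂ p′))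

  value : Fin n × Fin n → Coord × Coord → ℝ
  value s p = form (a (proj₁ s)) (a (proj₂ s)) (z (proj₁ p)) (z (proj₂ p))

  -- The signs assumed to be decided: of the elements, for the direction in which lines are
  -- monotone; of differences of coordinates, for the ranks; of differences of forms, for `line?`.
  module Comparisons
    (sign-a : ∀ i → Tri (a i))
    (compare : ∀ (x : Coord × Coord) → Tri (z (proj₁ x) -ℝ z (proj₂ x)))
    (compare-forms : ∀ (x : (Fin n × Fin n) × (Coord × Coord) × (Coord × Coord)) →
       Tri (value (proj₁ x) (proj₁ (proj₂ x)) -ℝ value (proj₁ x) (proj₂ (proj₂ x))))
    where

    -- Parallelism compares the finite codes of products, so it is decidable and absorbs the double
    -- negations of the real arithmetic.
    ∥-stable : ∀ {s s′} → ¬ ¬ EqualSlope π s s′ → EqualSlope π s s′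
    ∥-stable = decidable-stable (_ Fin.≟ _)

    ∥⇒Zero : ∀ {u v u′ v′} → EqualSlope π (u , v) (u′ , v′) → Zero (a u *ℝ a v′ -ℝ a u′ *ℝ a v)
    ∥⇒Zero {u} {v} {u′} {v′} eq = ≈⇒Zero {a u *ℝ a v′} {a u′ *ℝ a v} (π⇒≈ eq)

    Zero⇒∥ : ∀ {u v u′ v′} → Zero (a u *ℝ a v′ -ℝ a u′ *ℝ a v) → EqualSlope π (u , v) (u′ , v′)
    Zero⇒∥ {u} {v} {u′} {v′} eq = ≈⇒π (Zero⇒≈ {a u *ℝ a v′} {a u′ *ℝ a v} eq)

    ∥-trans : ∀ {s s′ s″} → EqualSlope π s s′ → EqualSlope π s′ s″ → EqualSlope π s s″
    ∥-trans {u , v} {u′ , v′} {u″ , v″} p p′ = ∥-stable {u , v} {u″ , v″} λ ¬p″ →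
      proportional-trans (a u) (a v) (a u′) (a v′) (a u″) (a v″)
        (∥⇒Zero {u} {v} {u′} {v′} p) (∥⇒Zero {u′} {v′} {u″} {v″} p′) (a≉0 u′)
        λ eq → ¬p″ (Zero⇒∥ {u} {v} {u″} {v″} eq)

    line? : ∀ s p p′ → Dec (Line s p p′)
    line? s p p′ = map′ to from (zero? {value s p -ℝ value s p′} (compare-forms (s , p , p′)))
      where
      to : Zero (value s p -ℝ value s p′) → Line s p p′
      to eq = on-line (Zero⇒≈ {value s p} {value s p′} eq)
      from : Line s p p′ → Zero (value s p -ℝ value s p′)
      from (on-line eq) = ≈⇒Zero {value s p} {value s p′} eq

    𝓛 : LineStructure
    𝓛 = record
      { Coord      = Coord
      ; Dir        = Fin n × Fin n
      ; Line       = Line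
      ; line?      = line?
      ; line-refl  = λ s p → on-line (≈ℝ.refl {value s p})
      ; line-sym   = λ s {p} {p′} l → on-line (≈ℝ.sym {value s p} {value s p′} (Line.same-form l))
      ; line-trans = λ s {p} {p′} {p″} l l′ →
          on-line (≈ℝ.trans {value s p} {value s p′} {value s p″} (Line.same-form l) (Line.same-form l′))
      ; _∥_        = EqualSlope π
      }

    open Grids 𝓛

    collinear : ∀ {u v x y x′ y′} → Line (u , v) (x , y) (x′ , y′) → Collinear (a u) (a v) (z x) (z y) (z x′) (z y′)
    collinear {u} {v} {x} {y} {x′} {y′} l = ≈⇒Zero {value (u , v) (x , y)} {value (u , v) (x′ , y′)} (Line.same-form l)

    module _ {k} (X : Fin k → Coord) (X-injective : ∀ {i j} → z (X i) ≈ℝ z (X j) → i ≡ j) where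

      record _≻_ (i j : Fin k) : Set where
        constructor above
        field difference>0 : Pos (z (X i) -ℝ z (X j))

      private
        ≻-trans : ∀ {i j l} → i ≻ j → j ≻ l → i ≻ l
        ≻-trans {i} {j} {l} (above p) (above q) = above (Pos-resp
          {(z (X i) -ℝ z (X j)) +ℝ (z (X j) -ℝ z (X l))} {z (X i) -ℝ z (X l)}
          (λ n → solveℚ 3 (λ i j l → (i :- j) :+ℚ (j :- l) :=ℚ i :- l) refl (seq (z (X i)) n) (seq (z (X j)) n) (seq (z (X l)) n))
          (Pos-+ {z (X i) -ℝ z (X j)} {z (X j) -ℝ z (X l)} p q))

        order : ∀ i j → Tri (z (X i) -ℝ z (X j)) → i ≻ j ⊎ i ≡ j ⊎ j ≻ i
        order i j (inj₁ p)        = inj₁ (above p)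
        order i j (inj₂ (inj₁ p)) = inj₂ (inj₁ (X-injective (Zero⇒≈ {z (X i)} {z (X j)} p)))
        order i j (inj₂ (inj₂ p)) = inj₂ (inj₂ (above (Neg⇒Pos-flip {z (X i)} {z (X j)} p)))

        open module R = Rank {k} {_≻_}
          (λ i j → map′ above _≻_.difference>0 (pos? {z (X i) -ℝ z (X j)} (compare (X i , X j))))
          (λ i i≻i → Pos-irrefl (z (X i)) (_≻_.difference>0 i≻i))
          ≻-trans (λ i j → order i j (compare (X i , X j)))

      X-grid : IsGrid X
      X-grid = record
        { rank           = rank
        ; rank<n         = rank<k
        ; rank-injective = rank-injective
        ; monotone       = λ (u , v) → direction u v (nonzero-* {a u} {a v}
            (nonzero-sign {a u} (a≉0 u) (sign-a u)) (nonzero-sign {a v} (a≉0 v) (sign-a v)))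
        ; two-points     = λ {s} {s′} {i} {j} {i′} {j′} i≢i′ l l′ → ∥-stable {s} {s′} λ ¬∥ →
            two-lines (a (proj₁ s)) (a (proj₂ s)) (a (proj₁ s′)) (a (proj₂ s′)) (z (X i)) (z (X j)) (z (X i′)) (z (X j′))
              (collinear l) (collinear l′)
              (λ eq → i≢i′ (X-injective (Zero⇒≈ {z (X i)} {z (X i′)} eq)))
              (λ eq → ¬∥ (Zero⇒∥ {proj₁ s} {proj₂ s} {proj₁ s′} {proj₂ s′} eq))
        }
        where
        direction : ∀ u v → Nonzero (a u *ℝ a v) →
          (∀ {i j i′ j′} → Line (u , v) (X i , X j) (X i′ , X j′) → rank i ≤ rank i′ → rank j ≤ rank j′) ⊎
          (∀ {i j i′ j′} → Line (u , v) (X i , X j) (X i′ , X j′) → rank i ≤ rank i′ → rank j′ ≤ rank j)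
        direction u v (inj₁ uv>0) = inj₁ λ {i} {j} {i′} {j′} l le → rank-mono-≤ λ (above y>y′) →
          slope-sign {a u *ℝ a v} {z (X i) -ℝ z (X i′)} {z (X j) -ℝ z (X j′)} {a u} uv>0 (a≉0 u)
            (line-slope (a u) (a v) (z (X i)) (z (X j)) (z (X i′)) (z (X j′)) (collinear l))
            (λ x>x′ → rank-reflects-≤ le (above x>x′)) y>y′
        direction u v (inj₂ uv<0) = inj₂ λ {i} {j} {i′} {j′} l le → rank-mono-≤ λ (above y′>y) →
          slope-sign { -ℝ (a u *ℝ a v)} {z (X i) -ℝ z (X i′)} {z (X j′) -ℝ z (X j)} {a u} uv<0 (a≉0 u)
            (line-slope-neg (a u) (a v) (z (X i)) (z (X j)) (z (X i′)) (z (X j′)) (collinear l))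
            (λ x>x′ → rank-reflects-≤ le (above x>x′)) y′>y

    χ-injective : ∀ {i c c′ l} → χ i c l → χ i c′ l → c ≡ c′
    χ-injective {i} {c} {c′} {l} h h′ = a-injective (Zero⇒≈ {a c} {a c′}
      (Zero-resp {(a i -ℝ a c′) -ℝ (a i -ℝ a c)} {a c -ℝ a c′}
        (λ n → solveℚ 3 (λ i c c′ → (i :- c′) :- (i :- c) :=ℚ c :- c′) refl (seq (a i) n) (seq (a c) n) (seq (a c′) n))
        (≈⇒Zero {a i -ℝ a c′} {a i -ℝ a c}
          (≈ℝ.trans {a i -ℝ a c′} {d l} {a i -ℝ a c} (χ⇒≈ h′) (≈ℝ.sym {a i -ℝ a c} {d l} (χ⇒≈ h))))))

    χ-line : ∀ {i j c e l l′} s → EqualSlope π (c , e) s → χ i c l → χ j e l′ →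
             Line s (inj₁ i , inj₁ j) (inj₂ l , inj₂ l′)
    χ-line {i} {j} {c} {e} {l} {l′} (u , v) ∥s h h′ = on-line (Zero⇒≈ {value (u , v) (inj₁ i , inj₁ j)} {value (u , v) (inj₂ l , inj₂ l′)}
      (translate-line (a u) (a v) (a c) (a e) (a i) (a j) (d l) (d l′)
        (∥⇒Zero {c} {e} {u} {v} ∥s)
        (≈⇒Zero {a i -ℝ a c} {d l} (χ⇒≈ h)) (≈⇒Zero {a j -ℝ a e} {d l′} (χ⇒≈ h′))))

    open Popular π (λ {s} {s′} {s″} → ∥-trans {s} {s′} {s″}) χ χ?

    -- Off the line no σ contributes. On it, i and l determine c, and j and l′ determine e, so at
    -- most one does. The abstract L admits either order of the two points, as the roles of the
    -- grids vary.
    g≤ : ∀ s p r {L : Set} (L? : Dec L) → (Line s (at inj₁ p) (at inj₂ r) → L) → g s p r ≤ ⟦ L? ⟧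
    g≤ s (i , j) (l , l′) (no ¬l)  line⇒ = ≤-reflexive (sum-zero (points n) λ σ → vanish σ (σ ∥? s) (χ? i (proj₁ σ) l) (χ? j (proj₂ σ) l′))
      where
      vanish : ∀ σ (x : Dec (σ ∥ s)) (y : Dec (χ i (proj₁ σ) l)) (y′ : Dec (χ j (proj₂ σ) l′)) → ⟦ x ⟧ * (⟦ y ⟧ * ⟦ y′ ⟧) ≡ 0
      vanish σ (no  _) _       _        = refl
      vanish σ (yes _) (no  _) _        = refl
      vanish σ (yes _) (yes _) (no  _)  = refl
      vanish σ (yes x) (yes y) (yes y′) = contradiction (line⇒ (χ-line s x y y′)) ¬l
    g≤ s (i , j) (l , l′) (yes _) _ = begin
      (∑[ σ ∈ points n ] ⟦ σ ∥? s ⟧ * (⟦ χ? i (proj₁ σ) l ⟧ * ⟦ χ? j (proj₂ σ) l′ ⟧))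
        ≤⟨ sum-mono (points n) (λ σ → ⟦⟧*≤ʳ (σ ∥? s) _) ⟩
      (∑[ (c , e) ∈ points n ] ⟦ χ? i c l ⟧ * ⟦ χ? j e l′ ⟧)
        ≡⟨ trans (sum-× (allFin n) (allFin n) _) (sym (sum*sum (allFin n) (allFin n) _ _)) ⟩
      (∑[ c ∈ allFin n ] ⟦ χ? i c l ⟧) * (∑[ e ∈ allFin n ] ⟦ χ? j e l′ ⟧)
        ≤⟨ *-mono-≤ (fin-count≤1 (λ c → χ? i c l) χ-injective) (fin-count≤1 (λ e → χ? j e l′) χ-injective) ⟩
      1 ∎
      where open ≤-Reasoning

    module _ {t} (popular : ∀ l → t ≤ (∑[ (i , c) ∈ points n ] ⟦ χ? i c l ⟧)) (m≤n² : m ≤ n * n)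
             {M} (1≤M : 1 ≤ M) (n²<2^M : n * n < 2 ^ M) (q²<2^M : q * q < 2 ^ M) where

      private
        gridA : IsGrid inj₁
        gridA = X-grid inj₁ a-injective

        gridD : IsGrid inj₂
        gridD = X-grid inj₂ d-injective

        conclude : ∀ (weight : Fin n × Fin n → ℕ) → (∀ s → weight s ≡ w s) → ∀ x z →
          x ≡ fourth n * fourth q → z ≤ tenth n * (fourth q * fourth q) →
          let Q = ∑[ s ∈ slopes ] weight s * weight s in
          Q * Q ≤ c₁ * (M * (sumOver slopes weight * x)) ⊎ cube Q ≤ c₂ * (cube M * z) →
          fourth (q * cube t) ≤ c₃ * (cube M * (cube m * tenth n))
        conclude weight weight≡ x z refl z≤ =
          [ conclude₁ {n} {q} {m} {t} {M} {F} (qt≤F popular) F⁴≤′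
              (≤-trans (≤-reflexive (sum-cong slopes weight≡)) sum-w≤) m≤n² 1≤M
          , conclude₂ {n} {q} {m} {t} {M} {F} (qt≤F popular) F⁴≤′ z≤ ]′
          where
          F⁴≤′ : fourth F ≤ m * (∑[ s ∈ slopes ] weight s * weight s)
          F⁴≤′ = ≤-trans F⁴≤ (≤-reflexive (cong (m *_) (sum-cong slopes λ s → cong (λ z → z * z) (sym (weight≡ s)))))

        -- When D is the smaller grid the energy bound has q^10 n^8; exchanging two factors q for n
        -- gives the n^10 q^8 of the other case.
        swap-powers : q ≤ n → tenth q * (fourth n * fourth n) ≤ tenth n * (fourth q * fourth q)
        swap-powers q≤n = begin
          tenth q * (fourth n * fourth n)
            ≡⟨ factor q n ⟩
          q * q * (fourth q * fourth q * (fourth n * fourth n))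
            ≤⟨ *-monoˡ-≤ _ (*-mono-≤ q≤n q≤n) ⟩
          n * n * (fourth q * fourth q * (fourth n * fourth n))
            ≡⟨ cong (n * n *_) (*-comm (fourth q * fourth q) (fourth n * fourth n)) ⟩
          n * n * (fourth n * fourth n * (fourth q * fourth q))
            ≡⟨ factor n q ⟨
          tenth n * (fourth q * fourth q) ∎
          where
          open ≤-Reasoning
          factor : ∀ x y → tenth x * (fourth y * fourth y) ≡ x * x * (fourth x * fourth x * (fourth y * fourth y))
          factor = solve-* 2 (λ x y → let x² = x · x ; x⁴ = x · x · (x · x) ; y⁴ = y · y · (y · y) in
            x² · (x² · x²) · x⁴ · (y⁴ · y⁴) ⊜ x · x · (x⁴ · x⁴ · (y⁴ · y⁴))) refl

        slopes-distinct : AllPairs (λ s s′ → ¬ s ∥ s′) slopes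
        slopes-distinct = Slopes.reps-distinct (points n)

        module A≤D (n≤q : n ≤ q) = Pairs gridA gridD n≤q slopes slopes-distinct
          (≤-trans length-slopes (*-mono-≤ n≤q n≤q)) M 1≤M q²<2^M g
          (λ s p r → g≤ s p r (line? s (at inj₂ r) (at inj₁ p)) (LineStructure.line-sym 𝓛 s))

        module D≤A (q≤n : q ≤ n) = Pairs gridD gridA q≤n slopes slopes-distinct
          length-slopes M 1≤M n²<2^M (λ s r p → g s p r)
          (λ s r p → g≤ s p r (line? s (at inj₁ p) (at inj₂ r)) id)

      popular-differences : fourth (q * cube t) ≤ c₃ * (cube M * (cube m * tenth n))
      popular-differences = [ case₁ , case₂ ]′ (≤-total n q)
        where
        case₁ : n ≤ q → fourth (q * cube t) ≤ c₃ * (cube M * (cube m * tenth n))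
        case₁ n≤q = conclude (A≤D.weight n≤q) sum-g _ _ refl ≤-refl (A≤D.energy-bound n≤q)
        case₂ : q ≤ n → fourth (q * cube t) ≤ c₃ * (cube M * (cube m * tenth n))
        case₂ q≤n = conclude (D≤A.weight q≤n) (λ s → trans (sum-swap (points q) (points n) _) (sum-g s))
          _ _ (*-comm (fourth q) (fourth n)) (swap-powers q≤n) (D≤A.energy-bound q≤n)

module Chosen
  {n q m : ℕ} (a : Fin n → ℝ) (d : Fin q → ℝ)
  (a-injective : ∀ {i j} → a i ≈ℝ a j → i ≡ j) (d-injective : ∀ {i j} → d i ≈ℝ d j → i ≡ j)
  (a≉0 : ∀ i → ¬ Zero (a i))
  (π : Fin n × Fin n → Fin m)
  (π⇒≈ : ∀ {i j k l} → π (i , j) ≡ π (k , l) → a i *ℝ a j ≈ℝ a k *ℝ a l)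
  (≈⇒π : ∀ {i j k l} → a i *ℝ a j ≈ℝ a k *ℝ a l → π (i , j) ≡ π (k , l))
  (χ : Fin n → Fin n → Fin q → Set) (χ? : ∀ i c l → Dec (χ i c l)) (χ⇒≈ : ∀ {i c l} → χ i c l → a i -ℝ a c ≈ℝ d l)
  {t} (popular : ∀ l → t ≤ (∑[ (i , c) ∈ points n ] ⟦ χ? i c l ⟧)) (m≤n² : m ≤ n * n)
  {M} (1≤M : 1 ≤ M) (n²<2^M : n * n < 2 ^ M) (q²<2^M : q * q < 2 ^ M)
  where

  private
    module D = Decided a d a-injective d-injective a≉0 π π⇒≈ ≈⇒π χ χ? χ⇒≈

    coord-choice : DNChoice D.Coord
    coord-choice = ⊎-choice fin-choice fin-choice

  -- Only finitely many comparisons of real numbers enter, so that they may be assumed decided.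
  popular-differences : fourth (q * cube t) ≤ c₃ * (cube M * (cube m * tenth n))
  popular-differences = decidable-stable (_ ≤? _) λ ¬bound →
    fin-choice (λ i → trichotomy (a i)) λ sign-a →
    ×-choice coord-choice coord-choice (λ x → trichotomy (D.z (proj₁ x) -ℝ D.z (proj₂ x))) λ compare →
    ×-choice (×-choice fin-choice fin-choice) (×-choice (×-choice coord-choice coord-choice) (×-choice coord-choice coord-choice))
      (λ x → trichotomy (D.value (proj₁ x) (proj₁ (proj₂ x)) -ℝ D.value (proj₁ x) (proj₂ (proj₂ x)))) λ compare-forms →
    ¬bound (D.Comparisons.popular-differences sign-a compare compare-forms popular m≤n² 1≤M n²<2^M q²<2^M)

-- Enumerated sets

module Enumeration (S : Setoid 0ℓ 0ℓ) {P : Pred (Setoid.Carrier S) 0ℓ} {xs} (enum : Finite.Enumerates S xs P) where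
  open Setoid S using (Carrier; _≈_) renaming (sym to ≈-sym; refl to ≈-refl)

  holds : ∀ i → P (lookup xs i)
  holds i = Equivalence.to (proj₂ enum (lookup xs i)) (Membership.∈-lookup S xs i)

  index : ∀ {x} → P x → Fin (length xs)
  index {x} p = Any.index (Equivalence.from (proj₂ enum x) p)

  lookup-index : ∀ {x} (p : P x) → x ≈ lookup xs (index p)
  lookup-index {x} p = Any.lookup-index (Equivalence.from (proj₂ enum x) p)

  lookup-injective : ∀ {i j} → lookup xs i ≈ lookup xs j → i ≡ j
  lookup-injective = go (proj₁ enum)
    where
    go : ∀ {ys} → AllPairs (λ x y → ¬ x ≈ y) ys → ∀ {i j} → lookup ys i ≈ lookup ys j → i ≡ j
    go (_  ∷ _)  {zero}  {zero}  _  = refl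
    go (x≉ ∷ _)  {zero}  {suc j} eq = contradiction eq (All.lookup x≉ (∈-lookup j))
    go (x≉ ∷ _)  {suc i} {zero}  eq = contradiction (≈-sym eq) (All.lookup x≉ (∈-lookup i))
    go (_ ∷ ys!) {suc i} {suc j} eq = cong suc (go ys! eq)

distinct-lookup : ∀ {I : Set} {xs : List I} → AllPairs _≢_ xs → ∀ {i j} → lookup xs i ≡ lookup xs j → i ≡ j
distinct-lookup (_  ∷ _)  {zero}  {zero}  _  = refl
distinct-lookup (x≉ ∷ _)  {zero}  {suc j} eq = contradiction eq (All.lookup x≉ (∈-lookup j))
distinct-lookup (x≉ ∷ _)  {suc i} {zero}  eq = contradiction (sym eq) (All.lookup x≉ (∈-lookup i))
distinct-lookup (_ ∷ ys!) {suc i} {suc j} eq = cong suc (distinct-lookup ys! eq)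

injection-count : ∀ {k n} {Q : Pred (Fin n × Fin n) 0ℓ} (Q? : Decidable Q) (h : Fin k → Fin n × Fin n) →
  (∀ {i j} → h i ≡ h j → i ≡ j) → (∀ i → Q (h i)) → k ≤ (∑[ p ∈ points n ] ⟦ Q? p ⟧)
injection-count {k} {n} {Q} Q? h h-injective Qh = begin
  k
    ≡⟨ trans (sym (length-allFin k)) (length-as-sum (allFin k)) ⟩
  (∑[ i ∈ allFin k ] 1)
    ≤⟨ sum-mono (allFin k) (λ i → ≤-trans
         (≤-reflexive (sym (cong₂ _*_ (⟦⟧-true (h i ≟² h i) refl) (⟦⟧-true (Q? (h i)) (Qh i)))))
         (term≤sum (λ p → ⟦ h i ≟² p ⟧ * ⟦ Q? p ⟧) (∈-points (h i)))) ⟩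
  (∑[ i ∈ allFin k ] ∑[ p ∈ points n ] ⟦ h i ≟² p ⟧ * ⟦ Q? p ⟧)
    ≡⟨ sum-swap (allFin k) (points n) _ ⟩
  (∑[ p ∈ points n ] ∑[ i ∈ allFin k ] ⟦ h i ≟² p ⟧ * ⟦ Q? p ⟧)
    ≤⟨ sum-mono (points n) (λ p → ≤-trans (≤-reflexive (sym (sum-*ʳ (allFin k) (λ i → ⟦ h i ≟² p ⟧) ⟦ Q? p ⟧)))
         (≤-trans (*-monoˡ-≤ ⟦ Q? p ⟧ (fin-count≤1 (λ i → h i ≟² p) λ e e′ → h-injective (trans e (sym e′))))
           (≤-reflexive (*-identityˡ _)))) ⟩
  (∑[ p ∈ points n ] ⟦ Q? p ⟧) ∎
  where
  open ≤-Reasoning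
  _≟²_ : ∀ (p p′ : Fin n × Fin n) → Dec (p ≡ p′)
  _≟²_ = Product.≡-dec Fin._≟_ Fin._≟_

count-points≤ : ∀ {n} {Q : Pred (Fin n × Fin n) 0ℓ} (Q? : Decidable Q) → (∑[ p ∈ points n ] ⟦ Q? p ⟧) ≤ n * n
count-points≤ {n} Q? = ≤-trans (sum-≤-const (points n) 1 λ p → ⟦⟧≤1 (Q? p))
  (≤-reflexive (trans (*-identityʳ _) (length-points n)))

length-filter-count : ∀ {I : Set} {P : Pred I 0ℓ} (P? : Decidable P) xs → length (filter P? xs) ≡ (∑[ x ∈ xs ] ⟦ P? x ⟧)
length-filter-count P? []       = refl
length-filter-count P? (x ∷ xs) with P? x
... | yes _ = cong suc (length-filter-count P? xs)
... | no  _ = length-filter-count P? xs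

sum-allFin-suc : ∀ n (f : Fin (suc n) → ℕ) → sumOver (allFin (suc n)) f ≡ f zero + sumOver (allFin n) (f ∘ suc)
sum-allFin-suc n f = cong (f zero +_) (trans (cong (λ xs → sumOver xs f) (sym (map-tabulate id suc))) (sum-map suc (allFin n) f))

multiplicities : ∀ {I : Set} {R : I → ℕ → Set} {xs ks} → Pointwise R xs ks →
  ∃ λ (k : Fin (length xs) → ℕ) → (∀ i → R (lookup xs i) (k i)) × sum (map (_^ 3) ks) ≡ (∑[ i ∈ allFin (length xs) ] cube (k i))
multiplicities [] = (λ ()) , (λ ()) , refl
multiplicities {R = R} {x ∷ xs} {y ∷ ks} (r ∷ rs) with multiplicities rs
... | k , Rk , eq = k′ , (λ { zero → r ; (suc i) → Rk i }) ,
  trans (cong₂ _+_ (cong (λ z → y * (y * z)) (*-identityʳ y)) eq) (sym (sum-allFin-suc (length xs) (cube ∘ k′)))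
  where
  k′ : Fin (suc (length xs)) → ℕ
  k′ zero    = y
  k′ (suc i) = k i

x≤cube : ∀ x → x ≤ cube x
x≤cube zero    = z≤n
x≤cube (suc x) = m≤m*n (suc x) (suc x * suc x)

-- Pigeonholing contributes K⁴ and the bound for popular differences K³. Rounding K⁷ up to K⁹ allows
-- an exact cube root carrying K³: this is the exponent 3 of the logarithm.
cube-combine : ∀ a b c {e K x y} m n → 1 ≤ K → e ≤ a * K * (b * x * y) →
  fourth (y * x) ≤ c * (cube (a * K) * (cube m * tenth n)) →
  fourth e ≤ cube (fourth b * (c * (fourth a * cube a)) * (cube K * m)) * tenth n
cube-combine a b c {e} {K} {x} {y} m n 1≤K e≤ xy≤ = begin
  fourth e
    ≤⟨ *-mono-≤ (*-mono-≤ e≤ e≤) (*-mono-≤ e≤ e≤) ⟩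
  fourth (a * K * (b * x * y))
    ≡⟨ separate a b K x y ⟩
  fourth b * (fourth a * fourth K * fourth (y * x))
    ≤⟨ *-monoʳ-≤ (fourth b) (*-monoʳ-≤ (fourth a * fourth K) xy≤) ⟩
  fourth b * (fourth a * fourth K * (c * (cube (a * K) * (cube m * tenth n))))
    ≡⟨ cong (λ z → fourth b * (fourth a * fourth K * (c * (z * (cube m * tenth n))))) (cube-* a K) ⟩
  fourth b * (fourth a * fourth K * (c * (cube a * cube K * (cube m * tenth n))))
    ≡⟨ collect (fourth b) (fourth a) (fourth K) c (cube a) (cube K) (cube m) (tenth n) ⟩
  C * (fourth K * cube K * cube m) * tenth n
    ≤⟨ *-monoˡ-≤ (tenth n) (*-mono-≤ (x≤cube C) (*-monoˡ-≤ (cube m) K⁷≤K⁹)) ⟩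
  cube C * (cube (cube K) * cube m) * tenth n
    ≡⟨ cong (_* tenth n) (trans (cong (cube C *_) (sym (cube-* (cube K) m))) (sym (cube-* C (cube K * m)))) ⟩
  cube (C * (cube K * m)) * tenth n ∎
  where
  open ≤-Reasoning
  C : ℕ
  C = fourth b * (c * (fourth a * cube a))
  separate : ∀ a b K x y → fourth (a * K * (b * x * y)) ≡ fourth b * (fourth a * fourth K * fourth (y * x))
  separate = solve-* 5 (λ a b K x y → let s = λ z → z · z · (z · z) in
    s (a · K · (b · x · y)) ⊜ s b · (s a · s K · s (y · x))) refl
  collect : ∀ a b K⁴ c d K³ m x → a * (b * K⁴ * (c * (d * K³ * (m * x)))) ≡ a * (c * (b * d)) * (K⁴ * K³ * m) * x
  collect = solve-* 8 (λ a b K⁴ c d K³ m x → a · (b · K⁴ · (c · (d · K³ · (m · x)))) ⊜ a · (c · (b · d)) · (K⁴ · K³ · m) · x) refl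
  K⁷≤K⁹ : fourth K * cube K ≤ cube (cube K)
  K⁷≤K⁹ = begin
    fourth K * cube K            ≡⟨ *-identityˡ _ ⟨
    1 * (fourth K * cube K)      ≤⟨ *-monoˡ-≤ (fourth K * cube K) (*-mono-≤ 1≤K 1≤K) ⟩
    K * K * (fourth K * cube K)
      ≡⟨ solve-* 1 (λ K → let K³ = K · (K · K) in K · K · (K · K · (K · K) · K³) ⊜ K³ · (K³ · K³)) refl K ⟩
    cube (cube K)                ∎

opaque
  -- Here 8 is the loss in `dyadic-pigeonhole` and 4 the ratio of `M` to `K` in `Scale`, which
  -- enters to the seventh power along with `K`.
  c₄ : ℕ
  c₄ = fourth 8 * (c₃ * (fourth 4 * cube 4))

  c₄≡ : c₄ ≡ fourth 8 * (c₃ * (fourth 4 * cube 4))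
  c₄≡ = refl

-ℝ-cong : ∀ {x x′ y y′} → x ≈ℝ x′ → y ≈ℝ y′ → x -ℝ y ≈ℝ x′ -ℝ y′
-ℝ-cong {x} {x′} {y} {y′} p p′ = Zero⇒≈ {x -ℝ y} {x′ -ℝ y′} (Zero-resp {(x -ℝ x′) -ℝ (y -ℝ y′)} {(x -ℝ y) -ℝ (x′ -ℝ y′)}
  (λ n → solveℚ 4 (λ x x′ y y′ → (x :- x′) :- (y :- y′) :=ℚ (x :- y) :- (x′ :- y′)) refl (seq x n) (seq x′ n) (seq y n) (seq y′ n))
  (Zero-- {x -ℝ x′} {y -ℝ y′} (≈⇒Zero {x} {x′} p) (≈⇒Zero {y} {y′} p′)))

*ℝ-cong : ∀ {x x′ y y′} → x ≈ℝ x′ → y ≈ℝ y′ → x *ℝ y ≈ℝ x′ *ℝ y′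
*ℝ-cong {x} {x′} {y} {y′} p p′ = Zero⇒≈ {x *ℝ y} {x′ *ℝ y′} (Zero-resp {x *ℝ (y -ℝ y′) +ℝ y′ *ℝ (x -ℝ x′)} {x *ℝ y -ℝ x′ *ℝ y′}
  (λ n → solveℚ 4 (λ x x′ y y′ → x :*ℚ (y :- y′) :+ℚ y′ :*ℚ (x :- x′) :=ℚ x :*ℚ y :- x′ :*ℚ y′) refl (seq x n) (seq x′ n) (seq y n) (seq y′ n))
  (Zero-+ {x *ℝ (y -ℝ y′)} {y′ *ℝ (x -ℝ x′)} (Zero-*ˡ x {y -ℝ y′} (≈⇒Zero {y} {y′} p′)) (Zero-*ˡ y′ {x -ℝ x′} (≈⇒Zero {x} {x′} p))))

-- From enumerated sets of reals to indices

module Assembly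
  {A : Pred ℝ 0ℓ} {as aas xs : List ℝ} (enumA : Enumerates as A) (enumAA : Enumerates aas (ProductSet A))
  (enumD : Enumerates xs (DifferenceSet A)) (A≉0 : ∀ x → A x → ¬ x ≈ℝ 0ℝ)
  (k : Fin (length xs) → ℕ) (k-counts : ∀ i → RepCount A (lookup xs i) (k i))
  where

  private
    n m N : ℕ
    n = length as
    m = length aas
    N = length xs

    module 𝐴  = Enumeration ≈ℝ-setoid enumA
    module 𝐴𝐴 = Enumeration ≈ℝ-setoid enumAA
    module 𝐷  = Enumeration ≈ℝ-setoid enumD

    a : Fin n → ℝ
    a = lookup as

    π : Fin n × Fin n → Fin m
    π (i , j) = 𝐴𝐴.index {a i *ℝ a j} (a i , a j , 𝐴.holds i , 𝐴.holds j , ≈ℝ.refl {a i *ℝ a j})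

    product≈ : ∀ i j → a i *ℝ a j ≈ℝ lookup aas (π (i , j))
    product≈ i j = 𝐴𝐴.lookup-index {a i *ℝ a j} (a i , a j , 𝐴.holds i , 𝐴.holds j , ≈ℝ.refl {a i *ℝ a j})

    δ : Fin n → Fin n → Fin N
    δ i c = 𝐷.index {a i -ℝ a c} (a i , a c , 𝐴.holds i , 𝐴.holds c , ≈ℝ.refl {a i -ℝ a c})

    difference≈ : ∀ i c → a i -ℝ a c ≈ℝ lookup xs (δ i c)
    difference≈ i c = 𝐷.lookup-index {a i -ℝ a c} (a i , a c , 𝐴.holds i , 𝐴.holds c , ≈ℝ.refl {a i -ℝ a c})

    π⇒≈ : ∀ {i j k l} → π (i , j) ≡ π (k , l) → a i *ℝ a j ≈ℝ a k *ℝ a l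
    π⇒≈ {i} {j} {k} {l} eq = ≈ℝ.trans {a i *ℝ a j} {lookup aas (π (i , j))} {a k *ℝ a l} (product≈ i j)
      (≈ℝ.sym {a k *ℝ a l} {lookup aas (π (i , j))}
        (subst (λ p → a k *ℝ a l ≈ℝ lookup aas p) (sym eq) (product≈ k l)))

    ≈⇒π : ∀ {i j k l} → a i *ℝ a j ≈ℝ a k *ℝ a l → π (i , j) ≡ π (k , l)
    ≈⇒π {i} {j} {k} {l} eq = 𝐴𝐴.lookup-injective
      (≈ℝ.trans {lookup aas (π (i , j))} {a i *ℝ a j} {lookup aas (π (k , l))}
        (≈ℝ.sym {a i *ℝ a j} {lookup aas (π (i , j))} (product≈ i j))
        (≈ℝ.trans {a i *ℝ a j} {a k *ℝ a l} {lookup aas (π (k , l))} eq (product≈ k l)))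

    module RepCounts {x k} (count : RepCount A x k) where
      pairs : List (ℝ × ℝ)
      pairs = proj₁ count

      module 𝑅 = Enumeration (×-setoid ≈ℝ-setoid ≈ℝ-setoid) (proj₁ (proj₂ count))

      fst snd : Fin (length pairs) → ℝ
      fst i = proj₁ (lookup pairs i)
      snd i = proj₂ (lookup pairs i)

      i₁ i₂ : Fin (length pairs) → Fin n
      i₁ i = 𝐴.index (proj₁ (𝑅.holds i))
      i₂ i = 𝐴.index (proj₁ (proj₂ (𝑅.holds i)))

      fst≈ : ∀ i → fst i ≈ℝ a (i₁ i)
      fst≈ i = 𝐴.lookup-index (proj₁ (𝑅.holds i))

      snd≈ : ∀ i → snd i ≈ℝ a (i₂ i)
      snd≈ i = 𝐴.lookup-index (proj₁ (proj₂ (𝑅.holds i)))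

      same-entry : ∀ {x y z z′ : ℝ} → x ≈ℝ z → y ≈ℝ z′ → z ≡ z′ → x ≈ℝ y
      same-entry {x} {y} {z} p p′ refl = ≈ℝ.trans {x} {z} {y} p (≈ℝ.sym {y} {z} p′)

      indices-injective : ∀ {i j} → (i₁ i , i₂ i) ≡ (i₁ j , i₂ j) → i ≡ j
      indices-injective {i} {j} eq = 𝑅.lookup-injective
        ( same-entry {fst i} {fst j} (fst≈ i) (fst≈ j) (cong (a ∘ proj₁) eq)
        , same-entry {snd i} {snd j} (snd≈ i) (snd≈ j) (cong (a ∘ proj₂) eq))

      difference-index : ∀ i → x ≈ℝ lookup xs (δ (i₁ i) (i₂ i))
      difference-index i = ≈ℝ.trans {x} {fst i -ℝ snd i} {lookup xs (δ (i₁ i) (i₂ i))}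
        (≈ℝ.sym {fst i -ℝ snd i} {x} (proj₂ (proj₂ (𝑅.holds i))))
        (≈ℝ.trans {fst i -ℝ snd i} {a (i₁ i) -ℝ a (i₂ i)} {lookup xs (δ (i₁ i) (i₂ i))}
          (-ℝ-cong {fst i} {a (i₁ i)} {snd i} {a (i₂ i)} (fst≈ i) (snd≈ i)) (difference≈ (i₁ i) (i₂ i)))

    -- The listed pairs are distinct up to `≈ℝ`, so their index pairs are distinct, and each of
    -- these has its difference at l.
    k≤ : ∀ l → k l ≤ (∑[ (i , c) ∈ points n ] ⟦ δ i c Fin.≟ l ⟧)
    k≤ l = subst (_≤ (∑[ (i , c) ∈ points n ] ⟦ δ i c Fin.≟ l ⟧)) (proj₂ (proj₂ (k-counts l)))
      (injection-count (λ (i , c) → δ i c Fin.≟ l) (λ i → i₁ i , i₂ i) indices-injective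
        λ i → sym (𝐷.lookup-injective (difference-index i)))
      where open RepCounts {lookup xs l} {k l} (k-counts l)

    m≤n² : m ≤ n * n
    m≤n² = ≤-trans (injection-count {Q = λ p → p ≡ p} (λ _ → yes refl) (λ p → i₁ p , i₂ p) indices-injective (λ _ → refl))
      (count-points≤ {n} {λ p → p ≡ p} λ _ → yes refl)
      where
      factor₁ factor₂ : Fin m → ℝ
      factor₁ p = proj₁ (𝐴𝐴.holds p)
      factor₂ p = proj₁ (proj₂ (𝐴𝐴.holds p))
      i₁ i₂ : Fin m → Fin n
      i₁ p = 𝐴.index (proj₁ (proj₂ (proj₂ (𝐴𝐴.holds p))))
      i₂ p = 𝐴.index (proj₁ (proj₂ (proj₂ (proj₂ (𝐴𝐴.holds p)))))
      product : ∀ p → lookup aas p ≈ℝ a (i₁ p) *ℝ a (i₂ p)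
      product p = ≈ℝ.trans {lookup aas p} {factor₁ p *ℝ factor₂ p} {a (i₁ p) *ℝ a (i₂ p)}
        (proj₂ (proj₂ (proj₂ (proj₂ (𝐴𝐴.holds p)))))
        (*ℝ-cong {factor₁ p} {a (i₁ p)} {factor₂ p} {a (i₂ p)}
          (𝐴.lookup-index (proj₁ (proj₂ (proj₂ (𝐴𝐴.holds p)))))
          (𝐴.lookup-index (proj₁ (proj₂ (proj₂ (proj₂ (𝐴𝐴.holds p)))))))
      indices-injective : ∀ {p p′} → (i₁ p , i₂ p) ≡ (i₁ p′ , i₂ p′) → p ≡ p′
      indices-injective {p} {p′} eq = 𝐴𝐴.lookup-injective
        (≈ℝ.trans {lookup aas p} {a (i₁ p) *ℝ a (i₂ p)} {lookup aas p′} (product p)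
          (≈ℝ.sym {lookup aas p′} {a (i₁ p) *ℝ a (i₂ p)}
            (subst (λ (i , j) → lookup aas p′ ≈ℝ a i *ℝ a j) (sym eq) (product p′))))

  module Scale {K} (1≤K : 1 ≤ K) (1≤n : 1 ≤ n) (n<2^K : n < 2 ^ K) where

    private
      M : ℕ
      -- D may have up to n² elements, so q² < 2^M calls for 2^M > n⁴.
      M = 4 * K

      n⁴<2^M : n * n * (n * n) < 2 ^ M
      n⁴<2^M = <-≤-trans (*-mono-< (*-mono-< n<2^K n<2^K) (*-mono-< n<2^K n<2^K)) (≤-reflexive (begin
        2 ^ K * 2 ^ K * (2 ^ K * 2 ^ K)  ≡⟨ cong₂ _*_ (^-distribˡ-+-* 2 K K) (^-distribˡ-+-* 2 K K) ⟨
        2 ^ (K + K) * 2 ^ (K + K)        ≡⟨ ^-distribˡ-+-* 2 (K + K) (K + K) ⟨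
        2 ^ (K + K + (K + K))            ≡⟨ cong (2 ^_) (solve 1 (λ k → k :+ k :+ (k :+ k) := con 4 :* k) refl K) ⟩
        2 ^ M                            ∎))
        where open ≡-Reasoning

      n²<2^M : n * n < 2 ^ M
      n²<2^M = ≤-<-trans (≤-trans (≤-reflexive (sym (*-identityˡ (n * n)))) (*-monoˡ-≤ (n * n) (*-mono-≤ 1≤n 1≤n))) n⁴<2^M

      k<2^M : ∀ l → k l < 2 ^ M
      k<2^M l = ≤-<-trans (≤-trans (k≤ l) (count-points≤ λ (i , c) → δ i c Fin.≟ l)) n²<2^M

      module Threshold (t : ℕ) (1≤t : 1 ≤ t) where
        D : List (Fin N)
        D = filter (λ l → t ≤? k l) (allFin N)

        q : ℕ
        q = length D

        D-injective : ∀ {l l′} → lookup D l ≡ lookup D l′ → l ≡ l′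
        D-injective = distinct-lookup (AllPairs.filter⁺ (λ l → t ≤? k l) (allFin⁺ N))

        χ : Fin n → Fin n → Fin q → Set
        χ i c l = δ i c ≡ lookup D l

        χ? : ∀ i c l → Dec (χ i c l)
        χ? i c l = δ i c Fin.≟ lookup D l

        popular : ∀ l → t ≤ (∑[ (i , c) ∈ points n ] ⟦ χ? i c l ⟧)
        popular l = ≤-trans (All.lookup (All.all-filter (λ l → t ≤? k l) (allFin N)) (∈-lookup l)) (k≤ (lookup D l))

        q≤n² : q ≤ n * n
        q≤n² = begin
          q                                                          ≡⟨ *-identityʳ q ⟨
          q * 1                                                      ≡⟨ cong (_* 1) (length-allFin q) ⟨
          length (allFin q) * 1                                      ≡⟨ sum-const (allFin q) 1 ⟨
          (∑[ l ∈ allFin q ] 1)                                      ≤⟨ sum-mono (allFin q) (λ l → ≤-trans 1≤t (popular l)) ⟩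
          (∑[ l ∈ allFin q ] ∑[ (i , c) ∈ points n ] ⟦ χ? i c l ⟧)   ≡⟨ sum-swap (allFin q) (points n) _ ⟩
          (∑[ (i , c) ∈ points n ] ∑[ l ∈ allFin q ] ⟦ χ? i c l ⟧)
            ≤⟨ sum-≤-const (points n) 1 (λ (i , c) → fin-count≤1 (χ? i c) λ e e′ → D-injective (trans (sym e) e′)) ⟩
          length (points n) * 1                                      ≡⟨ trans (*-identityʳ _) (length-points n) ⟩
          n * n                                                      ∎
          where open ≤-Reasoning

        bound : fourth (q * cube t) ≤ c₃ * (cube M * (cube m * tenth n))
        bound = Chosen.popular-differences a (lookup xs ∘ lookup D) 𝐴.lookup-injective
          (λ eq → D-injective (𝐷.lookup-injective eq))
          (λ i → A≉0 (a i) (𝐴.holds i)) π (λ {i} {j} {k} {l} → π⇒≈ {i} {j} {k} {l}) (λ {i} {j} {k} {l} → ≈⇒π {i} {j} {k} {l})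
          χ χ? (λ {i} {c} e → subst (λ l → a i -ℝ a c ≈ℝ lookup xs l) e (difference≈ i c))
          popular m≤n² (≤-trans 1≤K (m≤n*m K 4)) n²<2^M (≤-<-trans (*-mono-≤ q≤n² q≤n²) n⁴<2^M)

    energy-bound : fourth (∑[ l ∈ allFin N ] cube (k l)) ≤ cube (c₄ * (cube K * m)) * tenth n
    energy-bound = conclude (dyadic-pigeonhole (allFin N) k M k<2^M)
      where
      conclude : (∃ λ t → 1 ≤ t × (∑[ l ∈ allFin N ] cube (k l)) ≤ M * (8 * cube t * (∑[ l ∈ allFin N ] ⟦ t ≤? k l ⟧))) →
                 fourth (∑[ l ∈ allFin N ] cube (k l)) ≤ cube (c₄ * (cube K * m)) * tenth n
      conclude (t , 1≤t , le) = subst (λ c → fourth (∑[ l ∈ allFin N ] cube (k l)) ≤ cube (c * (cube K * m)) * tenth n) (sym c₄≡)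
        (cube-combine 4 8 c₃ {x = cube t} {y = Threshold.q t 1≤t} m n 1≤K
          (≤-trans le (≤-reflexive (cong (λ q → M * (8 * cube t * q)) (sym (length-filter-count (λ l → t ≤? k l) (allFin N))))))
          (Threshold.bound t 1≤t))

third-moment-bound : ∀ {A n m e K} → HasCard A n → (∀ x → A x → ¬ x ≈ℝ 0ℝ) → HasCard (ProductSet A) m → Energy₃⁺ A e →
  1 ≤ n → 1 ≤ K → n < 2 ^ K → fourth e ≤ cube (c₄ * (cube K * m)) * tenth n
third-moment-bound {A} (as , enumA , refl) A≉0 (aas , enumAA , refl) (xs , ks , enumD , counts , refl) 1≤n 1≤K n<2^K =
  go (multiplicities counts)
  where
  go : (∃ λ (k : Fin (length xs) → ℕ) → (∀ i → RepCount A (lookup xs i) (k i)) × sum (map (_^ 3) ks) ≡ (∑[ i ∈ allFin (length xs) ] cube (k i))) → _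
  go (k , k-counts , eq) = subst (λ e → fourth e ≤ _) (sym eq)
    (Assembly.Scale.energy-bound enumA enumAA enumD A≉0 k k-counts 1≤K 1≤n n<2^K)

-- Comparison with the logarithm

-- The shift by 2 ensures J ≥ 1, so that the scale J + 1, with n < 2^(J+1), is at most 2 J and can
-- be compared with the logarithm of 2 + n.
dyadic-scale : ∀ n → ∃ λ J → 1 ≤ J × 2 ^ J ≤ 2 + n × 2 + n < 2 ^ suc J
dyadic-scale zero = 1 , ≤-refl , ≤-refl , s≤s (s≤s (s≤s z≤n))
dyadic-scale (suc n) with dyadic-scale n
... | J , 1≤J , lower , upper with 3 + n <? 2 ^ suc J
...   | yes below = J , 1≤J , m≤n⇒m≤1+n lower , below
...   | no  above = suc J , m≤n⇒m≤1+n 1≤J , ≮⇒≥ above ,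
  <-≤-trans (s≤s upper) (≤-trans (+-monoˡ-≤ (2 ^ suc J) (m^n>0 2 (suc J))) (≤-reflexive (cong (2 ^ suc J +_) (sym (+-identityʳ _)))))

∑-extend : ∀ {m n} f → (∀ j → 0ℚ ℚ.≤ f j) → m ≤ n → ∑ m f ℚ.≤ ∑ n f
∑-extend {m} {n} f f≥0 m≤n with m≤n⇒∃[o]m+o≡n m≤n
... | o , refl = subst₂ ℚ._≤_ (ℚ.+-identityʳ (∑ m f))
  (trans (sym (∑-+ m o f)) (cong (λ k → ∑ k f) (+-comm o m)))
  (ℚ.+-monoʳ-≤ (∑ m f) (nonNeg o λ j → f≥0 (j + m)))
  where
  nonNeg : ∀ n {f} → (∀ j → 0ℚ ℚ.≤ f j) → 0ℚ ℚ.≤ ∑ n f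
  nonNeg zero    _   = ℚ.≤-refl
  nonNeg (suc n) f≥0 = ℚ.+-mono-≤ (nonNeg n f≥0) (f≥0 n)

-- With N = 1 + i, passing from 2^J to 2^(J+1) adds 2^J N rectangles to the Riemann sum, each of
-- area at least 1 / (2 · 2^J N), hence at least 1/2 in all.
logSum-doubling : ∀ J i → J // 2 ℚ.≤ logSum (2 ^ J) i
logSum-doubling zero    i = ℚ.≤-refl
logSum-doubling (suc J) i = begin
  suc J // 2                       ≡⟨ cong (λ z → z // 2) (+-comm 1 J) ⟩
  (J + 1) // 2                     ≡⟨ frac-+ˢ J 1 2 ⟨
  J // 2 ℚ.+ 1 // 2                ≤⟨ ℚ.+-mono-≤ (logSum-doubling J i) block ⟩
  ∑ old f ℚ.+ ∑ new (λ j → f (j + old))  ≡⟨ ∑-+ old new f ⟨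
  ∑ (new + old) f                  ≡⟨ cong (λ k → ∑ k f) split ⟩
  logSum (2 ^ suc J) i             ∎
  where
  open ℚ.≤-Reasoning
  f : ℕ → ℚ
  f j = 1 // suc (i + j)
  old new : ℕ
  old = (2 ^ J ∸ 1) * suc i
  new = 2 ^ J * suc i
  old+N : suc i + old ≡ new
  old+N = cong (_* suc i) (m+[n∸m]≡n (m^n>0 2 J))
  split : new + old ≡ (2 ^ suc J ∸ 1) * suc i
  split = trans (sym (*-distribʳ-+ (suc i) (2 ^ J) (2 ^ J ∸ 1)))
    (cong (_* suc i) (trans (sym (+-∸-assoc (2 ^ J) (m^n>0 2 J))) (cong (λ z → 2 ^ J + z ∸ 1) (sym (+-identityʳ (2 ^ J))))))
  instance _ = m*n≢0 (2 ^ J) (suc i) {{m^n≢0 2 J}}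
  instance _ = m*n≢0 2 new
  block : 1 // 2 ℚ.≤ ∑ new (λ j → f (j + old))
  block = begin
    1 // 2                              ≤⟨ frac-≤ 1 2 new (2 * new) (≤-reflexive (trans (*-identityˡ (2 * new)) (*-comm 2 new))) ⟩
    new // (2 * new)                    ≡⟨ ∑-const new (2 * new) ⟨
    ∑ new (λ _ → 1 // (2 * new))        ≤⟨ ∑-mono new (λ j j<new → frac-≤ 1 (2 * new) 1 (suc (i + (j + old)))
                                             (*-monoʳ-≤ 1 (small-denominator j j<new))) ⟩
    ∑ new (λ j → f (j + old))           ∎
    where
    small-denominator : ∀ j → j < new → suc (i + (j + old)) ≤ 2 * new
    small-denominator j j<new = ≤-trans
      (≤-reflexive (trans (solve 3 (λ i j o → con 1 :+ (i :+ (j :+ o)) := j :+ (con 1 :+ i :+ o)) refl i j old) (cong (j +_) old+N)))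
      (≤-trans (+-monoˡ-≤ new (<⇒≤ j<new)) (≤-reflexive (cong (new +_) (sym (+-identityʳ new)))))

logSum-lower : ∀ J n i → 2 ^ J ≤ n → J // 2 ℚ.≤ logSum n i
logSum-lower J n i le = ℚ.≤-trans (logSum-doubling J i)
  (∑-extend (λ j → 1 // suc (i + j)) (λ j → nonNeg-frac 1 (suc (i + j))) (*-monoˡ-≤ (suc i) (∸-monoˡ-≤ 1 le)))

-- Roots

frac-* : ∀ a b c d .{{_ : NonZero b}} .{{_ : NonZero d}} .{{_ : NonZero (b * d)}} →
         (a // b) ℚ.* (c // d) ≡ (a * c) // (b * d)
frac-* a b@(suc b-1) c d@(suc d-1) = ℚ.toℚᵘ-injective (begin-equality
  ℚ.toℚᵘ ((a // b) ℚ.* (c // d))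
    ≃⟨ ℚ.toℚᵘ-homo-* (a // b) (c // d) ⟩
  ℚ.toℚᵘ (a // b) ℚᵘ.* ℚ.toℚᵘ (c // d)
    ≃⟨ ℚᵘ.*-cong (ℚ.toℚᵘ-fromℚᵘ (ℚᵘ.mkℚᵘ (ℤ.+ a) b-1)) (ℚ.toℚᵘ-fromℚᵘ (ℚᵘ.mkℚᵘ (ℤ.+ c) d-1)) ⟩
  ℚᵘ.mkℚᵘ (ℤ.+ a) b-1 ℚᵘ.* ℚᵘ.mkℚᵘ (ℤ.+ c) d-1
    ≃⟨ ℚᵘ.≃-reflexive (cong (λ z → ℚᵘ.mkℚᵘ z _) (sym (ℤ.pos-* a c))) ⟩
  ℚᵘ.mkℚᵘ (ℤ.+ (a * c)) _
    ≃⟨ ℚᵘ.≃-sym (ℚ.toℚᵘ-fromℚᵘ (ℚᵘ.mkℚᵘ (ℤ.+ (a * c)) _)) ⟩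
  ℚ.toℚᵘ ((a * c) // (b * d)) ∎)
  where open ℚᵘ.≤-Reasoning

cube-cancel-≤ : ∀ {x y} → cube x ≤ cube y → x ≤ y
cube-cancel-≤ {x} {y} le with x ≤? y
... | yes x≤y = x≤y
... | no  x≰y = contradiction le (<⇒≱ (*-mono-< (≰⇒> x≰y) (*-mono-< (≰⇒> x≰y) (≰⇒> x≰y))))

-- Floors only lower the two roots, so with s = 1 + i the quantities u³ and v³ n^10 are at most e⁴
-- s³ and s³; it remains to multiply and take cube roots.
rootFloors : ∀ e n x i .{{_ : NonZero n}} → fourth e ≤ cube x * tenth n →
  rootFloor 3 (e ^ 4) 1 (suc i) * rootFloor 3 1 (n ^ 10) (suc i) ≤ x * (suc i * suc i)
rootFloors e n x i e⁴≤ = cube-cancel-≤ (*-cancelʳ-≤ _ _ (n ^ 10) {{m^n≢0 n 10}} (begin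
  cube (u * v) * n ^ 10
    ≡⟨ split u v (n ^ 10) ⟩
  u ^ 3 * 1 * (v ^ 3 * n ^ 10)
    ≤⟨ *-mono-≤ (rootFloor-lower 3 (e ^ 4) 1 s) (rootFloor-lower 3 1 (n ^ 10) {{_}} {{m^n≢0 n 10}} s) ⟩
  e ^ 4 * s ^ 3 * (1 * s ^ 3)
    ≡⟨ to-fourth e s ⟩
  fourth e * cube (s * s)
    ≤⟨ *-monoˡ-≤ (cube (s * s)) e⁴≤ ⟩
  cube x * tenth n * cube (s * s)
    ≡⟨ to-tenth x n (s * s) ⟩
  cube (x * (s * s)) * n ^ 10 ∎))
  where
  open ≤-Reasoning
  s u v : ℕ
  s = suc i
  u = rootFloor 3 (e ^ 4) 1 s
  v = rootFloor 3 1 (n ^ 10) s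
  split : ∀ u v w → cube (u * v) * w ≡ u ^ 3 * 1 * (v ^ 3 * w)
  split = solve-* 3 (λ u v w → u · v · (u · v · (u · v)) · w ⊜ u · (u · (u · id*)) · id* · (v · (v · (v · id*)) · w)) refl
  to-fourth : ∀ e s → e ^ 4 * s ^ 3 * (1 * s ^ 3) ≡ fourth e * cube (s * s)
  to-fourth = solve-* 2 (λ e s → e · (e · (e · (e · id*))) · (s · (s · (s · id*))) · (id* · (s · (s · (s · id*))))
    ⊜ e · e · (e · e) · (s · s · (s · s · (s · s)))) refl
  to-tenth : ∀ x n s → cube x * tenth n * cube s ≡ cube (x * s) * n ^ 10
  to-tenth = solve-* 3 (λ x n s → let n² = n · n in x · (x · x) · (n² · (n² · n²) · (n · n · (n · n))) · (s · (s · s))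
    ⊜ x · s · (x · s · (x · s)) · (n · (n · (n · (n · (n · (n · (n · (n · (n · (n · id*))))))))))) refl

opaque
  -- 64 = 8 · 8: one factor is 2³ from K ≤ 2 J, the other the cube of the 2 in the lower bound J / 2
  -- for the logarithm. The summand 1 makes positivity evident.
  c₅ : ℕ
  c₅ = 1 + 64 * c₄

  c₅≡ : c₅ ≡ 1 + 64 * c₄
  c₅≡ = refl

log-cube-lower : ∀ {L J} → J // 2 ℚ.≤ L → ∀ m →
  ((c₅ * m) // 1) ℚ.* (cube J // 8) ℚ.≤ (c₅ // 1) ℚ.* (m // 1) ℚ.* (L ℚ.* (L ℚ.* (L ℚ.* 1ℚ)))
log-cube-lower {L} {J} le m = subst (ℚ._≤ _) eq (*-mono (nonneg* (nonNeg-frac c₅ 1) (nonNeg-frac m 1)) ℚ.≤-refl L³)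
  where
  nonneg* : ∀ {p q} → 0ℚ ℚ.≤ p → 0ℚ ℚ.≤ q → 0ℚ ℚ.≤ p ℚ.* q
  nonneg* {p} {q} 0≤p 0≤q = subst (ℚ._≤ p ℚ.* q) (ℚ.*-zeroʳ p) (ℚ.*-monoˡ-≤-nonNeg p {{ℚ.nonNegative 0≤p}} 0≤q)
  *-mono : ∀ {p p′ q q′} → 0ℚ ℚ.≤ p → p ℚ.≤ p′ → (0ℚ ℚ.≤ q × q ℚ.≤ q′) → p ℚ.* q ℚ.≤ p′ ℚ.* q′
  *-mono {p} {p′} {q} {q′} 0≤p p≤ (0≤q , q≤) = ℚ.≤-trans
    (ℚ.*-monoʳ-≤-nonNeg q {{ℚ.nonNegative 0≤q}} p≤)
    (ℚ.*-monoˡ-≤-nonNeg p′ {{ℚ.nonNegative (ℚ.≤-trans 0≤p p≤)}} q≤)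
  j : ℚ
  j = J // 2
  0≤j : 0ℚ ℚ.≤ j
  0≤j = nonNeg-frac J 2
  step : ∀ {q q′} → (0ℚ ℚ.≤ q × q ℚ.≤ q′) → 0ℚ ℚ.≤ j ℚ.* q × j ℚ.* q ℚ.≤ L ℚ.* q′
  step (0≤q , q≤) = nonneg* 0≤j 0≤q , *-mono 0≤j le (0≤q , q≤)
  L³ : 0ℚ ℚ.≤ j ℚ.* (j ℚ.* (j ℚ.* 1ℚ)) × j ℚ.* (j ℚ.* (j ℚ.* 1ℚ)) ℚ.≤ L ℚ.* (L ℚ.* (L ℚ.* 1ℚ))
  L³ = step (step (step (nonNeg-frac 1 1 , ℚ.≤-refl)))
  eq : (c₅ // 1) ℚ.* (m // 1) ℚ.* (j ℚ.* (j ℚ.* (j ℚ.* 1ℚ))) ≡ ((c₅ * m) // 1) ℚ.* (cube J // 8)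
  eq = cong₂ ℚ._*_ (frac-* c₅ 1 m 1) (trans (cong (λ z → j ℚ.* (j ℚ.* z)) (ℚ.*-identityʳ j))
    (trans (cong (j ℚ.*_) (frac-* J 2 J 2)) (frac-* J 2 (J * J) 4)))

fractions-bound : ∀ {x J K m s} u v .{{_ : NonZero s}} → K ≤ 2 * J → u * v ≤ c₄ * (cube K * m) * (s * s) → J // 2 ℚ.≤ x →
  (u // s) ℚ.* (v // s) ℚ.≤ (c₅ // 1) ℚ.* (m // 1) ℚ.* (x ℚ.* (x ℚ.* (x ℚ.* 1ℚ)))
fractions-bound {x} {J} {K} {m} {s} u v K≤2J uv≤ J/2≤x = begin
  (u // s) ℚ.* (v // s)
    ≡⟨ frac-* u s v s ⟩
  (u * v) // (s * s)
    ≤⟨ frac-≤ (u * v) (s * s) (c₅ * m * cube J) 8 numerators ⟩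
  (c₅ * m * cube J) // 8
    ≡⟨ frac-* (c₅ * m) 1 (cube J) 8 ⟨
  ((c₅ * m) // 1) ℚ.* (cube J // 8)
    ≤⟨ log-cube-lower {x} {J} J/2≤x m ⟩
  (c₅ // 1) ℚ.* (m // 1) ℚ.* (x ℚ.* (x ℚ.* (x ℚ.* 1ℚ))) ∎
  where
  open ℚ.≤-Reasoning
  instance _ = m*n≢0 s s
  64c₄≤c₅ : 64 * c₄ ≤ c₅
  64c₄≤c₅ = ≤-trans (n≤1+n (64 * c₄)) (≤-reflexive (sym c₅≡))
  rearrange : ∀ a c J³ m s b → c * (a * J³ * m) * s * b ≡ a * b * c * m * J³ * s
  rearrange = solve-* 6 (λ a c J³ m s b → c · (a · J³ · m) · s · b ⊜ a · b · c · m · J³ · s) refl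
  numerators : u * v * 8 ≤ c₅ * m * cube J * (s * s)
  numerators = ≤-trans (*-monoˡ-≤ 8 (≤-trans uv≤ (*-monoˡ-≤ (s * s) (*-monoʳ-≤ c₄ (*-monoˡ-≤ m
      (≤-trans (cube-mono K≤2J) (≤-reflexive (cube-* 2 J))))))))
    (≤-trans (≤-reflexive (rearrange (cube 2) c₄ (cube J) m (s * s) 8))
      (*-monoˡ-≤ (s * s) (*-monoˡ-≤ (cube J) (*-monoˡ-≤ m 64c₄≤c₅))))

mainTheorem7 : ∃[ C ] ∃[ c ] 0ℝ <ℝ C × NonZero c ×
    (∀ (A : Pred ℝ 0ℓ) (∣A∣ ∣AA∣ E₃ : ℕ) .{{_ : NonZero ∣A∣}} →
    HasCard A ∣A∣ →
    (∀ x → A x → ¬ x ≈ℝ 0ℝ) →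
    HasCard (ProductSet A) ∣AA∣ →
    Energy₃⁺ A E₃ →
    E₃ ^[ 4 / 3 ] *ℝ ∣A∣ ^-[ 10 / 3 ] ≤ℝ C *ℝ fromℕ ∣AA∣ *ℝ log (2 + ∣A∣) ^ℝ c)
mainTheorem7 = fromℕ c₅ , 3 , C>0 , _ , bound
  where
  C>0 : 0ℝ <ℝ fromℕ c₅
  C>0 = 1ℚ , ℚ.positive⁻¹ 1ℚ , 0 , λ _ → frac-≤ 1 1 c₅ 1
    (*-monoˡ-≤ 1 (≤-trans (s≤s z≤n) (≤-reflexive (sym c₅≡))))

  bound : ∀ (A : Pred ℝ 0ℓ) (∣A∣ ∣AA∣ E₃ : ℕ) .{{_ : NonZero ∣A∣}} → HasCard A ∣A∣ → (∀ x → A x → ¬ x ≈ℝ 0ℝ) →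
    HasCard (ProductSet A) ∣AA∣ → Energy₃⁺ A E₃ →
    E₃ ^[ 4 / 3 ] *ℝ ∣A∣ ^-[ 10 / 3 ] ≤ℝ fromℕ c₅ *ℝ fromℕ ∣AA∣ *ℝ log (2 + ∣A∣) ^ℝ 3
  -- `≤ℝ` negates a strict inequality, which would hold with a margin ε from the index N on. The
  -- termwise bound at the single index N refutes it.
  bound A n m e cardA A≉0 cardAA energy (ε , 0<ε , N , exceeds) = ℚ.<-irrefl refl (ℚ.<-≤-trans
    (subst (ℚ._< right ℚ.+ ε) (ℚ.+-identityʳ right) (ℚ.+-monoʳ-< right 0<ε))
    (ℚ.≤-trans (exceeds ≤-refl) (pointwise (dyadic-scale n))))
    where
    right : ℚ
    right = seq (fromℕ c₅ *ℝ fromℕ m *ℝ log (2 + n) ^ℝ 3) N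
    pointwise : (∃ λ J → 1 ≤ J × 2 ^ J ≤ 2 + n × 2 + n < 2 ^ suc J) → seq (e ^[ 4 / 3 ] *ℝ n ^-[ 10 / 3 ]) N ℚ.≤ right
    pointwise (J , 1≤J , lower , upper) = fractions-bound {J = J} {suc J} {m} (rootFloor 3 (e ^ 4) 1 (suc N)) (rootFloor 3 1 (n ^ 10) (suc N))
      (≤-trans (+-monoˡ-≤ J 1≤J) (≤-reflexive (cong (J +_) (sym (+-identityʳ J)))))
      (rootFloors e n (c₄ * (cube (suc J) * m)) N (third-moment-bound {K = suc J} cardA A≉0 cardAA energy (>-nonZero⁻¹ n) (s≤s z≤n)
        (≤-<-trans (m≤n+m n 2) upper)))
      (logSum-lower J (2 + n) N lower)
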